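{- Let $L,H$ be causal models in a Markov category $\mathcal C$ with variables $V_L,V_H$. An interchange abstraction $L\to H$ with variable alignment $(\pi,\tau)$ is equivalent to a downward abstraction $(\pi,\tau)\colon(\mathrm{Int}(V_L),L)\to(\mathrm{Int}(V_H),H)$ of interchange queries such that $\pi(V_H^{\rm in})=V_L^{\rm in}$, $\pi(V_H^{\rm nin})\subseteq V_L^{\rm nin}$, and on queries $$\pi\big(\mathrm{Int}(S_1,\dots,S_n)\to O\big)=\big(\mathrm{Int}(\pi(S_1),\dots,\pi(S_n))\to\pi(O)\big)$$ for all disjoint $S_1,\dots,S_n\subseteq V_H^{\rm nin}$ and all $O\subseteq V_H^{\rm out}$. That is, restricting $\pi$ and $\tau$ to variables gives a bijection from such downward abstractions to interchange abstractions $L\to H$.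
   Context: **Categories.** A Markov category is a symmetric monoidal category with terminal unit $I$ in which each object has a commutative comonoid structure (copy, discard) compatible with $\otimes$. Morphisms are called channels; $f$ is deterministic if $\mathrm{copy}\circ f=(f\otimes f)\circ\mathrm{copy}$. Functors are strong symmetric monoidal, copy-preserving, with deterministic structure isomorphisms; natural transformations are monoidal with deterministic components; "epic" means all components are epic. **Causal models.** An open DAG is a finite DAG with vertex set $V$ and a subset $V^{\rm in}\subseteq V$ of parentless vertices (inputs); $V^{\rm nin}=V\setminus V^{\rm in}$. A causal model $M$ over it in $\mathcal C$ consists of an object of $\mathcal C$ (again written $X$) for each vertex $X$, a channel (mechanism) $c_X\colon\bigotimes_{Y\in\mathrm{Pa}(X)}Y\to X$ for each $X\in V^{\rm nin}$, and a subset $V^{\rm out}\subseteq V$ of outputs. A set of variables is also used for the list of its elements (lists of distinct variables considered up to permutation) and for the tensor of the corresponding objects. For $O\subseteq V$, $M^{O}\colon V^{\rm in}\to O$ is the channel obtained by wiring together, with copy maps, the mechanisms of all non-input variables having a directed path (possibly of length 0) to $O$, copying each $X\in O$ once more to form an output, and discarding inputs with no path to $O$. For $S\subseteq V^{\rm nin}$, $M_{\mathrm{Do}(S)}$ is obtained by deleting the mechanisms of all $X\in S$ and all edges into $S$ and making each $X\in S$ an input; so $M_{\mathrm{Do}(S)}^{O}\colon V^{\rm in}\otimes S\to O$. **Queries.** A query signature $Q$ is a set of objects (types) and a set of generators (queries), each with finite lists of input and output types; it freely generates a Markov category $\mathbf Q$. A model of $Q$ in $\mathcal C$ is a functor $[\![-]\!]\colon\mathbf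 Q\to\mathcal C$. The signature of interchange queries $\mathrm{Int}(V)$ has types $V$ and, for all $n\ge0$, pairwise disjoint $S_1,\dots,S_n\subseteq V^{\rm nin}$ and $O\subseteq V^{\rm out}$, a query $\mathrm{Int}(S_1,\dots,S_n)\to O$ whose input is $n+1$ copies of $V^{\rm in}$ and whose output is $O$. A causal model $M$ over $V$ models it by $$M_{\mathrm{Int}(S_1,\dots,S_n)}^{O}:=M_{\mathrm{Do}(S_1\cup\dots\cup S_n)}^{O}\circ\big(\mathrm{id}_{V^{\rm in}}\otimes M^{S_1}\otimes\dots\otimes M^{S_n}\big).$$ **Downward abstraction** $(\pi,\tau)\colon(Q_L,L)\to(Q_H,H)$: a functor $\pi\colon\mathbf Q_H\to\mathbf Q_L$ sending each query of $Q_H$ to a query (generator) of $Q_L$, and an epic natural transformation $\tau\colon[\![-]\!]_L\circ\pi\Rightarrow[\![-]\!]_H$. The conditions $\pi(V_H^{\rm in})=V_L^{\rm in}$ and $\pi(V_H^{\rm nin})\subseteq V_L^{\rm nin}$ are on the concatenated lists, which in particular have no repetitions. **Interchange abstraction.** A variable alignment $(\pi,\tau)$ from $V_L$ to $V_H$ is a family of pairwise disjoint subsets $\pi(X)\subseteq V_L$, $X\in V_H$, with $\pi(V_H^{\rm in})=V_L^{\rm in}$ and $\pi(V_H^{\rm out})\subseteq V_L^{\rm out}$ (with $\pi(S)=\bigcup_{X\in S}\pi(X)$), together with an epic deterministic channel $\tau_X\colon\pi(X)\to X$ for each $X\in V_H$; put $\tau_S=\bigotimes_{X\in S}\tau_X$;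 all tensor products of the $\tau_X$ are also required to be epic. It is an interchange abstraction $L\to H$ if for all pairwise disjoint $S_1,\dots,S_n\subseteq V_H^{\rm nin}$, $$\tau_{V_H^{\rm out}}\circ L_{\mathrm{Int}(\pi(S_1),\dots,\pi(S_n))}^{\pi(V_H^{\rm out})}=H_{\mathrm{Int}(S_1,\dots,S_n)}^{V_H^{\rm out}}\circ(\tau_{V_H^{\rm in}})^{\otimes(n+1)}.$$ -}

module Defs where

open import Level using (Level; _⊔_; 0ℓ) renaming (suc to lsuc)
open import Data.Nat using (ℕ; zero; suc)
open import Data.Empty using (⊥; ⊥-elim-irr)
open import Data.Fin using (Fin)
import Data.Fin.Properties as Fin
open import Data.Fin.Induction using (spo-wellFounded; spo-noetherian)
open import Data.Fin.Subset
  renaming (⊥ to ∅)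
  using (Subset; _∈_; _∉_; _⊆_; _∪_; _∩_; ∁; ⋃; ⁅_⁆; Empty)
open import Data.Fin.Subset.Properties
  using (_∈?_; p⊆p∪q; q⊆p∪q; x∈p∪q⁺; x∈p∪q⁻; x∈⁅x⁆; ∉⊥)
open import Data.List using (List; []; _∷_; [_]; _++_; map; filter; allFin)
open import Data.List.Membership.Propositional using () renaming (_∈_ to _∈ₗ_; _∉_ to _∉ₗ_)
open import Data.List.Membership.Propositional.Properties
  using (∈-++⁺ˡ; ∈-++⁺ʳ; ∈-++⁻; ∈-filter⁺; ∈-filter⁻; ∈-allFin)
import Data.List.Membership.DecPropositional as DecMembership
open import Data.List.Relation.Binary.Permutation.Propositional using (_↭_)
open import Data.List.Relation.Binary.Permutation.Propositional.Properties using (∈-resp-↭)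
open import Data.List.Relation.Binary.Subset.Propositional using () renaming (_⊆_ to _⊆ₗ_)
open import Data.List.Relation.Unary.All using (All)
open import Data.List.Relation.Unary.Any using (here; there)
open import Data.List.Relation.Unary.Unique.Propositional using (Unique)
open import Data.Product using (Σ; ∃; Σ-syntax; ∃-syntax; _×_; _,_; proj₁; proj₂)
open import Data.Sum using (_⊎_; inj₁; inj₂; [_,_]′)
open import Data.Vec using (Vec; []; _∷_; lookup; toList) renaming (map to mapᵥ)
open import Function using (flip; _$_)
open import Induction.WellFounded using (WellFounded; Acc; acc; module Subrelation)
open import Relation.Binary using (Rel; IsEquivalence; IsStrictPartialOrder; Setoid)
open import Relation.Binary.Construct.Closure.ReflexiveTransitive using (Star; ε; _◅_)
open import Relation.Binary.Construct.Closure.Transitive as Plus using (TransClosure)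
open import Relation.Binary.PropositionalEquality
  using (_≡_; _≢_; refl; sym; trans; subst; isEquivalence)
import Relation.Binary.Reasoning.Setoid as SetoidReasoning
open import Relation.Nullary using (¬_; Dec; yes; no; contradiction)
open import Relation.Nullary.Decidable using (map′; _×-dec_; _⊎-dec_; ¬?)

private
  variable
    o ℓ e o′ ℓ′ e′ o″ ℓ″ e″ : Level

record MarkovCategory (o ℓ e : Level) : Set (lsuc (o ⊔ ℓ ⊔ e)) where
  infix  4 _⇒_ _≈_
  infixr 9 _∘_
  infixr 10 _⊗₀_ _⊗₁_
  field
    Obj : Set o
    _⇒_ : Obj → Obj → Set ℓ
    _≈_ : ∀ {A B} → Rel (A ⇒ B) e
    equiv : ∀ {A B} → IsEquivalence (_≈_ {A} {B})

    id  : ∀ {A} → A ⇒ A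
    _∘_ : ∀ {A B C} → B ⇒ C → A ⇒ B → A ⇒ C
    ∘-resp-≈ : ∀ {A B C} {f g : B ⇒ C} {h k : A ⇒ B} → f ≈ g → h ≈ k → f ∘ h ≈ g ∘ k
    assoc : ∀ {A B C D} {f : C ⇒ D} {g : B ⇒ C} {h : A ⇒ B} → (f ∘ g) ∘ h ≈ f ∘ (g ∘ h)
    identityˡ : ∀ {A B} {f : A ⇒ B} → id ∘ f ≈ f
    identityʳ : ∀ {A B} {f : A ⇒ B} → f ∘ id ≈ f

    I : Obj
    _⊗₀_ : Obj → Obj → Obj
    _⊗₁_ : ∀ {A B C D} → A ⇒ B → C ⇒ D → A ⊗₀ C ⇒ B ⊗₀ D
    ⊗-resp-≈ : ∀ {A B C D} {f g : A ⇒ B} {h k : C ⇒ D} → f ≈ g → h ≈ k → f ⊗₁ h ≈ g ⊗₁ k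
    ⊗-id : ∀ {A B} → id {A} ⊗₁ id {B} ≈ id
    ⊗-∘  : ∀ {A B C A′ B′ C′} {f : B ⇒ C} {g : A ⇒ B} {f′ : B′ ⇒ C′} {g′ : A′ ⇒ B′} →
           (f ∘ g) ⊗₁ (f′ ∘ g′) ≈ (f ⊗₁ f′) ∘ (g ⊗₁ g′)

    α   : ∀ {A B C} → (A ⊗₀ B) ⊗₀ C ⇒ A ⊗₀ (B ⊗₀ C)
    α⁻¹ : ∀ {A B C} → A ⊗₀ (B ⊗₀ C) ⇒ (A ⊗₀ B) ⊗₀ C
    lu   : ∀ {A} → I ⊗₀ A ⇒ A
    lu⁻¹ : ∀ {A} → A ⇒ I ⊗₀ A
    ru   : ∀ {A} → A ⊗₀ I ⇒ A
    ru⁻¹ : ∀ {A} → A ⇒ A ⊗₀ I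
    σ   : ∀ {A B} → A ⊗₀ B ⇒ B ⊗₀ A

    α-isoˡ  : ∀ {A B C} → α⁻¹ ∘ α {A} {B} {C} ≈ id
    α-isoʳ  : ∀ {A B C} → α {A} {B} {C} ∘ α⁻¹ ≈ id
    lu-isoˡ : ∀ {A} → lu⁻¹ ∘ lu {A} ≈ id
    lu-isoʳ : ∀ {A} → lu {A} ∘ lu⁻¹ ≈ id
    ru-isoˡ : ∀ {A} → ru⁻¹ ∘ ru {A} ≈ id
    ru-isoʳ : ∀ {A} → ru {A} ∘ ru⁻¹ ≈ id
    σ-invol : ∀ {A B} → σ {B} {A} ∘ σ {A} {B} ≈ id

    α-natural  : ∀ {A B C A′ B′ C′} {f : A ⇒ A′} {g : B ⇒ B′} {h : C ⇒ C′} →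
                 α ∘ ((f ⊗₁ g) ⊗₁ h) ≈ (f ⊗₁ (g ⊗₁ h)) ∘ α
    lu-natural : ∀ {A B} {f : A ⇒ B} → lu ∘ (id ⊗₁ f) ≈ f ∘ lu
    ru-natural : ∀ {A B} {f : A ⇒ B} → ru ∘ (f ⊗₁ id) ≈ f ∘ ru
    σ-natural  : ∀ {A B A′ B′} {f : A ⇒ A′} {g : B ⇒ B′} → σ ∘ (f ⊗₁ g) ≈ (g ⊗₁ f) ∘ σ

    triangle : ∀ {A B} → (id {A} ⊗₁ lu {B}) ∘ α ≈ ru ⊗₁ id
    pentagon : ∀ {A B C D} →
               (id {A} ⊗₁ α {B} {C} {D}) ∘ (α ∘ (α ⊗₁ id)) ≈ α ∘ α
    hexagon  : ∀ {A B C} →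
               (id {B} ⊗₁ σ {A} {C}) ∘ (α ∘ (σ ⊗₁ id)) ≈ α ∘ (σ ∘ α)

    ! : ∀ {A} → A ⇒ I
    !-unique : ∀ {A} (f : A ⇒ I) → f ≈ !

  -- (A ⊗ A) ⊗ (B ⊗ B) ⇒ (A ⊗ B) ⊗ (A ⊗ B), exchanging the two middle factors.
  middle : ∀ {A B} → (A ⊗₀ A) ⊗₀ (B ⊗₀ B) ⇒ (A ⊗₀ B) ⊗₀ (A ⊗₀ B)
  middle = α⁻¹ ∘ ((id ⊗₁ (α ∘ ((σ ⊗₁ id) ∘ α⁻¹))) ∘ α)

  field
    copy : ∀ {A} → A ⇒ A ⊗₀ A
    copy-assoc : ∀ {A} → α ∘ ((copy ⊗₁ id) ∘ copy) ≈ (id ⊗₁ copy) ∘ copy {A}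
    copy-unit  : ∀ {A} → lu ∘ ((! ⊗₁ id) ∘ copy) ≈ id {A}
    copy-comm  : ∀ {A} → σ ∘ copy ≈ copy {A}
    -- The analogous conditions on ! and on copy {I} hold because I is terminal.
    copy-⊗     : ∀ {A B} → copy {A ⊗₀ B} ≈ middle ∘ (copy ⊗₁ copy)

  Deterministic : ∀ {A B} → A ⇒ B → Set e
  Deterministic f = copy ∘ f ≈ (f ⊗₁ f) ∘ copy

  Epic : ∀ {A B} → A ⇒ B → Set (o ⊔ ℓ ⊔ e)
  Epic {A} {B} f = ∀ {X} (g h : B ⇒ X) → g ∘ f ≈ h ∘ f → g ≈ h

  hom-setoid : ∀ {A B} → Setoid ℓ e
  hom-setoid {A} {B} = record { isEquivalence = equiv {A} {B} }

  module Equiv {A B} = IsEquivalence (equiv {A} {B})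
  module HomReasoning {A B} = SetoidReasoning (hom-setoid {A} {B})

  ∘-congˡ : ∀ {A B C} {f : B ⇒ C} {h k : A ⇒ B} → h ≈ k → f ∘ h ≈ f ∘ k
  ∘-congˡ p = ∘-resp-≈ Equiv.refl p

  ∘-congʳ : ∀ {A B C} {f g : B ⇒ C} {h : A ⇒ B} → f ≈ g → f ∘ h ≈ g ∘ h
  ∘-congʳ p = ∘-resp-≈ p Equiv.refl

record Functor (𝒞 : MarkovCategory o ℓ e) (𝒟 : MarkovCategory o′ ℓ′ e′)
       : Set (o ⊔ ℓ ⊔ e ⊔ o′ ⊔ ℓ′ ⊔ e′) where
  private
    module C = MarkovCategory 𝒞
    module D = MarkovCategory 𝒟
  field
    F₀ : C.Obj → D.Obj
    F₁ : ∀ {A B} → A C.⇒ B → F₀ A D.⇒ F₀ B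
    F-resp-≈ : ∀ {A B} {f g : A C.⇒ B} → f C.≈ g → F₁ f D.≈ F₁ g
    F-id : ∀ {A} → F₁ (C.id {A}) D.≈ D.id
    F-∘  : ∀ {A B E} {f : B C.⇒ E} {g : A C.⇒ B} → F₁ (f C.∘ g) D.≈ F₁ f D.∘ F₁ g

    μ   : ∀ {A B} → F₀ A D.⊗₀ F₀ B D.⇒ F₀ (A C.⊗₀ B)
    μ⁻¹ : ∀ {A B} → F₀ (A C.⊗₀ B) D.⇒ F₀ A D.⊗₀ F₀ B
    η   : D.I D.⇒ F₀ C.I
    η⁻¹ : F₀ C.I D.⇒ D.I
    μ-isoˡ : ∀ {A B} → μ⁻¹ D.∘ μ {A} {B} D.≈ D.id
    μ-isoʳ : ∀ {A B} → μ {A} {B} D.∘ μ⁻¹ D.≈ D.id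
    η-isoˡ : η⁻¹ D.∘ η D.≈ D.id
    η-isoʳ : η D.∘ η⁻¹ D.≈ D.id

    μ-natural : ∀ {A B A′ B′} {f : A C.⇒ A′} {g : B C.⇒ B′} →
                μ D.∘ (F₁ f D.⊗₁ F₁ g) D.≈ F₁ (f C.⊗₁ g) D.∘ μ
    μ-assoc : ∀ {A B E} →
              F₁ (C.α {A} {B} {E}) D.∘ (μ D.∘ (μ D.⊗₁ D.id))
                D.≈ μ D.∘ ((D.id D.⊗₁ μ) D.∘ D.α)
    μ-unitˡ : ∀ {A} → F₁ (C.lu {A}) D.∘ (μ D.∘ (η D.⊗₁ D.id)) D.≈ D.lu
    μ-unitʳ : ∀ {A} → F₁ (C.ru {A}) D.∘ (μ D.∘ (D.id D.⊗₁ η)) D.≈ D.ru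
    μ-symm  : ∀ {A B} → F₁ (C.σ {A} {B}) D.∘ μ D.≈ μ D.∘ D.σ
    F-copy  : ∀ {A} → F₁ (C.copy {A}) D.≈ μ D.∘ D.copy

    μ-det : ∀ {A B} → D.Deterministic (μ {A} {B})
    η-det : D.Deterministic η

_∘F_ : {𝒞 : MarkovCategory o ℓ e} {𝒟 : MarkovCategory o′ ℓ′ e′} {ℰ : MarkovCategory o″ ℓ″ e″} →
       Functor 𝒟 ℰ → Functor 𝒞 𝒟 → Functor 𝒞 ℰ
_∘F_ {𝒞 = 𝒞} {𝒟} {ℰ} G F = record
  { F₀ = λ A → G.F₀ (F.F₀ A)
  ; F₁ = λ f → G.F₁ (F.F₁ f)
  ; F-resp-≈ = λ p → G.F-resp-≈ (F.F-resp-≈ p)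
  ; F-id = Equiv.trans (G.F-resp-≈ F.F-id) G.F-id
  ; F-∘ = Equiv.trans (G.F-resp-≈ F.F-∘) G.F-∘
  ; μ = G.F₁ F.μ ∘ G.μ
  ; μ⁻¹ = G.μ⁻¹ ∘ G.F₁ F.μ⁻¹
  ; η = G.F₁ F.η ∘ G.η
  ; η⁻¹ = G.η⁻¹ ∘ G.F₁ F.η⁻¹
  ; μ-isoˡ = inverse (image-inverse F.μ-isoˡ) G.μ-isoˡ
  ; μ-isoʳ = inverse G.μ-isoʳ (image-inverse F.μ-isoʳ)
  ; η-isoˡ = inverse (image-inverse F.η-isoˡ) G.η-isoˡ
  ; η-isoʳ = inverse G.η-isoʳ (image-inverse F.η-isoʳ)
  ; μ-natural = begin
      (G.F₁ F.μ ∘ G.μ) ∘ (G.F₁ (F.F₁ _) ⊗₁ G.F₁ (F.F₁ _))  ≈⟨ assoc ⟩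
      G.F₁ F.μ ∘ (G.μ ∘ (G.F₁ (F.F₁ _) ⊗₁ G.F₁ (F.F₁ _)))  ≈⟨ ∘-congˡ G.μ-natural ⟩
      G.F₁ F.μ ∘ (G.F₁ (F.F₁ _ D.⊗₁ F.F₁ _) ∘ G.μ)         ≈⟨ square F.μ-natural ⟩
      G.F₁ (F.F₁ _) ∘ (G.F₁ F.μ ∘ G.μ)                     ∎
  ; μ-assoc = begin
      GF α-C ∘ ((G.F₁ F.μ ∘ G.μ) ∘ ((G.F₁ F.μ ∘ G.μ) ⊗₁ id))
        ≈⟨ ∘-congˡ (∘-congˡ splitˡ) ⟩
      GF α-C ∘ ((G.F₁ F.μ ∘ G.μ) ∘ ((G.F₁ F.μ ⊗₁ G.F₁ D.id) ∘ (G.μ ⊗₁ id)))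
        ≈⟨ ∘-congˡ slide ⟩
      GF α-C ∘ (G.F₁ F.μ ∘ (G.F₁ (F.μ D.⊗₁ D.id) ∘ (G.μ ∘ (G.μ ⊗₁ id))))
        ≈⟨ ∘-congˡ join ⟩
      GF α-C ∘ (G.F₁ (F.μ D.∘ (F.μ D.⊗₁ D.id)) ∘ (G.μ ∘ (G.μ ⊗₁ id)))
        ≈⟨ square F.μ-assoc ⟩
      G.F₁ F.μ ∘ (G.F₁ ((D.id D.⊗₁ F.μ) D.∘ D.α) ∘ (G.μ ∘ (G.μ ⊗₁ id)))
        ≈⟨ ∘-congˡ (Equiv.trans (∘-congʳ G.F-∘) assoc) ⟩
      G.F₁ F.μ ∘ (G.F₁ (D.id D.⊗₁ F.μ) ∘ (G.F₁ D.α ∘ (G.μ ∘ (G.μ ⊗₁ id))))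
        ≈⟨ ∘-congˡ (∘-congˡ G.μ-assoc) ⟩
      G.F₁ F.μ ∘ (G.F₁ (D.id D.⊗₁ F.μ) ∘ (G.μ ∘ ((id ⊗₁ G.μ) ∘ α)))
        ≈⟨ ∘-congˡ (∘-congˡ (Equiv.sym assoc)) ⟩
      G.F₁ F.μ ∘ (G.F₁ (D.id D.⊗₁ F.μ) ∘ ((G.μ ∘ (id ⊗₁ G.μ)) ∘ α))
        ≈⟨ ∘-congˡ (Equiv.sym assoc) ⟩
      G.F₁ F.μ ∘ ((G.F₁ (D.id D.⊗₁ F.μ) ∘ (G.μ ∘ (id ⊗₁ G.μ))) ∘ α)
        ≈⟨ Equiv.sym assoc ⟩
      (G.F₁ F.μ ∘ (G.F₁ (D.id D.⊗₁ F.μ) ∘ (G.μ ∘ (id ⊗₁ G.μ)))) ∘ α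
        ≈⟨ ∘-congʳ (Equiv.sym slide) ⟩
      ((G.F₁ F.μ ∘ G.μ) ∘ ((G.F₁ D.id ⊗₁ G.F₁ F.μ) ∘ (id ⊗₁ G.μ))) ∘ α
        ≈⟨ ∘-congʳ (∘-congˡ (Equiv.sym splitʳ)) ⟩
      ((G.F₁ F.μ ∘ G.μ) ∘ (id ⊗₁ (G.F₁ F.μ ∘ G.μ))) ∘ α
        ≈⟨ assoc ⟩
      (G.F₁ F.μ ∘ G.μ) ∘ ((id ⊗₁ (G.F₁ F.μ ∘ G.μ)) ∘ α)
        ∎
  ; μ-unitˡ = begin
      GF C.lu ∘ ((G.F₁ F.μ ∘ G.μ) ∘ ((G.F₁ F.η ∘ G.η) ⊗₁ id))
        ≈⟨ ∘-congˡ (Equiv.trans (∘-congˡ splitˡ) (Equiv.trans slide join)) ⟩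
      GF C.lu ∘ (G.F₁ (F.μ D.∘ (F.η D.⊗₁ D.id)) ∘ (G.μ ∘ (G.η ⊗₁ id)))
        ≈⟨ absorb F.μ-unitˡ ⟩
      G.F₁ D.lu ∘ (G.μ ∘ (G.η ⊗₁ id))
        ≈⟨ G.μ-unitˡ ⟩
      lu ∎
  ; μ-unitʳ = begin
      GF C.ru ∘ ((G.F₁ F.μ ∘ G.μ) ∘ (id ⊗₁ (G.F₁ F.η ∘ G.η)))
        ≈⟨ ∘-congˡ (Equiv.trans (∘-congˡ splitʳ) (Equiv.trans slide join)) ⟩
      GF C.ru ∘ (G.F₁ (F.μ D.∘ (D.id D.⊗₁ F.η)) ∘ (G.μ ∘ (id ⊗₁ G.η)))
        ≈⟨ absorb F.μ-unitʳ ⟩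
      G.F₁ D.ru ∘ (G.μ ∘ (id ⊗₁ G.η))
        ≈⟨ G.μ-unitʳ ⟩
      ru ∎
  ; μ-symm = begin
      GF C.σ ∘ (G.F₁ F.μ ∘ G.μ)   ≈⟨ square F.μ-symm ⟩
      G.F₁ F.μ ∘ (G.F₁ D.σ ∘ G.μ) ≈⟨ ∘-congˡ G.μ-symm ⟩
      G.F₁ F.μ ∘ (G.μ ∘ σ)        ≈⟨ Equiv.sym assoc ⟩
      (G.F₁ F.μ ∘ G.μ) ∘ σ        ∎
  ; F-copy = begin
      GF C.copy                   ≈⟨ G.F-resp-≈ F.F-copy ⟩
      G.F₁ (F.μ D.∘ D.copy)       ≈⟨ G.F-∘ ⟩
      G.F₁ F.μ ∘ G.F₁ D.copy      ≈⟨ ∘-congˡ G.F-copy ⟩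
      G.F₁ F.μ ∘ (G.μ ∘ copy)     ≈⟨ Equiv.sym assoc ⟩
      (G.F₁ F.μ ∘ G.μ) ∘ copy     ∎
  ; μ-det = ∘-det (F₁-det F.μ-det) G.μ-det
  ; η-det = ∘-det (F₁-det F.η-det) G.η-det
  }
  where
    module C = MarkovCategory 𝒞
    module D = MarkovCategory 𝒟
    module F = Functor F
    module G = Functor G
    open MarkovCategory ℰ
    open HomReasoning

    GF : ∀ {A B} → A C.⇒ B → G.F₀ (F.F₀ A) ⇒ G.F₀ (F.F₀ B)
    GF f = G.F₁ (F.F₁ f)

    α-C : ∀ {A B E} → (A C.⊗₀ B) C.⊗₀ E C.⇒ A C.⊗₀ (B C.⊗₀ E)
    α-C = C.α

    image-inverse : ∀ {A B} {f : A D.⇒ B} {g : B D.⇒ A} → f D.∘ g D.≈ D.id →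
                    G.F₁ f ∘ G.F₁ g ≈ id
    image-inverse p = Equiv.trans (Equiv.sym G.F-∘) (Equiv.trans (G.F-resp-≈ p) G.F-id)

    inverse : ∀ {X Y Z} {f : Y ⇒ X} {g : Z ⇒ Y} {h : Y ⇒ Z} {k : X ⇒ Y} →
              g ∘ h ≈ id → f ∘ k ≈ id → (f ∘ g) ∘ (h ∘ k) ≈ id
    inverse {f = f} {g} {h} {k} p q = begin
      (f ∘ g) ∘ (h ∘ k) ≈⟨ assoc ⟩
      f ∘ (g ∘ (h ∘ k)) ≈⟨ ∘-congˡ (Equiv.sym assoc) ⟩
      f ∘ ((g ∘ h) ∘ k) ≈⟨ ∘-congˡ (∘-congʳ p) ⟩
      f ∘ (id ∘ k)      ≈⟨ ∘-congˡ identityˡ ⟩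
      f ∘ k             ≈⟨ q ⟩
      id                ∎

    square : ∀ {X A B B′ E} {f : B D.⇒ E} {g : A D.⇒ B} {h : B′ D.⇒ E} {k : A D.⇒ B′}
             {x : X ⇒ G.F₀ A} → f D.∘ g D.≈ h D.∘ k →
             G.F₁ f ∘ (G.F₁ g ∘ x) ≈ G.F₁ h ∘ (G.F₁ k ∘ x)
    square {f = f} {g} {h} {k} {x} p = begin
      G.F₁ f ∘ (G.F₁ g ∘ x) ≈⟨ Equiv.sym assoc ⟩
      (G.F₁ f ∘ G.F₁ g) ∘ x ≈⟨ ∘-congʳ (Equiv.sym G.F-∘) ⟩
      G.F₁ (f D.∘ g) ∘ x    ≈⟨ ∘-congʳ (G.F-resp-≈ p) ⟩
      G.F₁ (h D.∘ k) ∘ x    ≈⟨ ∘-congʳ G.F-∘ ⟩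
      (G.F₁ h ∘ G.F₁ k) ∘ x ≈⟨ assoc ⟩
      G.F₁ h ∘ (G.F₁ k ∘ x) ∎

    absorb : ∀ {X A B E} {f : B D.⇒ E} {g : A D.⇒ B} {h : A D.⇒ E} {x : X ⇒ G.F₀ A} →
             f D.∘ g D.≈ h → G.F₁ f ∘ (G.F₁ g ∘ x) ≈ G.F₁ h ∘ x
    absorb p = Equiv.trans (Equiv.sym assoc)
                 (∘-congʳ (Equiv.trans (Equiv.sym G.F-∘) (G.F-resp-≈ p)))

    join : ∀ {X A B E} {f : B D.⇒ E} {g : A D.⇒ B} {x : X ⇒ G.F₀ A} →
           G.F₁ f ∘ (G.F₁ g ∘ x) ≈ G.F₁ (f D.∘ g) ∘ x
    join = Equiv.trans (Equiv.sym assoc) (∘-congʳ (Equiv.sym G.F-∘))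

    splitˡ : ∀ {X Y Z A} {f : Y ⇒ Z} {g : X ⇒ Y} →
             (f ∘ g) ⊗₁ id {G.F₀ A} ≈ (f ⊗₁ G.F₁ (D.id {A})) ∘ (g ⊗₁ id)
    splitˡ = Equiv.trans
      (⊗-resp-≈ Equiv.refl
        (Equiv.trans (Equiv.sym identityˡ) (∘-congʳ (Equiv.sym G.F-id)))) ⊗-∘

    splitʳ : ∀ {X Y Z A} {f : Y ⇒ Z} {g : X ⇒ Y} →
             id {G.F₀ A} ⊗₁ (f ∘ g) ≈ (G.F₁ (D.id {A}) ⊗₁ f) ∘ (id ⊗₁ g)
    splitʳ = Equiv.trans
      (⊗-resp-≈ (Equiv.trans (Equiv.sym identityˡ) (∘-congʳ (Equiv.sym G.F-id)))
        Equiv.refl) ⊗-∘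

    slide : ∀ {X A B A′ B′ E} {h : A′ D.⊗₀ B′ D.⇒ E} {f : A D.⇒ A′} {g : B D.⇒ B′}
            {x : X ⇒ G.F₀ A ⊗₀ G.F₀ B} →
            (G.F₁ h ∘ G.μ) ∘ ((G.F₁ f ⊗₁ G.F₁ g) ∘ x)
              ≈ G.F₁ h ∘ (G.F₁ (f D.⊗₁ g) ∘ (G.μ ∘ x))
    slide {h = h} {f} {g} {x} = begin
      (G.F₁ h ∘ G.μ) ∘ ((G.F₁ f ⊗₁ G.F₁ g) ∘ x) ≈⟨ assoc ⟩
      G.F₁ h ∘ (G.μ ∘ ((G.F₁ f ⊗₁ G.F₁ g) ∘ x)) ≈⟨ ∘-congˡ (Equiv.sym assoc) ⟩
      G.F₁ h ∘ ((G.μ ∘ (G.F₁ f ⊗₁ G.F₁ g)) ∘ x) ≈⟨ ∘-congˡ (∘-congʳ G.μ-natural) ⟩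
      G.F₁ h ∘ ((G.F₁ (f D.⊗₁ g) ∘ G.μ) ∘ x)    ≈⟨ ∘-congˡ assoc ⟩
      G.F₁ h ∘ (G.F₁ (f D.⊗₁ g) ∘ (G.μ ∘ x))    ∎

    F₁-det : ∀ {A B} {f : A D.⇒ B} → D.Deterministic f → Deterministic (G.F₁ f)
    F₁-det {f = f} p = begin
      copy ∘ G.F₁ f                             ≈⟨ Equiv.sym identityˡ ⟩
      id ∘ (copy ∘ G.F₁ f)                      ≈⟨ ∘-congʳ (Equiv.sym G.μ-isoˡ) ⟩
      (G.μ⁻¹ ∘ G.μ) ∘ (copy ∘ G.F₁ f)           ≈⟨ assoc ⟩
      G.μ⁻¹ ∘ (G.μ ∘ (copy ∘ G.F₁ f))           ≈⟨ ∘-congˡ (Equiv.sym assoc) ⟩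
      G.μ⁻¹ ∘ ((G.μ ∘ copy) ∘ G.F₁ f)           ≈⟨ ∘-congˡ (∘-congʳ (Equiv.sym G.F-copy)) ⟩
      G.μ⁻¹ ∘ (G.F₁ D.copy ∘ G.F₁ f)            ≈⟨ ∘-congˡ (Equiv.sym G.F-∘) ⟩
      G.μ⁻¹ ∘ G.F₁ (D.copy D.∘ f)               ≈⟨ ∘-congˡ (G.F-resp-≈ p) ⟩
      G.μ⁻¹ ∘ G.F₁ ((f D.⊗₁ f) D.∘ D.copy)      ≈⟨ ∘-congˡ G.F-∘ ⟩
      G.μ⁻¹ ∘ (G.F₁ (f D.⊗₁ f) ∘ G.F₁ D.copy)   ≈⟨ ∘-congˡ (∘-congˡ G.F-copy) ⟩
      G.μ⁻¹ ∘ (G.F₁ (f D.⊗₁ f) ∘ (G.μ ∘ copy))  ≈⟨ ∘-congˡ (Equiv.sym assoc) ⟩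
      G.μ⁻¹ ∘ ((G.F₁ (f D.⊗₁ f) ∘ G.μ) ∘ copy)  ≈⟨ ∘-congˡ (∘-congʳ (Equiv.sym G.μ-natural)) ⟩
      G.μ⁻¹ ∘ ((G.μ ∘ (G.F₁ f ⊗₁ G.F₁ f)) ∘ copy) ≈⟨ ∘-congˡ assoc ⟩
      G.μ⁻¹ ∘ (G.μ ∘ ((G.F₁ f ⊗₁ G.F₁ f) ∘ copy)) ≈⟨ Equiv.sym assoc ⟩
      (G.μ⁻¹ ∘ G.μ) ∘ ((G.F₁ f ⊗₁ G.F₁ f) ∘ copy) ≈⟨ ∘-congʳ G.μ-isoˡ ⟩
      id ∘ ((G.F₁ f ⊗₁ G.F₁ f) ∘ copy)          ≈⟨ identityˡ ⟩
      (G.F₁ f ⊗₁ G.F₁ f) ∘ copy                 ∎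

    ∘-det : ∀ {X Y Z} {f : Y ⇒ Z} {g : X ⇒ Y} →
            Deterministic f → Deterministic g → Deterministic (f ∘ g)
    ∘-det {f = f} {g} p q = begin
      copy ∘ (f ∘ g)             ≈⟨ Equiv.sym assoc ⟩
      (copy ∘ f) ∘ g             ≈⟨ ∘-congʳ p ⟩
      ((f ⊗₁ f) ∘ copy) ∘ g      ≈⟨ assoc ⟩
      (f ⊗₁ f) ∘ (copy ∘ g)      ≈⟨ ∘-congˡ q ⟩
      (f ⊗₁ f) ∘ ((g ⊗₁ g) ∘ copy) ≈⟨ Equiv.sym assoc ⟩
      ((f ⊗₁ f) ∘ (g ⊗₁ g)) ∘ copy ≈⟨ ∘-congʳ (Equiv.sym ⊗-∘) ⟩
      ((f ∘ g) ⊗₁ (f ∘ g)) ∘ copy ∎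

record Transformation {𝒞 : MarkovCategory o ℓ e} {𝒟 : MarkovCategory o′ ℓ′ e′}
       (F G : Functor 𝒞 𝒟) : Set (o ⊔ ℓ ⊔ e ⊔ o′ ⊔ ℓ′ ⊔ e′) where
  private
    module C = MarkovCategory 𝒞
    module D = MarkovCategory 𝒟
    module F = Functor F
    module G = Functor G
  field
    at : ∀ A → F.F₀ A D.⇒ G.F₀ A
    natural : ∀ {A B} (f : A C.⇒ B) → at B D.∘ F.F₁ f D.≈ G.F₁ f D.∘ at A
    at-⊗ : ∀ {A B} → at (A C.⊗₀ B) D.∘ F.μ D.≈ G.μ D.∘ (at A D.⊗₁ at B)
    at-unit : at C.I D.∘ F.η D.≈ G.η
    at-det : ∀ A → D.Deterministic (at A)

infixr 10 _⊗_

-- Objects of the free category below, which is not strict: bracketed lists.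
data Tensor (T : Set) : Set where
  unit : Tensor T
  var  : T → Tensor T
  _⊗_  : Tensor T → Tensor T → Tensor T

fold : ∀ {a} {T : Set} {X : Set a} → X → (X → X → X) → (T → X) → Tensor T → X
fold i _·_ f unit    = i
fold i _·_ f (var x) = f x
fold i _·_ f (A ⊗ B) = fold i _·_ f A · fold i _·_ f B

substitute : {S T : Set} → (S → Tensor T) → Tensor S → Tensor T
substitute = fold unit _⊗_

vars : {T : Set} → Tensor T → List T
vars = fold [] _++_ [_]

⨂ : {T : Set} → List T → Tensor T
⨂ []       = unit
⨂ (x ∷ xs) = var x ⊗ ⨂ xs

power : {T : Set} → ℕ → Tensor T → Tensor T
power zero    A = unit
power (suc k) A = A ⊗ power k A

record Signature : Set₁ where
  field
    Type  : Set
    Query : Set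
    dom cod : Query → Tensor Type

module _ (Q : Signature) where
  open Signature Q

  infixr 9 _∘ᵗ_
  infixr 10 _⊗ᵗ_

  data Term : Tensor Type → Tensor Type → Set where
    gen  : ∀ q → Term (dom q) (cod q)
    idᵗ   : ∀ {A} → Term A A
    _∘ᵗ_  : ∀ {A B C} → Term B C → Term A B → Term A C
    _⊗ᵗ_ : ∀ {A B C D} → Term A B → Term C D → Term (A ⊗ C) (B ⊗ D)
    αᵗ    : ∀ {A B C} → Term ((A ⊗ B) ⊗ C) (A ⊗ (B ⊗ C))
    α⁻¹ᵗ  : ∀ {A B C} → Term (A ⊗ (B ⊗ C)) ((A ⊗ B) ⊗ C)
    luᵗ   : ∀ {A} → Term (unit ⊗ A) A
    lu⁻¹ᵗ : ∀ {A} → Term A (unit ⊗ A)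
    ruᵗ   : ∀ {A} → Term (A ⊗ unit) A
    ru⁻¹ᵗ : ∀ {A} → Term A (A ⊗ unit)
    σᵗ    : ∀ {A B} → Term (A ⊗ B) (B ⊗ A)
    !ᵗ    : ∀ {A} → Term A unit
    copyᵗ : ∀ {A} → Term A (A ⊗ A)

module _ {Q : Signature} where
  infix 4 _≈ᵗ_

  data _≈ᵗ_ : ∀ {A B} → Term Q A B → Term Q A B → Set where
    ≈-refl  : ∀ {A B} {f : Term Q A B} → f ≈ᵗ f
    ≈-sym   : ∀ {A B} {f g : Term Q A B} → f ≈ᵗ g → g ≈ᵗ f
    ≈-trans : ∀ {A B} {f g h : Term Q A B} → f ≈ᵗ g → g ≈ᵗ h → f ≈ᵗ h

    ∘-resp-≈ : ∀ {A B C} {f g : Term Q B C} {h k : Term Q A B} →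
               f ≈ᵗ g → h ≈ᵗ k → f ∘ᵗ h ≈ᵗ g ∘ᵗ k
    assoc : ∀ {A B C D} {f : Term Q C D} {g : Term Q B C} {h : Term Q A B} →
            (f ∘ᵗ g) ∘ᵗ h ≈ᵗ f ∘ᵗ (g ∘ᵗ h)
    identityˡ : ∀ {A B} {f : Term Q A B} → idᵗ ∘ᵗ f ≈ᵗ f
    identityʳ : ∀ {A B} {f : Term Q A B} → f ∘ᵗ idᵗ ≈ᵗ f

    ⊗-resp-≈ : ∀ {A B C D} {f g : Term Q A B} {h k : Term Q C D} →
               f ≈ᵗ g → h ≈ᵗ k → f ⊗ᵗ h ≈ᵗ g ⊗ᵗ k
    ⊗-id : ∀ {A B} → idᵗ {A = A} ⊗ᵗ idᵗ {A = B} ≈ᵗ idᵗ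
    ⊗-∘  : ∀ {A B C A′ B′ C′} {f : Term Q B C} {g : Term Q A B}
           {f′ : Term Q B′ C′} {g′ : Term Q A′ B′} →
           (f ∘ᵗ g) ⊗ᵗ (f′ ∘ᵗ g′) ≈ᵗ (f ⊗ᵗ f′) ∘ᵗ (g ⊗ᵗ g′)

    α-isoˡ  : ∀ {A B C} → α⁻¹ᵗ ∘ᵗ αᵗ {A = A} {B} {C} ≈ᵗ idᵗ
    α-isoʳ  : ∀ {A B C} → αᵗ {A = A} {B} {C} ∘ᵗ α⁻¹ᵗ ≈ᵗ idᵗ
    lu-isoˡ : ∀ {A} → lu⁻¹ᵗ ∘ᵗ luᵗ {A = A} ≈ᵗ idᵗ
    lu-isoʳ : ∀ {A} → luᵗ {A = A} ∘ᵗ lu⁻¹ᵗ ≈ᵗ idᵗ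
    ru-isoˡ : ∀ {A} → ru⁻¹ᵗ ∘ᵗ ruᵗ {A = A} ≈ᵗ idᵗ
    ru-isoʳ : ∀ {A} → ruᵗ {A = A} ∘ᵗ ru⁻¹ᵗ ≈ᵗ idᵗ
    σ-invol : ∀ {A B} → σᵗ {A = B} {A} ∘ᵗ σᵗ {A = A} {B} ≈ᵗ idᵗ

    α-natural  : ∀ {A B C A′ B′ C′}
                 {f : Term Q A A′} {g : Term Q B B′} {h : Term Q C C′} →
                 αᵗ ∘ᵗ ((f ⊗ᵗ g) ⊗ᵗ h) ≈ᵗ (f ⊗ᵗ (g ⊗ᵗ h)) ∘ᵗ αᵗ
    lu-natural : ∀ {A B} {f : Term Q A B} → luᵗ ∘ᵗ (idᵗ ⊗ᵗ f) ≈ᵗ f ∘ᵗ luᵗ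
    ru-natural : ∀ {A B} {f : Term Q A B} → ruᵗ ∘ᵗ (f ⊗ᵗ idᵗ) ≈ᵗ f ∘ᵗ ruᵗ
    σ-natural  : ∀ {A B A′ B′} {f : Term Q A A′} {g : Term Q B B′} →
                 σᵗ ∘ᵗ (f ⊗ᵗ g) ≈ᵗ (g ⊗ᵗ f) ∘ᵗ σᵗ

    triangle : ∀ {A B} → (idᵗ {A = A} ⊗ᵗ luᵗ {A = B}) ∘ᵗ αᵗ ≈ᵗ ruᵗ ⊗ᵗ idᵗ
    pentagon : ∀ {A B C D} →
               (idᵗ {A = A} ⊗ᵗ αᵗ {A = B} {C} {D}) ∘ᵗ (αᵗ ∘ᵗ (αᵗ ⊗ᵗ idᵗ)) ≈ᵗ αᵗ ∘ᵗ αᵗ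
    hexagon  : ∀ {A B C} →
               (idᵗ {A = B} ⊗ᵗ σᵗ {A = A} {C}) ∘ᵗ (αᵗ ∘ᵗ (σᵗ ⊗ᵗ idᵗ)) ≈ᵗ αᵗ ∘ᵗ (σᵗ ∘ᵗ αᵗ)

    !-unique   : ∀ {A} (f : Term Q A unit) → f ≈ᵗ !ᵗ
    copy-assoc : ∀ {A} → αᵗ ∘ᵗ ((copyᵗ ⊗ᵗ idᵗ) ∘ᵗ copyᵗ) ≈ᵗ (idᵗ ⊗ᵗ copyᵗ) ∘ᵗ copyᵗ {A = A}
    copy-unit  : ∀ {A} → luᵗ ∘ᵗ ((!ᵗ ⊗ᵗ idᵗ) ∘ᵗ copyᵗ) ≈ᵗ idᵗ {A = A}
    copy-comm  : ∀ {A} → σᵗ ∘ᵗ copyᵗ ≈ᵗ copyᵗ {A = A}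
    copy-⊗     : ∀ {A B} → copyᵗ {A = A ⊗ B} ≈ᵗ
                 (α⁻¹ᵗ ∘ᵗ ((idᵗ ⊗ᵗ (αᵗ ∘ᵗ ((σᵗ ⊗ᵗ idᵗ) ∘ᵗ α⁻¹ᵗ))) ∘ᵗ αᵗ)) ∘ᵗ (copyᵗ ⊗ᵗ copyᵗ)

Free : Signature → MarkovCategory 0ℓ 0ℓ 0ℓ
Free Q = record
  { Obj = Tensor (Signature.Type Q)
  ; _⇒_ = Term Q
  ; _≈_ = _≈ᵗ_
  ; equiv = record { refl = ≈-refl ; sym = ≈-sym ; trans = ≈-trans }
  ; id = idᵗ ; _∘_ = _∘ᵗ_ ; ∘-resp-≈ = ∘-resp-≈
  ; assoc = assoc ; identityˡ = identityˡ ; identityʳ = identityʳ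
  ; I = unit ; _⊗₀_ = _⊗_ ; _⊗₁_ = _⊗ᵗ_
  ; ⊗-resp-≈ = ⊗-resp-≈ ; ⊗-id = ⊗-id ; ⊗-∘ = ⊗-∘
  ; α = αᵗ ; α⁻¹ = α⁻¹ᵗ ; lu = luᵗ ; lu⁻¹ = lu⁻¹ᵗ ; ru = ruᵗ ; ru⁻¹ = ru⁻¹ᵗ ; σ = σᵗ
  ; α-isoˡ = α-isoˡ ; α-isoʳ = α-isoʳ
  ; lu-isoˡ = lu-isoˡ ; lu-isoʳ = lu-isoʳ
  ; ru-isoˡ = ru-isoˡ ; ru-isoʳ = ru-isoʳ
  ; σ-invol = σ-invol
  ; α-natural = α-natural ; lu-natural = lu-natural
  ; ru-natural = ru-natural ; σ-natural = σ-natural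
  ; triangle = triangle ; pentagon = pentagon ; hexagon = hexagon
  ; ! = !ᵗ ; !-unique = !-unique
  ; copy = copyᵗ ; copy-assoc = copy-assoc ; copy-unit = copy-unit
  ; copy-comm = copy-comm ; copy-⊗ = copy-⊗
  }

module _ (𝒞 : MarkovCategory o ℓ e) where
  private
    module C = MarkovCategory 𝒞
    open C.Equiv using () renaming (refl to ≈refl; sym to ≈sym; trans to ≈trans)

  ⟦_⟧₀ : {T : Set} → Tensor T → (T → C.Obj) → C.Obj
  ⟦ A ⟧₀ ob = fold C.I C._⊗₀_ ob A

  -- The strict extension of an assignment on generators to the free category.
  module Extension (Q : Signature) (ob : Signature.Type Q → C.Obj)
                   (hom : ∀ q → ⟦ Signature.dom Q q ⟧₀ ob C.⇒ ⟦ Signature.cod Q q ⟧₀ ob) where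

    ⟦_⟧₁ : ∀ {A B} → Term Q A B → ⟦ A ⟧₀ ob C.⇒ ⟦ B ⟧₀ ob
    ⟦ gen q ⟧₁   = hom q
    ⟦ idᵗ ⟧₁      = C.id
    ⟦ f ∘ᵗ g ⟧₁   = ⟦ f ⟧₁ C.∘ ⟦ g ⟧₁
    ⟦ f ⊗ᵗ g ⟧₁  = ⟦ f ⟧₁ C.⊗₁ ⟦ g ⟧₁
    ⟦ αᵗ ⟧₁       = C.α
    ⟦ α⁻¹ᵗ ⟧₁     = C.α⁻¹
    ⟦ luᵗ ⟧₁      = C.lu
    ⟦ lu⁻¹ᵗ ⟧₁    = C.lu⁻¹
    ⟦ ruᵗ ⟧₁      = C.ru
    ⟦ ru⁻¹ᵗ ⟧₁    = C.ru⁻¹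
    ⟦ σᵗ ⟧₁       = C.σ
    ⟦ !ᵗ ⟧₁       = C.!
    ⟦ copyᵗ ⟧₁    = C.copy

    ⟦⟧-resp-≈ : ∀ {A B} {f g : Term Q A B} → f ≈ᵗ g → ⟦ f ⟧₁ C.≈ ⟦ g ⟧₁
    ⟦⟧-resp-≈ ≈-refl         = ≈refl
    ⟦⟧-resp-≈ (≈-sym p)      = ≈sym (⟦⟧-resp-≈ p)
    ⟦⟧-resp-≈ (≈-trans p q)  = ≈trans (⟦⟧-resp-≈ p) (⟦⟧-resp-≈ q)
    ⟦⟧-resp-≈ (∘-resp-≈ p q) = C.∘-resp-≈ (⟦⟧-resp-≈ p) (⟦⟧-resp-≈ q)
    ⟦⟧-resp-≈ assoc          = C.assoc
    ⟦⟧-resp-≈ identityˡ      = C.identityˡ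
    ⟦⟧-resp-≈ identityʳ      = C.identityʳ
    ⟦⟧-resp-≈ (⊗-resp-≈ p q) = C.⊗-resp-≈ (⟦⟧-resp-≈ p) (⟦⟧-resp-≈ q)
    ⟦⟧-resp-≈ ⊗-id           = C.⊗-id
    ⟦⟧-resp-≈ ⊗-∘            = C.⊗-∘
    ⟦⟧-resp-≈ α-isoˡ         = C.α-isoˡ
    ⟦⟧-resp-≈ α-isoʳ         = C.α-isoʳ
    ⟦⟧-resp-≈ lu-isoˡ        = C.lu-isoˡ
    ⟦⟧-resp-≈ lu-isoʳ        = C.lu-isoʳ
    ⟦⟧-resp-≈ ru-isoˡ        = C.ru-isoˡ
    ⟦⟧-resp-≈ ru-isoʳ        = C.ru-isoʳ
    ⟦⟧-resp-≈ σ-invol        = C.σ-invol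
    ⟦⟧-resp-≈ α-natural      = C.α-natural
    ⟦⟧-resp-≈ lu-natural     = C.lu-natural
    ⟦⟧-resp-≈ ru-natural     = C.ru-natural
    ⟦⟧-resp-≈ σ-natural      = C.σ-natural
    ⟦⟧-resp-≈ triangle       = C.triangle
    ⟦⟧-resp-≈ pentagon       = C.pentagon
    ⟦⟧-resp-≈ hexagon        = C.hexagon
    ⟦⟧-resp-≈ (!-unique f)   = C.!-unique ⟦ f ⟧₁
    ⟦⟧-resp-≈ copy-assoc     = C.copy-assoc
    ⟦⟧-resp-≈ copy-unit      = C.copy-unit
    ⟦⟧-resp-≈ copy-comm      = C.copy-comm
    ⟦⟧-resp-≈ copy-⊗         = C.copy-⊗

    private
      id-det : ∀ {A} → C.Deterministic (C.id {A})
      id-det = ≈trans C.identityʳ (≈sym (≈trans (C.∘-congʳ C.⊗-id) C.identityˡ))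

      f∘id∘id⊗id : ∀ {A B E} {f : A C.⊗₀ B C.⇒ E} →
                   f C.∘ (C.id C.∘ (C.id C.⊗₁ C.id)) C.≈ f
      f∘id∘id⊗id = ≈trans (C.∘-congˡ (≈trans C.identityˡ C.⊗-id)) C.identityʳ

    extend : Functor (Free Q) 𝒞
    extend = record
      { F₀ = λ A → ⟦ A ⟧₀ ob
      ; F₁ = ⟦_⟧₁
      ; F-resp-≈ = ⟦⟧-resp-≈
      ; F-id = ≈refl
      ; F-∘ = ≈refl
      ; μ = C.id ; μ⁻¹ = C.id ; η = C.id ; η⁻¹ = C.id
      ; μ-isoˡ = C.identityˡ ; μ-isoʳ = C.identityˡ
      ; η-isoˡ = C.identityˡ ; η-isoʳ = C.identityˡ
      ; μ-natural = ≈trans C.identityˡ (≈sym C.identityʳ)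
      ; μ-assoc = ≈trans f∘id∘id⊗id
                    (≈sym (≈trans C.identityˡ (≈trans (C.∘-congʳ C.⊗-id) C.identityˡ)))
      ; μ-unitˡ = f∘id∘id⊗id
      ; μ-unitʳ = f∘id∘id⊗id
      ; μ-symm = ≈trans C.identityʳ (≈sym C.identityˡ)
      ; F-copy = ≈sym C.identityˡ
      ; μ-det = id-det
      ; η-det = id-det
      }

module _ {Q : Signature} where
  open Signature Q

  project : ∀ A {x : Type} → x ∈ₗ vars A → Term Q A (var x)
  project (var y) (here refl) = idᵗ
  project (A ⊗ B) p = [ (λ q → ruᵗ ∘ᵗ (project A q ⊗ᵗ !ᵗ))
                      , (λ q → luᵗ ∘ᵗ (!ᵗ ⊗ᵗ project B q)) ]′ (∈-++⁻ (vars A) p)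

  -- Each output wire is connected to the input wire at the position given by
  -- its membership proof, copying and discarding inputs as needed.  Between
  -- lists of the same distinct variables this is the permutation isomorphism.
  wire : ∀ {A} B → vars B ⊆ₗ vars A → Term Q A B
  wire unit    f = !ᵗ
  wire (var x) f = project _ (f (here refl))
  wire (B ⊗ D) f =
    (wire B (λ p → f (∈-++⁺ˡ p)) ⊗ᵗ wire D (λ p → f (∈-++⁺ʳ (vars B) p))) ∘ᵗ copyᵗ

  permute : ∀ {A B} → vars B ↭ vars A → Term Q A B
  permute {B = B} s = wire B (∈-resp-↭ s)

  powerᵗ : ∀ {S : Set} (f : S → Tensor Type) k {A B} → Term Q A (substitute f B) →
           Term Q (power k A) (substitute f (power k B))
  powerᵗ f zero    g = idᵗ
  powerᵗ f (suc k) g = g ⊗ᵗ powerᵗ f k g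

module _ (𝒞 : MarkovCategory o ℓ e) where
  open MarkovCategory 𝒞 using (Obj; _⇒_)

  rewire : ∀ {T : Set} (ob : T → Obj) A B → vars B ⊆ₗ vars A → ⟦_⟧₀ 𝒞 A ob ⇒ ⟦_⟧₀ 𝒞 B ob
  rewire {T} ob A B f = ⟦ wire {A = A} B f ⟧₁
    where
    noQueries : Signature
    noQueries = record { Type = T ; Query = ⊥ ; dom = λ () ; cod = λ () }

    none : ∀ q → ⟦_⟧₀ 𝒞 (Signature.dom noQueries q) ob ⇒ ⟦_⟧₀ 𝒞 (Signature.cod noQueries q) ob
    none ()

    open Extension 𝒞 noQueries ob none

elems : ∀ {n} → Subset n → List (Fin n)
elems {n} S = filter (_∈? S) (allFin n)

⨂ˢ : ∀ {n} → Subset n → Tensor (Fin n)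
⨂ˢ S = ⨂ (elems S)

support : ∀ {n} → Tensor (Fin n) → Subset n
support A = ⋃ (map ⁅_⁆ (vars A))

image : ∀ {m n} → (Fin n → Subset m) → Subset n → Subset m
image π S = ⋃ (map π (elems S))

Disjoint : ∀ {n} → Subset n → Subset n → Set
Disjoint S T = Empty (S ∩ T)

PairwiseDisjoint : ∀ {k n} → Vec (Subset n) k → Set
PairwiseDisjoint Ss = ∀ i j → i ≢ j → Disjoint (lookup Ss i) (lookup Ss j)

∈-elems⁺ : ∀ {n} {S : Subset n} {x} → x ∈ S → x ∈ₗ elems S
∈-elems⁺ {S = S} = ∈-filter⁺ (_∈? S) (∈-allFin _)

∈-elems⁻ : ∀ {n} {S : Subset n} {x} → x ∈ₗ elems S → x ∈ S
∈-elems⁻ {n} {S} p = proj₂ (∈-filter⁻ (_∈? S) {xs = allFin n} p)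

∈-⨂⁺ : ∀ {T : Set} {xs : List T} → xs ⊆ₗ vars (⨂ xs)
∈-⨂⁺ (here p)  = here p
∈-⨂⁺ (there p) = there (∈-⨂⁺ p)

∈-⨂⁻ : ∀ {T : Set} (xs : List T) → vars (⨂ xs) ⊆ₗ xs
∈-⨂⁻ (_ ∷ xs) (here p)  = here p
∈-⨂⁻ (_ ∷ xs) (there p) = there (∈-⨂⁻ xs p)

∈-⨂ˢ⁺ : ∀ {n} {S : Subset n} {x} → x ∈ S → x ∈ₗ vars (⨂ˢ S)
∈-⨂ˢ⁺ p = ∈-⨂⁺ (∈-elems⁺ p)

∈-⨂ˢ⁻ : ∀ {n} {S : Subset n} {x} → x ∈ₗ vars (⨂ˢ S) → x ∈ S
∈-⨂ˢ⁻ p = ∈-elems⁻ (∈-⨂⁻ _ p)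

∈-⋃-map⁺ : ∀ {n} {T : Set} (f : T → Subset n) {x y} {ys : List T} →
           y ∈ₗ ys → x ∈ f y → x ∈ ⋃ (map f ys)
∈-⋃-map⁺ f (here refl) q = x∈p∪q⁺ (inj₁ q)
∈-⋃-map⁺ f (there p)   q = x∈p∪q⁺ (inj₂ (∈-⋃-map⁺ f p q))

∈-support⁺ : ∀ {n} (A : Tensor (Fin n)) {x} → x ∈ₗ vars A → x ∈ support A
∈-support⁺ A p = ∈-⋃-map⁺ ⁅_⁆ p (x∈⁅x⁆ _)

∈-substitute⁻ : ∀ {S T : Set} (f : S → Tensor T) (A : Tensor S) {y} →
                y ∈ₗ vars (substitute f A) → ∃[ x ] x ∈ₗ vars A × y ∈ₗ vars (f x)
∈-substitute⁻ f (var x) p = x , here refl , p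
∈-substitute⁻ f (A ⊗ B) p with ∈-++⁻ (vars (substitute f A)) p
... | inj₁ q = let x , x∈A , y∈fx = ∈-substitute⁻ f A q in x , ∈-++⁺ˡ x∈A , y∈fx
... | inj₂ q = let x , x∈B , y∈fx = ∈-substitute⁻ f B q in x , ∈-++⁺ʳ (vars A) x∈B , y∈fx

substitute-⊆-image : ∀ {m n} {π : Fin n → Subset m} (f : Fin n → Tensor (Fin m)) →
                     (∀ X {y} → y ∈ₗ vars (f X) → y ∈ π X) →
                     ∀ S → vars (substitute f (⨂ˢ S)) ⊆ₗ vars (⨂ˢ (image π S))
substitute-⊆-image {π = π} f f⊆π S p =
  let X , X∈S , y∈fX = ∈-substitute⁻ f (⨂ˢ S) p
  in ∈-⨂ˢ⁺ (∈-⋃-map⁺ π (∈-⨂⁻ (elems S) X∈S) (f⊆π X y∈fX))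

record OpenDAG (n : ℕ) : Set where
  field
    pa  : Fin n → Subset n
    ins : Subset n
    ins-parentless : ∀ {x} → x ∈ ins → Empty (pa x)

  infix 4 _⟶_
  _⟶_ : Rel (Fin n) 0ℓ
  x ⟶ y = x ∈ pa y

  field
    acyclic : ∀ x → ¬ TransClosure _⟶_ x x

  nin : Subset n
  nin = ∁ ins

  PathTo : Subset n → Fin n → Set
  PathTo O x = ∃[ y ] y ∈ O × Star _⟶_ x y

  private
    ⟶⁺-isStrictPartialOrder : IsStrictPartialOrder _≡_ (TransClosure _⟶_)
    ⟶⁺-isStrictPartialOrder = record
      { isEquivalence = isEquivalence
      ; irrefl = λ { refl → acyclic _ }
      ; trans = Plus._++_
      ; <-resp-≈ = (λ { refl p → p }) , (λ { refl p → p })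
      }

  ⟶-wellFounded : WellFounded _⟶_
  ⟶-wellFounded =
    Subrelation.wellFounded {_<₂_ = TransClosure _⟶_} Plus.[_]
      (spo-wellFounded ⟶⁺-isStrictPartialOrder)

  ⟵-wellFounded : WellFounded (flip _⟶_)
  ⟵-wellFounded =
    Subrelation.wellFounded {_<₂_ = flip (TransClosure _⟶_)} Plus.[_]
      (spo-noetherian ⟶⁺-isStrictPartialOrder)

  path? : ∀ x y → Dec (Star _⟶_ x y)
  path? x y = go x (⟵-wellFounded x)
    where
    join : ∀ {x} → (x ≡ y) ⊎ (∃[ z ] Σ (x ⟶ z) λ _ → Star _⟶_ z y) → Star _⟶_ x y
    join (inj₁ refl)              = ε
    join (inj₂ (_ , x⟶z , z⟶*y)) = x⟶z ◅ z⟶*y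

    split : ∀ {x} → Star _⟶_ x y → (x ≡ y) ⊎ (∃[ z ] Σ (x ⟶ z) λ _ → Star _⟶_ z y)
    split ε               = inj₁ refl
    split (x⟶z ◅ z⟶*y) = inj₂ (_ , x⟶z , z⟶*y)

    go : ∀ x → Acc (flip _⟶_) x → Dec (Star _⟶_ x y)
    go x (acc rs) = map′ join split ((x Fin.≟ y) ⊎-dec Fin.any? step)
      where
      step : ∀ z → Dec (Σ (x ⟶ z) λ _ → Star _⟶_ z y)
      step z with x ∈? pa z
      ... | no ¬p = no λ q → ¬p (proj₁ q)
      ... | yes p = map′ (p ,_) proj₂ (go z (rs p))

  pathTo? : ∀ O x → Dec (PathTo O x)
  pathTo? O x = Fin.any? λ y → (y ∈? O) ×-dec path? x y

  -- Lists of distinct vertices, latest first, in which parents come earlier.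
  data Topological : List (Fin n) → Set where
    []  : Topological []
    add : ∀ x {xs} → x ∉ₗ xs → elems (pa x) ⊆ₗ xs → Topological xs → Topological (x ∷ xs)

  private
    open DecMembership (Fin._≟_ {n}) using () renaming (_∈?_ to _∈ₗ?_)

    Extending : List (Fin n) → (List (Fin n) → Set) → Set
    Extending xs P = ∃[ ys ] Topological ys × xs ⊆ₗ ys × P ys

    insertAll : ∀ zs → (∀ {z} → z ∈ₗ zs → ∀ {xs} → Topological xs → Extending xs (z ∈ₗ_)) →
                ∀ {xs} → Topological xs → Extending xs (zs ⊆ₗ_)
    insertAll []       f t = _ , t , (λ p → p) , λ ()
    insertAll (z ∷ zs) f t =
      let ys , t′ , i  , z∈ys = f (here refl) t
          ws , t″ , i′ , zs⊆ws = insertAll zs (λ p → f (there p)) t′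
      in ws , t″ , (λ p → i′ (i p)) , λ { (here refl) → i′ z∈ys ; (there p) → zs⊆ws p }

    insert : ∀ x → Acc _⟶_ x → ∀ {xs} → Topological xs → Extending xs (x ∈ₗ_)
    insert x (acc rs) t
      with insertAll (elems (pa x)) (λ p → insert _ (rs (∈-elems⁻ p))) t
    ... | ys , t′ , i , pa⊆ys with x ∈ₗ? ys
    ...   | yes x∈ys = ys , t′ , i , x∈ys
    ...   | no  x∉ys = x ∷ ys , add x x∉ys pa⊆ys t′ , (λ p → there (i p)) , here refl

  -- A topological order of all vertices.  By the symmetric monoidal laws the
  -- channels below do not depend on which one is chosen.
  order : ∃[ xs ] Topological xs × (∀ x → x ∈ₗ xs)
  order = let xs , t , _ , all = insertAll (allFin n) (λ {z} _ → insert z (⟶-wellFounded z)) []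
          in xs , t , λ x → all (∈-allFin x)

  -- The generators are the mechanisms; irrelevance of the proof identifies
  -- the mechanisms of a given vertex.
  record Mechanism : Set where
    constructor mechanism
    field
      vertex : Fin n
      .nonInput : vertex ∉ ins

  mechanisms : Signature
  mechanisms = record
    { Type  = Fin n
    ; Query = Mechanism
    ; dom   = λ m → ⨂ˢ (pa (Mechanism.vertex m))
    ; cod   = λ m → var (Mechanism.vertex m)
    }

  module _ (O : Subset n) where

    used? : ∀ x → Dec (x ∉ ins × PathTo O x)
    used? x = ¬? (x ∈? ins) ×-dec pathTo? O x

    -- The wires present once the mechanisms among the given vertices have
    -- been applied.
    wires : List (Fin n) → Tensor (Fin n)
    wires [] = ⨂ˢ ins
    wires (x ∷ xs) with used? x
    ... | yes _ = var x ⊗ wires xs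
    ... | no  _ = wires xs

    ∈-wires : ∀ {x xs} → x ∈ₗ xs → PathTo O x → x ∈ₗ vars (wires xs)
    ∈-wires {x} {xs} p path with x ∈? ins
    ... | yes x∈ins = input xs
      where
      input : ∀ xs → x ∈ₗ vars (wires xs)
      input [] = ∈-⨂ˢ⁺ x∈ins
      input (y ∷ ys) with used? y
      ... | yes _ = there (input ys)
      ... | no  _ = input ys
    ... | no x∉ins = computed p
      where
      computed : ∀ {xs} → x ∈ₗ xs → x ∈ₗ vars (wires xs)
      computed {y ∷ ys} (here refl) with used? y
      ... | yes _ = here refl
      ... | no ¬u = contradiction (x∉ins , path) ¬u
      computed {y ∷ ys} (there q) with used? y
      ... | yes _ = there (computed q)
      ... | no  _ = computed q

    build : ∀ {xs} → Topological xs → Term mechanisms (⨂ˢ ins) (wires xs)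
    build [] = idᵗ
    build (add x {xs} _ pa⊆xs t) with used? x
    ... | yes (x∉ins , y , y∈O , path) =
            ((gen (mechanism x x∉ins) ∘ᵗ wire (⨂ˢ (pa x)) parents) ⊗ᵗ idᵗ) ∘ᵗ (copyᵗ ∘ᵗ build t)
      where
      parents : vars (⨂ˢ (pa x)) ⊆ₗ vars (wires xs)
      parents p = ∈-wires (pa⊆xs (∈-⨂⁻ _ p)) (y , y∈O , ∈-⨂ˢ⁻ p ◅ path)
    ... | no _ = build t

    network : Term mechanisms (⨂ˢ ins) (⨂ˢ O)
    network =
      let xs , t , all = order
      in wire (⨂ˢ O) (λ p → ∈-wires (all _) (_ , ∈-⨂ˢ⁻ p , ε)) ∘ᵗ build t

Do : ∀ {n} → OpenDAG n → Subset n → OpenDAG n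
Do {n} G S = record
  { pa = pa′
  ; ins = ins ∪ S
  ; ins-parentless = parentless
  ; acyclic = λ x p → acyclic x (old p)
  }
  where
  open OpenDAG G

  pa′ : Fin n → Subset n
  pa′ x with x ∈? S
  ... | yes _ = ∅
  ... | no  _ = pa x

  parentless : ∀ {x} → x ∈ ins ∪ S → Empty (pa′ x)
  parentless {x} p (y , q) with x ∈? S
  ... | yes _   = ∉⊥ q
  ... | no  x∉S = [ (λ x∈ins → ins-parentless x∈ins (y , q)) , (λ x∈S → x∉S x∈S) ]′
                    (x∈p∪q⁻ ins S p)

  old-edge : ∀ {x y} → x ∈ pa′ y → x ⟶ y
  old-edge {x} {y} p with y ∈? S
  ... | yes _ = contradiction p ∉⊥
  ... | no  _ = p

  old : ∀ {x y} → TransClosure (λ x y → x ∈ pa′ y) x y → TransClosure _⟶_ x y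
  old Plus.[ p ]    = Plus.[ old-edge p ]
  old (p Plus.∷ ps) = old-edge p Plus.∷ old ps

record CausalModel (𝒞 : MarkovCategory o ℓ e) {n} (G : OpenDAG n) : Set (o ⊔ ℓ) where
  open MarkovCategory 𝒞
  open OpenDAG G
  field
    ob   : Fin n → Obj
    mech : ∀ x → .(x ∉ ins) → ⟦_⟧₀ 𝒞 (⨂ˢ (pa x)) ob ⇒ ob x
    outs : Subset n

module _ {𝒞 : MarkovCategory o ℓ e} {n} {G : OpenDAG n} where
  open MarkovCategory 𝒞 using (_⇒_)
  open OpenDAG G

  DoM : CausalModel 𝒞 G → (S : Subset n) → CausalModel 𝒞 (Do G S)
  DoM M S = record { ob = ob ; mech = mech′ ; outs = outs }
    where
    open CausalModel M
    mech′ : ∀ x → .(x ∉ ins ∪ S) → ⟦_⟧₀ 𝒞 (⨂ˢ (OpenDAG.pa (Do G S) x)) ob ⇒ ob x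
    mech′ x x∉ with x ∈? S
    ... | yes x∈S = ⊥-elim-irr (x∉ (q⊆p∪q ins S x∈S))
    ... | no _ = mech x (λ x∈ins → x∉ (p⊆p∪q S x∈ins))

  -- The channel M^O : V^in → O.
  channel : (M : CausalModel 𝒞 G) (O : Subset n) → let open CausalModel M in
            ⟦_⟧₀ 𝒞 (⨂ˢ ins) ob ⇒ ⟦_⟧₀ 𝒞 (⨂ˢ O) ob
  channel M O = ⟦ network O ⟧₁
    where
    open CausalModel M

    onMechanism : ∀ q → ⟦_⟧₀ 𝒞 (Signature.dom mechanisms q) ob ⇒
                        ⟦_⟧₀ 𝒞 (Signature.cod mechanisms q) ob
    onMechanism (mechanism x x∉ins) = mech x x∉ins

    open Extension 𝒞 mechanisms ob onMechanism

record IsInterchange {n} (G : OpenDAG n) (outs : Subset n)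
                     {k} (Ss : Vec (Subset n) k) (O : Subset n) : Set where
  field
    nonInput : ∀ i → lookup Ss i ⊆ OpenDAG.nin G
    disjoint : PairwiseDisjoint Ss
    output   : O ⊆ outs

-- Int(S₁,…,Sₖ) → O; the side conditions are irrelevant, so that a query is
-- determined by S₁,…,Sₖ and O.
record InterchangeQuery {n} (G : OpenDAG n) (outs : Subset n) : Set where
  constructor int
  field
    {size} : ℕ
    Ss : Vec (Subset n) size
    O  : Subset n
    .valid : IsInterchange G outs Ss O

Int : ∀ {n} → OpenDAG n → Subset n → Signature
Int {n} G outs = record
  { Type  = Fin n
  ; Query = InterchangeQuery G outs
  ; dom   = λ q → power (suc (InterchangeQuery.size q)) (⨂ˢ (OpenDAG.ins G))
  ; cod   = λ q → ⨂ˢ (InterchangeQuery.O q)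
  }

module _ {𝒞 : MarkovCategory o ℓ e} {n} {G : OpenDAG n} (M : CausalModel 𝒞 G) where
  open MarkovCategory 𝒞
  open OpenDAG G
  open CausalModel M

  private
    ⟦_⟧ : Tensor (Fin n) → Obj
    ⟦ A ⟧ = ⟦_⟧₀ 𝒞 A ob

  ⨂ˢˢ : ∀ {k} → Vec (Subset n) k → Tensor (Fin n)
  ⨂ˢˢ []       = unit
  ⨂ˢˢ (S ∷ Ss) = ⨂ˢ S ⊗ ⨂ˢˢ Ss

  ⋃ˢ : ∀ {k} → Vec (Subset n) k → Subset n
  ⋃ˢ Ss = ⋃ (toList Ss)

  ∈-⨂ˢˢ : ∀ {k} (Ss : Vec (Subset n) k) {x} → x ∈ ⋃ˢ Ss → x ∈ₗ vars (⨂ˢˢ Ss)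
  ∈-⨂ˢˢ []       p = contradiction p ∉⊥
  ∈-⨂ˢˢ (S ∷ Ss) p = [ (λ q → ∈-++⁺ˡ (∈-⨂ˢ⁺ q))
                     , (λ q → ∈-++⁺ʳ (vars (⨂ˢ S)) (∈-⨂ˢˢ Ss q)) ]′ (x∈p∪q⁻ S (⋃ˢ Ss) p)

  channels : ∀ {k} (Ss : Vec (Subset n) k) → ⟦ power k (⨂ˢ ins) ⟧ ⇒ ⟦ ⨂ˢˢ Ss ⟧
  channels []       = id
  channels (S ∷ Ss) = channel M S ⊗₁ channels Ss

  -- The channel of Int(S₁,…,Sₖ) → O.
  interchange : ∀ {k} (Ss : Vec (Subset n) k) (O : Subset n) →
                ⟦ power (suc k) (⨂ˢ ins) ⟧ ⇒ ⟦ ⨂ˢ O ⟧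
  interchange Ss O =
    channel (DoM M (⋃ˢ Ss)) O ∘
      (rewire 𝒞 ob (⨂ˢ ins ⊗ ⨂ˢˢ Ss) (⨂ˢ (ins ∪ ⋃ˢ Ss)) inputs ∘ (id ⊗₁ channels Ss))
    where
    inputs : vars (⨂ˢ (ins ∪ ⋃ˢ Ss)) ⊆ₗ vars (⨂ˢ ins ⊗ ⨂ˢˢ Ss)
    inputs p = [ (λ q → ∈-++⁺ˡ (∈-⨂ˢ⁺ q))
               , (λ q → ∈-++⁺ʳ (vars (⨂ˢ ins)) (∈-⨂ˢˢ Ss q)) ]′
                 (x∈p∪q⁻ ins (⋃ˢ Ss) (∈-⨂ˢ⁻ p))

  ⟦_⟧Int : Functor (Free (Int G outs)) 𝒞
  ⟦_⟧Int = Extension.extend 𝒞 (Int G outs) ob λ { (int Ss O _) → interchange Ss O }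

module _ {Q : Signature} {𝒟 : MarkovCategory o ℓ e} (F : Functor (Free Q) 𝒟) where
  open MarkovCategory 𝒟
  open Functor F

  onVar : Signature.Type Q → Obj
  onVar X = F₀ (var X)

  -- The coherence isomorphism F X₁ ⊗ … ⊗ F Xₖ ⇒ F (X₁ ⊗ … ⊗ Xₖ).
  merge : ∀ A → ⟦_⟧₀ 𝒟 A onVar ⇒ F₀ A
  merge unit    = η
  merge (var X) = id
  merge (A ⊗ B) = μ ∘ (merge A ⊗₁ merge B)

module _ {Q_L Q_H : Signature} (π : Functor (Free Q_H) (Free Q_L)) where
  private
    module L = Signature Q_L
    module H = Signature Q_H
  open Functor π

  -- π(q) is the generator q′, where i and j rearrange the inputs and outputs of
  -- q′ into the concatenations of the lists π(X) over the inputs and outputs X of q.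
  SendsTo : ∀ q q′ → Term Q_L (L.dom q′) (substitute (onVar π) (H.dom q)) →
            Term Q_L (L.cod q′) (substitute (onVar π) (H.cod q)) → Set
  SendsTo q q′ i j =
    F₁ (gen q) ∘ᵗ (merge π (H.dom q) ∘ᵗ i) ≈ᵗ merge π (H.cod q) ∘ᵗ (j ∘ᵗ gen q′)

module _ {𝒞 : MarkovCategory o ℓ e} {Q_L Q_H : Signature} where
  open MarkovCategory 𝒞 using (Epic)
  private
    module L = Signature Q_L
    module H = Signature Q_H

  record DownwardAbstraction (⟦⟧L : Functor (Free Q_L) 𝒞) (⟦⟧H : Functor (Free Q_H) 𝒞)
         : Set (o ⊔ ℓ ⊔ e) where
    field
      π : Functor (Free Q_H) (Free Q_L)
      π-query : ∀ q → ∃[ q′ ]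
        Σ[ s ∈ vars (substitute (onVar π) (H.dom q)) ↭ vars (L.dom q′) ]
        Σ[ t ∈ vars (substitute (onVar π) (H.cod q)) ↭ vars (L.cod q′) ]
        SendsTo π q q′ (permute s) (permute t)
      τ : Transformation (⟦⟧L ∘F π) ⟦⟧H
      τ-epic : ∀ A → Epic (Transformation.at τ A)

  -- Equality of (π , τ) and (π′ , τ′), where lists of variables, and hence
  -- functors into Free Q_L, are considered up to permutation: τ and τ′ agree
  -- along a monoidal transformation π ⇒ π′ that permutes each list π(X).
  -- By monoidality the latter is an isomorphism.
  record _≈ᴰ_ {⟦⟧L : Functor (Free Q_L) 𝒞} {⟦⟧H : Functor (Free Q_H) 𝒞}
              (D D′ : DownwardAbstraction ⟦⟧L ⟦⟧H) : Set e where
    private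
      module D  = DownwardAbstraction D
      module D′ = DownwardAbstraction D′
      module C  = MarkovCategory 𝒞
    field
      θ : Transformation D.π D′.π
      θ-var : ∀ X → Σ[ s ∈ vars (onVar D′.π X) ↭ vars (onVar D.π X) ]
              Transformation.at θ (var X) ≈ᵗ permute s
      θ-τ : ∀ A → Transformation.at D′.τ A C.∘ Functor.F₁ ⟦⟧L (Transformation.at θ A)
                    C.≈ Transformation.at D.τ A

module _ {𝒞 : MarkovCategory o ℓ e} {m n} {G_L : OpenDAG m} {G_H : OpenDAG n}
         (L : CausalModel 𝒞 G_L) (H : CausalModel 𝒞 G_H) where
  open MarkovCategory 𝒞
  private
    module L where
      open OpenDAG G_L public
      open CausalModel L public
    module H where
      open OpenDAG G_H public
      open CausalModel H public

    ⟦_⟧L : Tensor (Fin m) → Obj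
    ⟦ A ⟧L = ⟦_⟧₀ 𝒞 A L.ob

    ⟦_⟧H : Tensor (Fin n) → Obj
    ⟦ A ⟧H = ⟦_⟧₀ 𝒞 A H.ob

  record OnVariables : Set ℓ where
    field
      π : Fin n → Subset m
      τ : ∀ X → ⟦ ⨂ˢ (π X) ⟧L ⇒ H.ob X

    πᵗ : Tensor (Fin n) → Tensor (Fin m)
    πᵗ = substitute (λ X → ⨂ˢ (π X))

    τᵗ : ∀ A → ⟦ πᵗ A ⟧L ⇒ ⟦ A ⟧H
    τᵗ unit    = id
    τᵗ (var X) = τ X
    τᵗ (A ⊗ B) = τᵗ A ⊗₁ τᵗ B

    -- τ_S on the list of the set T = π(S).
    τˢ : ∀ S {T} → image π S ≡ T → ⟦ ⨂ˢ T ⟧L ⇒ ⟦ ⨂ˢ S ⟧H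
    τˢ S refl = τᵗ (⨂ˢ S) ∘
      rewire 𝒞 L.ob (⨂ˢ (image π S)) (πᵗ (⨂ˢ S))
        (substitute-⊆-image (λ X → ⨂ˢ (π X)) (λ X → ∈-⨂ˢ⁻) S)

  powerʰ : ∀ k {A B} → ⟦ A ⟧L ⇒ ⟦ B ⟧H → ⟦ power k A ⟧L ⇒ ⟦ power k B ⟧H
  powerʰ zero    f = id
  powerʰ (suc k) f = f ⊗₁ powerʰ k f

  record IsVariableAlignment (a : OnVariables) : Set (o ⊔ ℓ ⊔ e) where
    open OnVariables a
    field
      π-disjoint : ∀ X Y → X ≢ Y → Disjoint (π X) (π Y)
      π-in   : image π H.ins ≡ L.ins
      π-out  : image π H.outs ⊆ L.outs
      τ-epic : ∀ X → Epic (τ X)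
      τ-det  : ∀ X → Deterministic (τ X)
      τᵗ-epic : ∀ A → Epic (τᵗ A)

  record IsInterchangeAbstraction (a : OnVariables) : Set (o ⊔ ℓ ⊔ e) where
    open OnVariables a
    field
      alignment : IsVariableAlignment a
    open IsVariableAlignment alignment
    field
      commutes : ∀ {k} (Ss : Vec (Subset n) k) →
        (∀ i → lookup Ss i ⊆ H.nin) → PairwiseDisjoint Ss →
        τˢ H.outs refl ∘ interchange L (mapᵥ (image π) Ss) (image π H.outs)
          ≈ interchange H Ss H.outs ∘ powerʰ (suc k) (τˢ H.ins π-in)

  InterchangeAbstraction : Set (o ⊔ ℓ ⊔ e)
  InterchangeAbstraction = Σ OnVariables IsInterchangeAbstraction

  record _≈ᴵ_ (a b : InterchangeAbstraction) : Set e where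
    private
      module a = OnVariables (proj₁ a)
      module b = OnVariables (proj₁ b)
    field
      π-≡ : ∀ X → a.π X ≡ b.π X
      τ-≈ : ∀ X → subst (λ S → ⟦ ⨂ˢ S ⟧L ⇒ H.ob X) (π-≡ X) (a.τ X) ≈ b.τ X

  private
    Int_L = Int G_L L.outs
    Int_H = Int G_H H.outs

  record InterchangeDownwardAbstraction : Set (o ⊔ ℓ ⊔ e) where
    field
      downward : DownwardAbstraction ⟦ L ⟧Int ⟦ H ⟧Int
    open DownwardAbstraction downward public

    πˢ : Subset n → Subset m
    πˢ = image λ X → support (onVar π X)

    πᵗ : Tensor (Fin n) → Tensor (Fin m)
    πᵗ = substitute (onVar π)

    field
      π-in         : vars (πᵗ (⨂ˢ H.ins)) ↭ elems L.ins
      π-nin        : All (_∈ L.nin) (vars (πᵗ (⨂ˢ H.nin)))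
      π-nin-unique : Unique (vars (πᵗ (⨂ˢ H.nin)))

    inputs : Term Int_L (⨂ˢ L.ins) (πᵗ (⨂ˢ H.ins))
    inputs = wire _ λ p → ∈-⨂⁺ (∈-resp-↭ π-in p)

    outputs : ∀ O → Term Int_L (⨂ˢ (πˢ O)) (πᵗ (⨂ˢ O))
    outputs O = wire _ (substitute-⊆-image (onVar π) (λ X → ∈-support⁺ (onVar π X)) O)

    field
      π-int : ∀ {k} (Ss : Vec (Subset n) k) O (v : IsInterchange G_H H.outs Ss O) →
        Σ[ v′ ∈ IsInterchange G_L L.outs (mapᵥ πˢ Ss) (πˢ O) ]
        SendsTo π (int Ss O v) (int (mapᵥ πˢ Ss) (πˢ O) v′) (powerᵗ (onVar π) (suc k) inputs) (outputs O)

  restrict : InterchangeDownwardAbstraction → OnVariables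
  restrict D = record
    { π = λ X → support (onVar π X)
    ; τ = λ X → Transformation.at τ (var X) ∘
                rewire 𝒞 L.ob (⨂ˢ (support (onVar π X))) (onVar π X)
                  (λ p → ∈-⨂ˢ⁺ (∈-support⁺ (onVar π X) p))
    }
    where open InterchangeDownwardAbstraction D

{-# OPTIONS --safe #-}

-- Restricted to variables, a downward abstraction π sends S to π(S), and naturality of τ at the query
-- Int(S₁,…,Sₙ) → V^out is literally the equation of an interchange abstraction: being monoidal, τ is
-- determined by its components at single variables.  Conversely a strong monoidal functor out of a free
-- category is determined, up to the rearrangement of its lists of variables, by its values on types and
-- queries, and π(q) is prescribed on queries; so a downward abstraction can be recovered from its
-- restriction.  The only gap is that an interchange abstraction knows the queries with output V^out
-- alone.  It is closed by marginalisation: M^O is M^O′ followed by discarding when O ⊆ O′, and τ,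
-- being deterministic, commutes with discarding.
module Submission where

open import Defs hiding (assoc; identityˡ; identityʳ; ∘-resp-≈; ⊗-resp-≈; ⊗-id; ⊗-∘; α-isoˡ;
  α-isoʳ; lu-isoˡ; lu-isoʳ; ru-isoˡ; ru-isoʳ; σ-invol; α-natural; lu-natural; ru-natural;
  σ-natural; triangle; pentagon; hexagon; !-unique; copy-assoc; copy-unit; copy-comm; copy-⊗)
open import Level using (Level; _⊔_)
open import Data.Fin using (Fin)
import Data.Fin.Properties as Fin
open import Data.Fin.Subset using (Subset; _∈_; _∉_; _⊆_; _∩_; ⁅_⁆; ⋃)
open import Data.Fin.Subset.Properties using (_∈?_; _⊆?_; nonempty?; x∉p⇒x∈∁p; x∈∁p⇒x∉p; x∈p∪q⁻; ∉⊥;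
  x∈⁅y⁆⇒x≡y; ⊆-antisym; x∈p∩q⁺; x∈p∩q⁻)
open import Data.List using (List; []; _∷_; _++_; map)
open import Data.List.Membership.Propositional using () renaming (_∈_ to _∈ₗ_; _∉_ to _∉ₗ_)
open import Data.List.Membership.Propositional.Properties using (∈-++⁺ˡ; ∈-++⁺ʳ; ∈-++⁻)
open import Data.List.Membership.Propositional.Properties.WithK using (unique⇒irrelevant; unique∧set⇒bag)
open import Data.List.Relation.Binary.BagAndSetEquality using (∼bag⇒↭)
open import Data.List.Relation.Binary.Permutation.Propositional as ↭ using (_↭_; ↭⇒↭ₛ; ↭-sym)
open import Data.List.Relation.Binary.Permutation.Propositional.Properties using (∈-resp-↭; ++⁺ʳ; ++⁺ˡ; ++⁺)
import Data.List.Relation.Binary.Permutation.Setoid.Properties as SetoidPermutation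
open import Data.List.Relation.Binary.Subset.Propositional using () renaming (_⊆_ to _⊆ₗ_)
open import Data.List.Relation.Unary.All as All using ()
open import Data.List.Relation.Unary.All.Properties using () renaming (++⁻ to All-++⁻)
open import Data.List.Relation.Unary.AllPairs as AllPairs using ()
open import Data.List.Relation.Unary.Any using (here; there)
open import Data.List.Relation.Unary.Any.Properties using (++⁻∘++⁺; ++⁺∘++⁻)
open import Data.List.Relation.Unary.Unique.Propositional using (Unique)
open import Data.List.Relation.Unary.Unique.Propositional.Properties using (allFin⁺)
  renaming (filter⁺ to unique-filter⁺; ++⁺ to unique-++⁺)
open import Data.Nat using (ℕ; zero; suc)
open import Data.Product using (Σ-syntax; ∃-syntax; _×_; _,_; proj₁; proj₂)
open import Data.Sum using (_⊎_; inj₁; inj₂; [_,_]′; map₂)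
open import Data.Vec using (Vec; []; lookup) renaming (map to mapᵥ)
open import Data.Vec.Properties using (lookup-map; map-cong)
open import Function using (mk⇔)
open import Function.Definitions using (Congruent; Bijective)
open import Relation.Binary.PropositionalEquality as ≡ using (_≡_; _≢_; cong; subst)
open import Relation.Nullary using (Dec; yes; no; contradiction)
open import Relation.Nullary.Decidable using (map′; _×-dec_; _→-dec_; ¬?; recompute)

-- The obstacle is the order and bracketing of lists. `Free` is not strict, a functor π yields a
-- bracketed list in any order, an alignment yields only a set, and the two meet inside channels.
-- Every rearrangement is therefore a `wire`. Wirings compose because they are deterministic, and
-- two wirings from a list without repetitions to the same list agree. Repetitions are excluded in
-- one direction by the conditions on π(V^in) and π(V^nin), read on lists, and in the other by the
-- disjointness of the alignment. They do occur in the n+1 copies of V^in that a query takes as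
-- input, so these are rearranged copy by copy. Wirings contain no queries. A monoidal family that
-- is deterministic on variables is thus natural at every wiring before anything is known about
-- queries, and this is what allows the equation for V^out to be carried along the discarding maps
-- to a smaller O.

private
  variable
    o ℓ e o′ ℓ′ e′ : Level

-- Coherence, and deterministic morphisms

module Markov (𝒞 : MarkovCategory o ℓ e) where
  open MarkovCategory 𝒞
  open HomReasoning
  open Equiv using (refl; sym; trans)

  pullˡ : ∀ {A B C D} {f : C ⇒ D} {g : B ⇒ C} {h : B ⇒ D} {k : A ⇒ B} →
          f ∘ g ≈ h → f ∘ (g ∘ k) ≈ h ∘ k
  pullˡ p = trans (sym assoc) (∘-congʳ p)

  cancelˡ : ∀ {A B C} {f : B ⇒ C} {g : C ⇒ B} {k : A ⇒ C} →
            f ∘ g ≈ id → f ∘ (g ∘ k) ≈ k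
  cancelˡ p = trans (pullˡ p) identityˡ

  square : ∀ {X A B B′ C} {f : B ⇒ C} {g : A ⇒ B} {h : B′ ⇒ C} {k : A ⇒ B′} {x : X ⇒ A} →
           f ∘ g ≈ h ∘ k → f ∘ (g ∘ x) ≈ h ∘ (k ∘ x)
  square p = trans (pullˡ p) assoc

  ⊗-congˡ : ∀ {A B C D} {f : A ⇒ B} {g h : C ⇒ D} → g ≈ h → f ⊗₁ g ≈ f ⊗₁ h
  ⊗-congˡ = ⊗-resp-≈ refl

  ⊗-congʳ : ∀ {A B C D} {f g : A ⇒ B} {h : C ⇒ D} → f ≈ g → f ⊗₁ h ≈ g ⊗₁ h
  ⊗-congʳ p = ⊗-resp-≈ p refl

  ⊗-∘ˡ : ∀ {A B C D} {f : B ⇒ C} {g : A ⇒ B} → (f ∘ g) ⊗₁ id {D} ≈ (f ⊗₁ id) ∘ (g ⊗₁ id)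
  ⊗-∘ˡ = trans (⊗-congˡ (sym identityˡ)) ⊗-∘

  ⊗-∘ʳ : ∀ {A B C D} {f : B ⇒ C} {g : A ⇒ B} → id {D} ⊗₁ (f ∘ g) ≈ (id ⊗₁ f) ∘ (id ⊗₁ g)
  ⊗-∘ʳ = trans (⊗-congʳ (sym identityˡ)) ⊗-∘

  ⊗-splitˡ : ∀ {A B C D} {f : A ⇒ B} {g : C ⇒ D} → f ⊗₁ g ≈ (f ⊗₁ id) ∘ (id ⊗₁ g)
  ⊗-splitˡ = trans (⊗-resp-≈ (sym identityʳ) (sym identityˡ)) ⊗-∘

  ⊗-splitʳ : ∀ {A B C D} {f : A ⇒ B} {g : C ⇒ D} → f ⊗₁ g ≈ (id ⊗₁ g) ∘ (f ⊗₁ id)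
  ⊗-splitʳ = trans (⊗-resp-≈ (sym identityˡ) (sym identityʳ)) ⊗-∘

  ⊗-inverse : ∀ {A B C D} {f : B ⇒ A} {g : A ⇒ B} {h : D ⇒ C} {k : C ⇒ D} →
              f ∘ g ≈ id → h ∘ k ≈ id → (f ⊗₁ h) ∘ (g ⊗₁ k) ≈ id
  ⊗-inverse p q = trans (sym ⊗-∘) (trans (⊗-resp-≈ p q) ⊗-id)

  section⇒epic : ∀ {A B} {f : A ⇒ B} {g : B ⇒ A} → f ∘ g ≈ id → Epic f
  section⇒epic {f = f} {g} p h k q = begin
    h           ≈⟨ identityʳ ⟨
    h ∘ id      ≈⟨ ∘-congˡ p ⟨
    h ∘ (f ∘ g) ≈⟨ square q ⟩
    k ∘ (f ∘ g) ≈⟨ ∘-congˡ p ⟩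
    k ∘ id      ≈⟨ identityʳ ⟩
    k           ∎

  epic-∘ : ∀ {A B C} {f : B ⇒ C} {g : A ⇒ B} → Epic f → Epic g → Epic (f ∘ g)
  epic-∘ p q h k r = p h k (q _ _ (trans assoc (trans r (sym assoc))))

  epic-resp-≈ : ∀ {A B} {f g : A ⇒ B} → f ≈ g → Epic f → Epic g
  epic-resp-≈ p q h k r = q h k (trans (∘-congˡ p) (trans r (sym (∘-congˡ p))))

  retraction⇒monic : ∀ {A B X} {f : A ⇒ B} {g : B ⇒ A} {h k : X ⇒ A} →
                     g ∘ f ≈ id → f ∘ h ≈ f ∘ k → h ≈ k
  retraction⇒monic {f = f} {g} {h} {k} p q = begin
    h           ≈⟨ cancelˡ p ⟨
    g ∘ (f ∘ h) ≈⟨ ∘-congˡ q ⟩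
    g ∘ (f ∘ k) ≈⟨ cancelˡ p ⟩
    k           ∎

  -- By naturality, tensoring with `I` is conjugation by the invertible unitor.
  I⊗-faithful : ∀ {A B} {f g : A ⇒ B} → id {I} ⊗₁ f ≈ id ⊗₁ g → f ≈ g
  I⊗-faithful {f = f} {g} p = section⇒epic lu-isoʳ f g (begin
    f ∘ lu           ≈⟨ lu-natural ⟨
    lu ∘ (id ⊗₁ f)   ≈⟨ ∘-congˡ p ⟩
    lu ∘ (id ⊗₁ g)   ≈⟨ lu-natural ⟩
    g ∘ lu           ∎)

  ⊗I-faithful : ∀ {A B} {f g : A ⇒ B} → f ⊗₁ id {I} ≈ g ⊗₁ id → f ≈ g
  ⊗I-faithful {f = f} {g} p = section⇒epic ru-isoʳ f g (begin
    f ∘ ru           ≈⟨ ru-natural ⟨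
    ru ∘ (f ⊗₁ id)   ≈⟨ ∘-congˡ p ⟩
    ru ∘ (g ⊗₁ id)   ≈⟨ ru-natural ⟩
    g ∘ ru           ∎)

  -- Kelly's argument: after tensoring with `I` and precomposing with the isomorphism
  -- `α ∘ (α ⊗₁ id)`, one pentagon and two triangles join the two sides.
  lu-⊗ : ∀ {A B} → lu ∘ α ≈ lu {A} ⊗₁ id {B}
  lu-⊗ {A} {B} = I⊗-faithful
    (section⇒epic (trans assoc (trans (∘-congˡ (cancelˡ (⊗-inverse α-isoʳ identityˡ))) α-isoʳ)) _ _ (begin
    (id ⊗₁ (lu ∘ α)) ∘ (α ∘ (α ⊗₁ id))         ≈⟨ ∘-congʳ ⊗-∘ʳ ⟩
    ((id ⊗₁ lu) ∘ (id ⊗₁ α)) ∘ (α ∘ (α ⊗₁ id)) ≈⟨ assoc ⟩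
    (id ⊗₁ lu) ∘ ((id ⊗₁ α) ∘ (α ∘ (α ⊗₁ id))) ≈⟨ ∘-congˡ pentagon ⟩
    (id ⊗₁ lu) ∘ (α ∘ α)                       ≈⟨ pullˡ triangle ⟩
    (ru ⊗₁ id) ∘ α                             ≈⟨ ∘-congʳ (⊗-congˡ ⊗-id) ⟨
    (ru ⊗₁ (id ⊗₁ id)) ∘ α                     ≈⟨ α-natural ⟨
    α ∘ ((ru ⊗₁ id) ⊗₁ id)                     ≈⟨ ∘-congˡ (⊗-congʳ triangle) ⟨
    α ∘ (((id ⊗₁ lu) ∘ α) ⊗₁ id)               ≈⟨ ∘-congˡ ⊗-∘ˡ ⟩
    α ∘ (((id ⊗₁ lu) ⊗₁ id) ∘ (α ⊗₁ id))       ≈⟨ square α-natural ⟩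
    (id ⊗₁ (lu ⊗₁ id)) ∘ (α ∘ (α ⊗₁ id))       ∎))

  ru-⊗ : ∀ {A B} → (id {A} ⊗₁ ru {B}) ∘ α ≈ ru
  ru-⊗ = ⊗I-faithful (retraction⇒monic α-isoˡ (begin
    α ∘ (((id ⊗₁ ru) ∘ α) ⊗₁ id)               ≈⟨ ∘-congˡ ⊗-∘ˡ ⟩
    α ∘ (((id ⊗₁ ru) ⊗₁ id) ∘ (α ⊗₁ id))       ≈⟨ square α-natural ⟩
    (id ⊗₁ (ru ⊗₁ id)) ∘ (α ∘ (α ⊗₁ id))       ≈⟨ ∘-congʳ (⊗-congˡ triangle) ⟨
    (id ⊗₁ ((id ⊗₁ lu) ∘ α)) ∘ (α ∘ (α ⊗₁ id)) ≈⟨ trans (∘-congʳ ⊗-∘ʳ) assoc ⟩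
    (id ⊗₁ (id ⊗₁ lu)) ∘ ((id ⊗₁ α) ∘ (α ∘ (α ⊗₁ id))) ≈⟨ ∘-congˡ pentagon ⟩
    (id ⊗₁ (id ⊗₁ lu)) ∘ (α ∘ α)               ≈⟨ square α-natural ⟨
    α ∘ (((id ⊗₁ id) ⊗₁ lu) ∘ α)               ≈⟨ ∘-congˡ (trans (∘-congʳ (⊗-congʳ ⊗-id)) triangle) ⟩
    α ∘ (ru ⊗₁ id)                             ∎))

  -- The hexagon at `A`, `I`, `I` becomes the triangle once `lu` and `σ` have been moved by
  -- naturality.
  lu-σ : ∀ {A} → lu ∘ σ ≈ ru {A}
  lu-σ = ⊗I-faithful (retraction⇒monic σ-invol (begin
    σ ∘ ((lu ∘ σ) ⊗₁ id)                ≈⟨ ∘-congˡ ⊗-∘ˡ ⟩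
    σ ∘ ((lu ⊗₁ id) ∘ (σ ⊗₁ id))        ≈⟨ ∘-congˡ (∘-congʳ lu-⊗) ⟨
    σ ∘ ((lu ∘ α) ∘ (σ ⊗₁ id))          ≈⟨ ∘-congˡ assoc ⟩
    σ ∘ (lu ∘ (α ∘ (σ ⊗₁ id)))          ≈⟨ square lu-natural ⟨
    lu ∘ ((id ⊗₁ σ) ∘ (α ∘ (σ ⊗₁ id)))  ≈⟨ ∘-congˡ hexagon ⟩
    lu ∘ (α ∘ (σ ∘ α))                  ≈⟨ pullˡ lu-⊗ ⟩
    (lu ⊗₁ id) ∘ (σ ∘ α)                ≈⟨ square σ-natural ⟨
    σ ∘ ((id ⊗₁ lu) ∘ α)                ≈⟨ ∘-congˡ triangle ⟩
    σ ∘ (ru ⊗₁ id)                      ∎))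

  ru-σ : ∀ {A} → ru ∘ σ ≈ lu {A}
  ru-σ = begin
    ru ∘ σ       ≈⟨ ∘-congʳ lu-σ ⟨
    (lu ∘ σ) ∘ σ ≈⟨ assoc ⟩
    lu ∘ (σ ∘ σ) ≈⟨ ∘-congˡ σ-invol ⟩
    lu ∘ id      ≈⟨ identityʳ ⟩
    lu           ∎

  !-unique₂ : ∀ {A} {f g : A ⇒ I} → f ≈ g
  !-unique₂ = trans (!-unique _) (sym (!-unique _))

  -- `I ⊗₀ I` is isomorphic to the terminal object `I`. This evaluates `copy` on `I` and `σ` on
  -- `I ⊗₀ I`, about which there are no axioms.
  I⊗I-terminal : ∀ {A} {f g : A ⇒ I ⊗₀ I} → f ≈ g
  I⊗I-terminal = retraction⇒monic lu-isoˡ !-unique₂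

  exchange : ∀ {A B C} → A ⊗₀ (B ⊗₀ C) ⇒ B ⊗₀ (A ⊗₀ C)
  exchange = α ∘ ((σ ⊗₁ id) ∘ α⁻¹)

  -- `middle {A} {B}` is by definition `swap {A} {A} {B} {B}`.
  swap : ∀ {A B C D} → (A ⊗₀ B) ⊗₀ (C ⊗₀ D) ⇒ (A ⊗₀ C) ⊗₀ (B ⊗₀ D)
  swap = α⁻¹ ∘ ((id ⊗₁ exchange) ∘ α)

  α⁻¹-natural : ∀ {A B C A′ B′ C′} {f : A ⇒ A′} {g : B ⇒ B′} {h : C ⇒ C′} →
                α⁻¹ ∘ (f ⊗₁ (g ⊗₁ h)) ≈ ((f ⊗₁ g) ⊗₁ h) ∘ α⁻¹
  α⁻¹-natural {f = f} {g} {h} = retraction⇒monic α-isoˡ (begin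
    α ∘ (α⁻¹ ∘ (f ⊗₁ (g ⊗₁ h)))     ≈⟨ cancelˡ α-isoʳ ⟩
    f ⊗₁ (g ⊗₁ h)                   ≈⟨ identityʳ ⟨
    (f ⊗₁ (g ⊗₁ h)) ∘ id            ≈⟨ ∘-congˡ α-isoʳ ⟨
    (f ⊗₁ (g ⊗₁ h)) ∘ (α ∘ α⁻¹)     ≈⟨ square α-natural ⟨
    α ∘ (((f ⊗₁ g) ⊗₁ h) ∘ α⁻¹)     ∎)

  swap-natural : ∀ {A B C D A′ B′ C′ D′}
                 {f : A ⇒ A′} {g : B ⇒ B′} {h : C ⇒ C′} {k : D ⇒ D′} →
                 swap ∘ ((f ⊗₁ g) ⊗₁ (h ⊗₁ k)) ≈ ((f ⊗₁ h) ⊗₁ (g ⊗₁ k)) ∘ swap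
  swap-natural {f = f} {g} {h} {k} = begin
    (α⁻¹ ∘ ((id ⊗₁ exchange) ∘ α)) ∘ ((f ⊗₁ g) ⊗₁ (h ⊗₁ k))  ≈⟨ trans assoc (∘-congˡ assoc) ⟩
    α⁻¹ ∘ ((id ⊗₁ exchange) ∘ (α ∘ ((f ⊗₁ g) ⊗₁ (h ⊗₁ k))))  ≈⟨ ∘-congˡ (∘-congˡ α-natural) ⟩
    α⁻¹ ∘ ((id ⊗₁ exchange) ∘ ((f ⊗₁ (g ⊗₁ (h ⊗₁ k))) ∘ α))  ≈⟨ ∘-congˡ (square id⊗exchange-natural) ⟩
    α⁻¹ ∘ ((f ⊗₁ (h ⊗₁ (g ⊗₁ k))) ∘ ((id ⊗₁ exchange) ∘ α))  ≈⟨ square α⁻¹-natural ⟩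
    ((f ⊗₁ h) ⊗₁ (g ⊗₁ k)) ∘ (α⁻¹ ∘ ((id ⊗₁ exchange) ∘ α))  ∎
    where
    exchange-natural : exchange ∘ (g ⊗₁ (h ⊗₁ k)) ≈ (h ⊗₁ (g ⊗₁ k)) ∘ exchange
    exchange-natural = begin
      exchange ∘ (g ⊗₁ (h ⊗₁ k))   ≈⟨ trans assoc (∘-congˡ assoc) ⟩
      α ∘ ((σ ⊗₁ id) ∘ (α⁻¹ ∘ (g ⊗₁ (h ⊗₁ k))))   ≈⟨ ∘-congˡ (∘-congˡ α⁻¹-natural) ⟩
      α ∘ ((σ ⊗₁ id) ∘ (((g ⊗₁ h) ⊗₁ k) ∘ α⁻¹))   ≈⟨ ∘-congˡ (square σ⊗id) ⟩
      α ∘ (((h ⊗₁ g) ⊗₁ k) ∘ ((σ ⊗₁ id) ∘ α⁻¹))   ≈⟨ square α-natural ⟩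
      (h ⊗₁ (g ⊗₁ k)) ∘ (α ∘ ((σ ⊗₁ id) ∘ α⁻¹))   ∎
      where
      σ⊗id : (σ ⊗₁ id) ∘ ((g ⊗₁ h) ⊗₁ k) ≈ ((h ⊗₁ g) ⊗₁ k) ∘ (σ ⊗₁ id)
      σ⊗id = trans (sym ⊗-∘)
        (trans (⊗-resp-≈ σ-natural (trans identityˡ (sym identityʳ))) ⊗-∘)

    id⊗exchange-natural : (id ⊗₁ exchange) ∘ (f ⊗₁ (g ⊗₁ (h ⊗₁ k))) ≈ (f ⊗₁ (h ⊗₁ (g ⊗₁ k))) ∘ (id ⊗₁ exchange)
    id⊗exchange-natural = trans (sym ⊗-∘)
      (trans (⊗-resp-≈ (trans identityˡ (sym identityʳ)) exchange-natural) ⊗-∘)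

  id-det : ∀ {A} → Deterministic (id {A})
  id-det = trans identityʳ (sym (trans (∘-congʳ ⊗-id) identityˡ))

  ∘-det : ∀ {A B C} {f : B ⇒ C} {g : A ⇒ B} →
          Deterministic f → Deterministic g → Deterministic (f ∘ g)
  ∘-det {f = f} {g} p q = begin
    copy ∘ (f ∘ g)                ≈⟨ square p ⟩
    (f ⊗₁ f) ∘ (copy ∘ g)         ≈⟨ ∘-congˡ q ⟩
    (f ⊗₁ f) ∘ ((g ⊗₁ g) ∘ copy)  ≈⟨ pullˡ (sym ⊗-∘) ⟩
    ((f ∘ g) ⊗₁ (f ∘ g)) ∘ copy   ∎

  ⊗-det : ∀ {A B C D} {f : A ⇒ B} {g : C ⇒ D} →
          Deterministic f → Deterministic g → Deterministic (f ⊗₁ g)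
  ⊗-det {f = f} {g} p q = begin
    copy ∘ (f ⊗₁ g)                             ≈⟨ trans (∘-congʳ copy-⊗) assoc ⟩
    swap ∘ ((copy ⊗₁ copy) ∘ (f ⊗₁ g))          ≈⟨ ∘-congˡ (trans (sym ⊗-∘) (trans (⊗-resp-≈ p q) ⊗-∘)) ⟩
    swap ∘ (((f ⊗₁ f) ⊗₁ (g ⊗₁ g)) ∘ (copy ⊗₁ copy)) ≈⟨ square swap-natural ⟩
    ((f ⊗₁ g) ⊗₁ (f ⊗₁ g)) ∘ (swap ∘ (copy ⊗₁ copy)) ≈⟨ ∘-congˡ copy-⊗ ⟨
    ((f ⊗₁ g) ⊗₁ (f ⊗₁ g)) ∘ copy               ∎

  inverse-det : ∀ {A B} {f : A ⇒ B} {g : B ⇒ A} → f ∘ g ≈ id → g ∘ f ≈ id →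
                Deterministic f → Deterministic g
  inverse-det {f = f} {g} p q d = retraction⇒monic (⊗-inverse q q) (begin
    (f ⊗₁ f) ∘ (copy ∘ g)        ≈⟨ square d ⟨
    copy ∘ (f ∘ g)               ≈⟨ trans (∘-congˡ p) identityʳ ⟩
    copy                         ≈⟨ cancelˡ (⊗-inverse p p) ⟨
    (f ⊗₁ f) ∘ ((g ⊗₁ g) ∘ copy) ∎)

  det-resp-≈ : ∀ {A B} {f g : A ⇒ B} → f ≈ g → Deterministic f → Deterministic g
  det-resp-≈ p d = trans (∘-congˡ (sym p)) (trans d (∘-congʳ (⊗-resp-≈ p p)))

  !-det : ∀ {A} → Deterministic (! {A})
  !-det = I⊗I-terminal

  lu⁻¹-⊗ : ∀ {A B} → α⁻¹ ∘ lu⁻¹ ≈ lu⁻¹ {A} ⊗₁ id {B}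
  lu⁻¹-⊗ = retraction⇒monic (⊗-inverse lu-isoˡ identityˡ) (begin
    (lu ⊗₁ id) ∘ (α⁻¹ ∘ lu⁻¹)     ≈⟨ ∘-congʳ lu-⊗ ⟨
    (lu ∘ α) ∘ (α⁻¹ ∘ lu⁻¹)       ≈⟨ trans assoc (∘-congˡ (cancelˡ α-isoʳ)) ⟩
    lu ∘ lu⁻¹                     ≈⟨ lu-isoʳ ⟩
    id                            ≈⟨ ⊗-inverse lu-isoʳ identityˡ ⟨
    (lu ⊗₁ id) ∘ (lu⁻¹ ⊗₁ id)     ∎)

  α-lu⁻¹ : ∀ {A B} → α ∘ (lu⁻¹ {A} ⊗₁ id {B}) ≈ lu⁻¹
  α-lu⁻¹ = trans (∘-congˡ (sym lu⁻¹-⊗)) (cancelˡ α-isoʳ)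

  α-ru⁻¹ : ∀ {A B} → α ∘ (ru⁻¹ {A} ⊗₁ id {B}) ≈ id ⊗₁ lu⁻¹
  α-ru⁻¹ = retraction⇒monic (⊗-inverse identityˡ lu-isoˡ) (begin
    (id ⊗₁ lu) ∘ (α ∘ (ru⁻¹ ⊗₁ id)) ≈⟨ pullˡ triangle ⟩
    (ru ⊗₁ id) ∘ (ru⁻¹ ⊗₁ id)       ≈⟨ ⊗-inverse ru-isoʳ identityˡ ⟩
    id                              ≈⟨ ⊗-inverse identityˡ lu-isoʳ ⟨
    (id ⊗₁ lu) ∘ (id ⊗₁ lu⁻¹)       ∎)

  σ-lu⁻¹ : ∀ {A} → σ ∘ lu⁻¹ ≈ ru⁻¹ {A}
  σ-lu⁻¹ = retraction⇒monic ru-isoˡ (begin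
    ru ∘ (σ ∘ lu⁻¹) ≈⟨ pullˡ ru-σ ⟩
    lu ∘ lu⁻¹       ≈⟨ lu-isoʳ ⟩
    id              ≈⟨ ru-isoʳ ⟨
    ru ∘ ru⁻¹       ∎)

  σ-ru⁻¹ : ∀ {A} → σ ∘ ru⁻¹ ≈ lu⁻¹ {A}
  σ-ru⁻¹ = trans (∘-congˡ (sym σ-lu⁻¹)) (cancelˡ σ-invol)

  α⁻¹-lu⁻¹ : ∀ {A B} → α⁻¹ ∘ (id {A} ⊗₁ lu⁻¹ {B}) ≈ ru⁻¹ ⊗₁ id
  α⁻¹-lu⁻¹ = trans (∘-congˡ (sym α-ru⁻¹)) (cancelˡ α-isoˡ)

  exchange-lu⁻¹ : ∀ {A B} → exchange ∘ lu⁻¹ ≈ id {A} ⊗₁ lu⁻¹ {B}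
  exchange-lu⁻¹ = begin
    exchange ∘ lu⁻¹     ≈⟨ trans assoc (∘-congˡ assoc) ⟩
    α ∘ ((σ ⊗₁ id) ∘ (α⁻¹ ∘ lu⁻¹))     ≈⟨ ∘-congˡ (∘-congˡ lu⁻¹-⊗) ⟩
    α ∘ ((σ ⊗₁ id) ∘ (lu⁻¹ ⊗₁ id))     ≈⟨ ∘-congˡ (trans (sym ⊗-∘ˡ) (⊗-congʳ σ-lu⁻¹)) ⟩
    α ∘ (ru⁻¹ ⊗₁ id)                   ≈⟨ α-ru⁻¹ ⟩
    id ⊗₁ lu⁻¹                         ∎

  exchange-id⊗lu⁻¹ : ∀ {A B} → exchange ∘ (id {A} ⊗₁ lu⁻¹ {B}) ≈ lu⁻¹
  exchange-id⊗lu⁻¹ = begin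
    exchange ∘ (id ⊗₁ lu⁻¹)  ≈⟨ trans assoc (∘-congˡ assoc) ⟩
    α ∘ ((σ ⊗₁ id) ∘ (α⁻¹ ∘ (id ⊗₁ lu⁻¹)))  ≈⟨ ∘-congˡ (∘-congˡ α⁻¹-lu⁻¹) ⟩
    α ∘ ((σ ⊗₁ id) ∘ (ru⁻¹ ⊗₁ id))          ≈⟨ ∘-congˡ (trans (sym ⊗-∘ˡ) (⊗-congʳ σ-ru⁻¹)) ⟩
    α ∘ (lu⁻¹ ⊗₁ id)                        ≈⟨ α-lu⁻¹ ⟩
    lu⁻¹                                    ∎

  -- This is determinism of `lu`. On `I`, `copy` can only be `ru⁻¹`; carried through the associators
  -- and `exchange` it becomes a `lu⁻¹` that cancels the second `lu`, and `lu-⊗` absorbs the first.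
  copy-lu : ∀ {A} → copy ∘ lu {A} ≈ (lu ⊗₁ lu) ∘ copy
  copy-lu = sym (begin
    (lu ⊗₁ lu) ∘ copy
      ≈⟨ ∘-congˡ copy-⊗ ⟩
    (lu ⊗₁ lu) ∘ (swap ∘ (copy ⊗₁ copy))
      ≈⟨ ∘-congˡ (trans assoc (∘-congˡ assoc)) ⟩
    (lu ⊗₁ lu) ∘ (α⁻¹ ∘ ((id ⊗₁ exchange) ∘ (α ∘ (copy ⊗₁ copy))))
      ≈⟨ ∘-congˡ (∘-congˡ (∘-congˡ (∘-congˡ (trans (⊗-congʳ I⊗I-terminal) ⊗-splitˡ)))) ⟩
    (lu ⊗₁ lu) ∘ (α⁻¹ ∘ ((id ⊗₁ exchange) ∘ (α ∘ ((ru⁻¹ ⊗₁ id) ∘ (id ⊗₁ copy)))))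
      ≈⟨ ∘-congˡ (∘-congˡ (∘-congˡ (pullˡ α-ru⁻¹))) ⟩
    (lu ⊗₁ lu) ∘ (α⁻¹ ∘ ((id ⊗₁ exchange) ∘ ((id ⊗₁ lu⁻¹) ∘ (id ⊗₁ copy))))
      ≈⟨ ∘-congˡ (∘-congˡ (pullˡ (trans (sym ⊗-∘ʳ) (⊗-congˡ exchange-lu⁻¹)))) ⟩
    (lu ⊗₁ lu) ∘ (α⁻¹ ∘ ((id ⊗₁ (id ⊗₁ lu⁻¹)) ∘ (id ⊗₁ copy)))
      ≈⟨ ∘-congˡ (square α⁻¹-natural) ⟩
    (lu ⊗₁ lu) ∘ (((id ⊗₁ id) ⊗₁ lu⁻¹) ∘ (α⁻¹ ∘ (id ⊗₁ copy)))
      ≈⟨ pullˡ (trans (sym ⊗-∘) (⊗-resp-≈ (trans (∘-congˡ ⊗-id) identityʳ) lu-isoʳ)) ⟩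
    (lu ⊗₁ id) ∘ (α⁻¹ ∘ (id ⊗₁ copy))
      ≈⟨ trans (∘-congʳ (sym lu-⊗)) (trans assoc (∘-congˡ (cancelˡ α-isoʳ))) ⟩
    lu ∘ (id ⊗₁ copy)
      ≈⟨ lu-natural ⟩
    copy ∘ lu ∎)
  copy-ru : ∀ {A} → copy ∘ ru {A} ≈ (ru ⊗₁ ru) ∘ copy
  copy-ru = sym (begin
    (ru ⊗₁ ru) ∘ copy
      ≈⟨ ∘-congˡ copy-⊗ ⟩
    (ru ⊗₁ ru) ∘ (swap ∘ (copy ⊗₁ copy))
      ≈⟨ ∘-congˡ (trans assoc (∘-congˡ assoc)) ⟩
    (ru ⊗₁ ru) ∘ (α⁻¹ ∘ ((id ⊗₁ exchange) ∘ (α ∘ (copy ⊗₁ copy))))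
      ≈⟨ ∘-congˡ (∘-congˡ (∘-congˡ (∘-congˡ (trans (⊗-congˡ I⊗I-terminal) ⊗-splitʳ)))) ⟩
    (ru ⊗₁ ru) ∘ (α⁻¹ ∘ ((id ⊗₁ exchange) ∘ (α ∘ ((id ⊗₁ lu⁻¹) ∘ (copy ⊗₁ id)))))
      ≈⟨ ∘-congˡ (∘-congˡ (∘-congˡ (square (trans (∘-congˡ (⊗-congʳ (sym ⊗-id))) α-natural)))) ⟩
    (ru ⊗₁ ru) ∘ (α⁻¹ ∘ ((id ⊗₁ exchange) ∘ ((id ⊗₁ (id ⊗₁ lu⁻¹)) ∘ (α ∘ (copy ⊗₁ id)))))
      ≈⟨ ∘-congˡ (∘-congˡ (pullˡ (trans (sym ⊗-∘ʳ) (⊗-congˡ exchange-id⊗lu⁻¹)))) ⟩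
    (ru ⊗₁ ru) ∘ (α⁻¹ ∘ ((id ⊗₁ lu⁻¹) ∘ (α ∘ (copy ⊗₁ id))))
      ≈⟨ ∘-congˡ (pullˡ α⁻¹-lu⁻¹) ⟩
    (ru ⊗₁ ru) ∘ ((ru⁻¹ ⊗₁ id) ∘ (α ∘ (copy ⊗₁ id)))
      ≈⟨ pullˡ (trans (sym ⊗-∘) (⊗-resp-≈ ru-isoʳ identityʳ)) ⟩
    (id ⊗₁ ru) ∘ (α ∘ (copy ⊗₁ id))
      ≈⟨ pullˡ ru-⊗ ⟩
    ru ∘ (copy ⊗₁ id)
      ≈⟨ ru-natural ⟩
    copy ∘ ru ∎)
  -- Both sides are the fourfold copy. In right-nested form `swap` only exchanges the two middle
  -- outputs, which cocommutativity absorbs.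
  copy-det : ∀ {A} → Deterministic (copy {A})
  copy-det = begin
    copy ∘ copy
      ≈⟨ trans (∘-congʳ copy-⊗) assoc ⟩
    swap ∘ ((copy ⊗₁ copy) ∘ copy)
      ≈⟨ trans assoc (∘-congˡ assoc) ⟩
    α⁻¹ ∘ ((id ⊗₁ exchange) ∘ (α ∘ ((copy ⊗₁ copy) ∘ copy)))
      ≈⟨ ∘-congˡ (∘-congˡ α-copies) ⟩
    α⁻¹ ∘ ((id ⊗₁ exchange) ∘ ((id ⊗₁ ((id ⊗₁ copy) ∘ copy)) ∘ copy))
      ≈⟨ ∘-congˡ (pullˡ (trans (sym ⊗-∘ʳ) (⊗-congˡ exchange-copies))) ⟩
    α⁻¹ ∘ ((id ⊗₁ ((id ⊗₁ copy) ∘ copy)) ∘ copy)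
      ≈⟨ ∘-congˡ α-copies ⟨
    α⁻¹ ∘ (α ∘ ((copy ⊗₁ copy) ∘ copy))
      ≈⟨ cancelˡ α-isoˡ ⟩
    (copy ⊗₁ copy) ∘ copy ∎
    where
    α-copies : ∀ {A} → α ∘ ((copy ⊗₁ copy) ∘ copy {A}) ≈ (id ⊗₁ ((id ⊗₁ copy) ∘ copy)) ∘ copy
    α-copies = begin
      α ∘ ((copy ⊗₁ copy) ∘ copy)                 ≈⟨ ∘-congˡ (trans (∘-congʳ ⊗-splitʳ) assoc) ⟩
      α ∘ ((id ⊗₁ copy) ∘ ((copy ⊗₁ id) ∘ copy))  ≈⟨ square (trans (∘-congˡ (⊗-congʳ (sym ⊗-id))) α-natural) ⟩
      (id ⊗₁ (id ⊗₁ copy)) ∘ (α ∘ ((copy ⊗₁ id) ∘ copy)) ≈⟨ ∘-congˡ copy-assoc ⟩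
      (id ⊗₁ (id ⊗₁ copy)) ∘ ((id ⊗₁ copy) ∘ copy) ≈⟨ pullˡ (sym ⊗-∘ʳ) ⟩
      (id ⊗₁ ((id ⊗₁ copy) ∘ copy)) ∘ copy        ∎

    exchange-copies : ∀ {A} → exchange ∘ ((id ⊗₁ copy) ∘ copy {A}) ≈ (id ⊗₁ copy) ∘ copy
    exchange-copies = begin
      exchange ∘ ((id ⊗₁ copy) ∘ copy)                      ≈⟨ ∘-congˡ copy-assoc ⟨
      exchange ∘ (α ∘ ((copy ⊗₁ id) ∘ copy))                ≈⟨ trans assoc (∘-congˡ assoc) ⟩
      α ∘ ((σ ⊗₁ id) ∘ (α⁻¹ ∘ (α ∘ ((copy ⊗₁ id) ∘ copy)))) ≈⟨ ∘-congˡ (∘-congˡ (cancelˡ α-isoˡ)) ⟩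
      α ∘ ((σ ⊗₁ id) ∘ ((copy ⊗₁ id) ∘ copy))            ≈⟨ ∘-congˡ (pullˡ (trans (sym ⊗-∘ˡ) (⊗-congʳ copy-comm))) ⟩
      α ∘ ((copy ⊗₁ id) ∘ copy)                          ≈⟨ copy-assoc ⟩
      (id ⊗₁ copy) ∘ copy                                ∎

  fst : ∀ {A B} → A ⊗₀ B ⇒ A
  fst = ru ∘ (id ⊗₁ !)

  snd : ∀ {A B} → A ⊗₀ B ⇒ B
  snd = lu ∘ (! ⊗₁ id)

  fst-det : ∀ {A B} → Deterministic (fst {A} {B})
  fst-det = ∘-det copy-ru (⊗-det id-det !-det)

  snd-det : ∀ {A B} → Deterministic (snd {A} {B})
  snd-det = ∘-det copy-lu (⊗-det !-det id-det)

  ru-fst : ∀ {A B C} {f : A ⇒ C} → ru ∘ (f ⊗₁ ! {B}) ≈ f ∘ fst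
  ru-fst {f = f} = begin
    ru ∘ (f ⊗₁ !)                ≈⟨ ∘-congˡ (trans (⊗-resp-≈ (sym identityʳ) (sym identityˡ)) ⊗-∘) ⟩
    ru ∘ ((f ⊗₁ id) ∘ (id ⊗₁ !)) ≈⟨ square ru-natural ⟩
    f ∘ fst                      ∎

  lu-snd : ∀ {A B C} {f : B ⇒ C} → lu ∘ (! {A} ⊗₁ f) ≈ f ∘ snd
  lu-snd {f = f} = begin
    lu ∘ (! ⊗₁ f)                ≈⟨ ∘-congˡ (trans (⊗-resp-≈ (sym identityˡ) (sym identityʳ)) ⊗-∘) ⟩
    lu ∘ ((id ⊗₁ f) ∘ (! ⊗₁ id)) ≈⟨ square lu-natural ⟩
    f ∘ snd                      ∎

  fst-⊗ : ∀ {A B C D} {f : A ⇒ B} {g : C ⇒ D} → fst ∘ (f ⊗₁ g) ≈ f ∘ fst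
  fst-⊗ = trans assoc
    (trans (∘-congˡ (trans (sym ⊗-∘) (⊗-resp-≈ identityˡ (!-unique _)))) ru-fst)

  snd-⊗ : ∀ {A B C D} {f : A ⇒ B} {g : C ⇒ D} → snd ∘ (f ⊗₁ g) ≈ g ∘ snd
  snd-⊗ = trans assoc
    (trans (∘-congˡ (trans (sym ⊗-∘) (⊗-resp-≈ (!-unique _) identityˡ))) lu-snd)

  snd-copy : ∀ {A} → snd ∘ copy ≈ id {A}
  snd-copy = trans assoc copy-unit

  fst-copy : ∀ {A} → fst ∘ copy ≈ id {A}
  fst-copy = begin
    (ru ∘ (id ⊗₁ !)) ∘ copy       ≈⟨ assoc ⟩
    ru ∘ ((id ⊗₁ !) ∘ copy)       ≈⟨ ∘-congˡ (∘-congˡ copy-comm) ⟨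
    ru ∘ ((id ⊗₁ !) ∘ (σ ∘ copy)) ≈⟨ ∘-congˡ (square σ-natural) ⟨
    ru ∘ (σ ∘ ((! ⊗₁ id) ∘ copy)) ≈⟨ pullˡ ru-σ ⟩
    lu ∘ ((! ⊗₁ id) ∘ copy)       ≈⟨ copy-unit ⟩
    id                            ∎

  swap-unit : ∀ {A B} → swap {A} {I} {I} {B} ≈ id
  swap-unit = begin
    α⁻¹ ∘ ((id ⊗₁ exchange) ∘ α)
      ≈⟨ ∘-congˡ (∘-congʳ (⊗-congˡ (∘-congˡ (trans (∘-congʳ (trans (⊗-congʳ I⊗I-terminal) ⊗-id)) identityˡ)))) ⟩
    α⁻¹ ∘ ((id ⊗₁ (α ∘ α⁻¹)) ∘ α)
      ≈⟨ ∘-congˡ (trans (∘-congʳ (trans (⊗-congˡ α-isoʳ) ⊗-id)) identityˡ) ⟩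
    α⁻¹ ∘ α
      ≈⟨ α-isoˡ ⟩
    id ∎

  -- The tensor is not a product, but this half of the product laws survives: by naturality the
  -- discarding happens before `swap`, which then acts with `I` as both middle factors and is the
  -- identity.
  fst⊗snd-copy : ∀ {A B} → (fst {A} {B} ⊗₁ snd) ∘ copy ≈ id
  fst⊗snd-copy = begin
    (fst ⊗₁ snd) ∘ copy
      ≈⟨ ∘-resp-≈ ⊗-∘ copy-⊗ ⟩
    ((ru ⊗₁ lu) ∘ ((id ⊗₁ !) ⊗₁ (! ⊗₁ id))) ∘ (swap ∘ (copy ⊗₁ copy))
      ≈⟨ trans assoc (∘-congˡ (square (sym swap-natural))) ⟩
    (ru ⊗₁ lu) ∘ (swap ∘ (((id ⊗₁ !) ⊗₁ (! ⊗₁ id)) ∘ (copy ⊗₁ copy)))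
      ≈⟨ ∘-congˡ (trans (∘-congʳ swap-unit) identityˡ) ⟩
    (ru ⊗₁ lu) ∘ (((id ⊗₁ !) ⊗₁ (! ⊗₁ id)) ∘ (copy ⊗₁ copy))
      ≈⟨ pullˡ (sym ⊗-∘) ⟩
    (fst ⊗₁ snd) ∘ (copy ⊗₁ copy)
      ≈⟨ ⊗-inverse fst-copy snd-copy ⟩
    id ∎

  -- Brings a tensor of wirings into the form in which `wire` itself is defined, a `copy` followed
  -- by one wiring per output.
  ⊗-as-copy : ∀ {A B C D} {f : A ⇒ B} {g : C ⇒ D} →
              f ⊗₁ g ≈ ((f ∘ fst) ⊗₁ (g ∘ snd)) ∘ copy
  ⊗-as-copy {f = f} {g} = begin
    f ⊗₁ g                            ≈⟨ identityʳ ⟨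
    (f ⊗₁ g) ∘ id                     ≈⟨ ∘-congˡ fst⊗snd-copy ⟨
    (f ⊗₁ g) ∘ ((fst ⊗₁ snd) ∘ copy)  ≈⟨ pullˡ (sym ⊗-∘) ⟩
    ((f ∘ fst) ⊗₁ (g ∘ snd)) ∘ copy   ∎

-- Wirings

module _ {T : Set} where

  -- `∈-++⁺ˡ` and `∈-++⁺ʳ` jointly invert `∈-++⁻`, so `p` may be taken in one of two forms on which
  -- `project` is known.
  ∈-++-elim : ∀ (xs : List T) {ys x} (P : x ∈ₗ xs ++ ys → Set) →
              (∀ p → P (∈-++⁺ˡ p)) → (∀ p → P (∈-++⁺ʳ xs p)) → ∀ p → P p
  ∈-++-elim xs P l r p with ∈-++⁻ xs p | ++⁺∘++⁻ xs p
  ... | inj₁ q | ≡.refl = l q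
  ... | inj₂ q | ≡.refl = r q

  either : ∀ {xs ys zs : List T} → xs ⊆ₗ zs → ys ⊆ₗ zs → xs ++ ys ⊆ₗ zs
  either {xs} f g p = [ f , g ]′ (∈-++⁻ xs p)

  either-++⁺ˡ : ∀ {xs ys zs : List T} (f : xs ⊆ₗ zs) (g : ys ⊆ₗ zs) {x} (p : x ∈ₗ xs) →
                either {xs} {ys} f g (∈-++⁺ˡ p) ≡ f p
  either-++⁺ˡ {xs} f g p = cong [ f , g ]′ (++⁻∘++⁺ xs (inj₁ p))

  either-++⁺ʳ : ∀ {xs ys zs : List T} (f : xs ⊆ₗ zs) (g : ys ⊆ₗ zs) {x} (p : x ∈ₗ ys) →
                either {xs} {ys} f g (∈-++⁺ʳ xs p) ≡ g p
  either-++⁺ʳ {xs} f g p = cong [ f , g ]′ (++⁻∘++⁺ xs (inj₂ p))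

  either-unique : ∀ {xs ys zs : List T} (f : xs ⊆ₗ zs) (g : ys ⊆ₗ zs) (h : xs ++ ys ⊆ₗ zs) →
                  (∀ {x} (p : x ∈ₗ xs) → f p ≡ h (∈-++⁺ˡ p)) →
                  (∀ {x} (p : x ∈ₗ ys) → g p ≡ h (∈-++⁺ʳ xs p)) →
                  ∀ {x} (p : x ∈ₗ xs ++ ys) → either {xs} {ys} f g p ≡ h p
  either-unique {xs} f g h l r = ∈-++-elim xs (λ p → either f g p ≡ h p)
    (λ p → ≡.trans (either-++⁺ˡ f g p) (l p))
    (λ p → ≡.trans (either-++⁺ʳ f g p) (r p))

  -- `permute` depends on the positions computed by `∈-resp-↭`. They are traced through
  -- concatenations explicitly because `permute-++⁺` is applied to the copies of V^in, whose list
  -- has repetitions and hence several positions for one variable.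
  ∈-resp-++⁺ʳ-ˡ : ∀ {xs ys zs : List T} (s : xs ↭ ys) {x} (p : x ∈ₗ xs) →
                  ∈-resp-↭ (++⁺ʳ zs s) (∈-++⁺ˡ p) ≡ ∈-++⁺ˡ (∈-resp-↭ s p)
  ∈-resp-++⁺ʳ-ˡ ↭.refl         p                 = ≡.refl
  ∈-resp-++⁺ʳ-ˡ (↭.prep x s)   (here _)          = ≡.refl
  ∈-resp-++⁺ʳ-ˡ (↭.prep x s)   (there p)         = cong there (∈-resp-++⁺ʳ-ˡ s p)
  ∈-resp-++⁺ʳ-ˡ (↭.swap x y s) (here _)          = ≡.refl
  ∈-resp-++⁺ʳ-ˡ (↭.swap x y s) (there (here _))  = ≡.refl
  ∈-resp-++⁺ʳ-ˡ (↭.swap x y s) (there (there p)) = cong (λ q → there (there q)) (∈-resp-++⁺ʳ-ˡ s p)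
  ∈-resp-++⁺ʳ-ˡ {zs = zs} (↭.trans s t) p =
    ≡.trans (cong (∈-resp-↭ (++⁺ʳ zs t)) (∈-resp-++⁺ʳ-ˡ s p)) (∈-resp-++⁺ʳ-ˡ t _)

  ∈-resp-++⁺ʳ-ʳ : ∀ {xs ys zs : List T} (s : xs ↭ ys) {x} (p : x ∈ₗ zs) →
                  ∈-resp-↭ (++⁺ʳ zs s) (∈-++⁺ʳ xs p) ≡ ∈-++⁺ʳ ys p
  ∈-resp-++⁺ʳ-ʳ ↭.refl         p = ≡.refl
  ∈-resp-++⁺ʳ-ʳ (↭.prep x s)   p = cong there (∈-resp-++⁺ʳ-ʳ s p)
  ∈-resp-++⁺ʳ-ʳ (↭.swap x y s) p = cong (λ q → there (there q)) (∈-resp-++⁺ʳ-ʳ s p)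
  ∈-resp-++⁺ʳ-ʳ {zs = zs} (↭.trans s t) p =
    ≡.trans (cong (∈-resp-↭ (++⁺ʳ zs t)) (∈-resp-++⁺ʳ-ʳ s p)) (∈-resp-++⁺ʳ-ʳ t p)

  ∈-resp-++⁺ˡ-ˡ : ∀ (xs : List T) {ys zs} (s : ys ↭ zs) {x} (p : x ∈ₗ xs) →
                  ∈-resp-↭ (++⁺ˡ xs s) (∈-++⁺ˡ p) ≡ ∈-++⁺ˡ p
  ∈-resp-++⁺ˡ-ˡ (x ∷ xs) s (here _)  = ≡.refl
  ∈-resp-++⁺ˡ-ˡ (x ∷ xs) s (there p) = cong there (∈-resp-++⁺ˡ-ˡ xs s p)

  ∈-resp-++⁺ˡ-ʳ : ∀ (xs : List T) {ys zs} (s : ys ↭ zs) {x} (p : x ∈ₗ ys) →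
                  ∈-resp-↭ (++⁺ˡ xs s) (∈-++⁺ʳ xs p) ≡ ∈-++⁺ʳ xs (∈-resp-↭ s p)
  ∈-resp-++⁺ˡ-ʳ []       s p = ≡.refl
  ∈-resp-++⁺ˡ-ʳ (x ∷ xs) s p = cong there (∈-resp-++⁺ˡ-ʳ xs s p)

module Wiring {Q : Signature} where
  open Signature Q
  open MarkovCategory (Free Q)
  open Markov (Free Q)
  open HomReasoning
  private
    module E = Equiv

  project-++⁺ˡ : ∀ A B {x} (p : x ∈ₗ vars A) →
                 project {Q} (A ⊗ B) (∈-++⁺ˡ p) ≈ project A p ∘ fst
  project-++⁺ˡ A B p rewrite ++⁻∘++⁺ (vars A) {vars B} (inj₁ p) = ru-fst

  project-++⁺ʳ : ∀ A B {x} (p : x ∈ₗ vars B) →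
                 project {Q} (A ⊗ B) (∈-++⁺ʳ (vars A) p) ≈ project B p ∘ snd
  project-++⁺ʳ A B p rewrite ++⁻∘++⁺ (vars A) {vars B} (inj₂ p) = lu-snd

  project-cong : ∀ A {x} {p q : x ∈ₗ vars A} → p ≡ q → project {Q} A p ≈ project A q
  project-cong A ≡.refl = E.refl

  project-det : ∀ A {x} (p : x ∈ₗ vars A) → Deterministic (project {Q} A p)
  project-det (var x) (here ≡.refl) = id-det
  project-det (A ⊗ B) = ∈-++-elim (vars A) (λ p → Deterministic (project (A ⊗ B) p))
    (λ p → det-resp-≈ (E.sym (project-++⁺ˡ A B p)) (∘-det (project-det A p) fst-det))
    (λ p → det-resp-≈ (E.sym (project-++⁺ʳ A B p)) (∘-det (project-det B p) snd-det))

  wire-cong : ∀ {A} B {f g : vars B ⊆ₗ vars A} → (∀ {x} (p : x ∈ₗ vars B) → f p ≡ g p) →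
              wire {Q} {A} B f ≈ wire B g
  wire-cong unit    h = E.refl
  wire-cong {A} (var x) h = project-cong A (h (here ≡.refl))
  wire-cong {A} (B ⊗ D) h = ∘-congʳ (⊗-resp-≈ (wire-cong B (λ p → h (∈-++⁺ˡ p)))
                                               (wire-cong D (λ p → h (∈-++⁺ʳ (vars B) p))))

  -- A list without repetitions has at most one membership proof per element. All comparisons of
  -- differently described rearrangements rest on this.
  wire-unique : ∀ {A} B {f g : vars B ⊆ₗ vars A} → Unique (vars A) →
                wire {Q} {A} B f ≈ wire B g
  wire-unique B u = wire-cong B λ _ → unique⇒irrelevant u _ _

  wire-det : ∀ {A} B (f : vars B ⊆ₗ vars A) → Deterministic (wire {Q} {A} B f)
  wire-det unit    f = !-det
  wire-det {A} (var x) f = project-det A (f (here ≡.refl))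
  wire-det (B ⊗ D) f = ∘-det (⊗-det (wire-det B _) (wire-det D _)) copy-det

  -- On a tensor the branch that is not selected is discarded, and `copy` followed by a marginal is
  -- the identity.
  project-wire : ∀ {A} B (f : vars B ⊆ₗ vars A) {x} (p : x ∈ₗ vars B) →
                 project B p ∘ wire {Q} {A} B f ≈ project A (f p)
  project-wire (var x) f (here ≡.refl) = identityˡ
  project-wire {A} (B ⊗ D) f = ∈-++-elim (vars B)
    (λ p → project (B ⊗ D) p ∘ wire (B ⊗ D) f ≈ project A (f p))
    (λ p → begin
      project (B ⊗ D) (∈-++⁺ˡ p) ∘ wire (B ⊗ D) f
        ≈⟨ E.trans (∘-congʳ (project-++⁺ˡ B D p)) assoc ⟩
      project B p ∘ (fst ∘ ((wB ⊗₁ wD) ∘ copy))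
        ≈⟨ ∘-congˡ (E.trans (square fst-⊗) (E.trans (∘-congˡ fst-copy) identityʳ)) ⟩
      project B p ∘ wB
        ≈⟨ project-wire B _ p ⟩
      project A (f (∈-++⁺ˡ p)) ∎)
    (λ p → begin
      project (B ⊗ D) (∈-++⁺ʳ (vars B) p) ∘ wire (B ⊗ D) f
        ≈⟨ E.trans (∘-congʳ (project-++⁺ʳ B D p)) assoc ⟩
      project D p ∘ (snd ∘ ((wB ⊗₁ wD) ∘ copy))
        ≈⟨ ∘-congˡ (E.trans (square snd-⊗) (E.trans (∘-congˡ snd-copy) identityʳ)) ⟩
      project D p ∘ wD
        ≈⟨ project-wire D _ p ⟩
      project A (f (∈-++⁺ʳ (vars B) p)) ∎)
    where
    wB : A ⇒ B
    wB = wire B (λ p → f (∈-++⁺ˡ p))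
    wD : A ⇒ D
    wD = wire D (λ p → f (∈-++⁺ʳ (vars B) p))

  -- The first wiring is deterministic, so it passes through the copies made by the second and
  -- reaches each output separately.
  wire-∘ : ∀ {A B} C {f : vars B ⊆ₗ vars A} {g : vars C ⊆ₗ vars B} →
           wire {Q} {B} C g ∘ wire {Q} {A} B f ≈ wire C (λ p → f (g p))
  wire-∘ unit = !-unique _
  wire-∘ {B = B} (var x) {f} {g} = project-wire B f (g (here ≡.refl))
  wire-∘ {A} {B} (C ⊗ D) {f} {g} = begin
    ((wC ⊗₁ wD) ∘ copy) ∘ wire B f             ≈⟨ E.trans assoc (∘-congˡ (wire-det B f)) ⟩
    (wC ⊗₁ wD) ∘ ((wire B f ⊗₁ wire B f) ∘ copy) ≈⟨ pullˡ (E.sym ⊗-∘) ⟩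
    ((wC ∘ wire B f) ⊗₁ (wD ∘ wire B f)) ∘ copy ≈⟨ ∘-congʳ (⊗-resp-≈ (wire-∘ C) (wire-∘ D)) ⟩
    wire (C ⊗ D) (λ p → f (g p)) ∎
    where
    wC : B ⇒ C
    wC = wire C (λ p → g (∈-++⁺ˡ p))
    wD : B ⇒ D
    wD = wire D (λ p → g (∈-++⁺ʳ (vars C) p))

  wire-++⁺ˡ : ∀ {A} B C {f : vars C ⊆ₗ vars A} →
              wire {Q} {A ⊗ B} C (λ p → ∈-++⁺ˡ (f p)) ≈ wire C f ∘ fst
  wire-++⁺ˡ B unit = E.sym (!-unique _)
  wire-++⁺ˡ {A} B (var x) = project-++⁺ˡ A B _
  wire-++⁺ˡ B (C ⊗ D) = E.trans
    (∘-congʳ (E.trans (⊗-resp-≈ (wire-++⁺ˡ B C) (wire-++⁺ˡ B D)) ⊗-∘))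
    (E.trans assoc (E.trans (∘-congˡ (E.sym fst-det)) (E.sym assoc)))

  wire-++⁺ʳ : ∀ A {B} C {f : vars C ⊆ₗ vars B} →
              wire {Q} {A ⊗ B} C (λ p → ∈-++⁺ʳ (vars A) (f p)) ≈ wire C f ∘ snd
  wire-++⁺ʳ A unit = E.sym (!-unique _)
  wire-++⁺ʳ A {B} (var x) = project-++⁺ʳ A B _
  wire-++⁺ʳ A (C ⊗ D) = E.trans
    (∘-congʳ (E.trans (⊗-resp-≈ (wire-++⁺ʳ A C) (wire-++⁺ʳ A D)) ⊗-∘))
    (E.trans assoc (E.trans (∘-congˡ (E.sym snd-det)) (E.sym assoc)))

  wire-id : ∀ A → wire {Q} {A} A (λ p → p) ≈ id
  wire-id unit    = E.sym (!-unique _)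
  wire-id (var x) = E.refl
  wire-id (A ⊗ B) = begin
    (wire A ∈-++⁺ˡ ⊗₁ wire B (∈-++⁺ʳ (vars A))) ∘ copy
      ≈⟨ ∘-congʳ (⊗-resp-≈ (wire-++⁺ˡ B A) (wire-++⁺ʳ A B)) ⟩
    ((wire A (λ p → p) ∘ fst) ⊗₁ (wire B (λ p → p) ∘ snd)) ∘ copy
      ≈⟨ ∘-congʳ (⊗-resp-≈ (E.trans (∘-congʳ (wire-id A)) identityˡ)
                           (E.trans (∘-congʳ (wire-id B)) identityˡ)) ⟩
    (fst ⊗₁ snd) ∘ copy
      ≈⟨ fst⊗snd-copy ⟩
    id ∎

  wire-either : ∀ {A} B C {f : vars B ⊆ₗ vars A} {g : vars C ⊆ₗ vars A} →
                (wire B f ⊗₁ wire C g) ∘ copy ≈ wire {Q} {A} (B ⊗ C) (either f g)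
  wire-either B C {f} {g} = ∘-congʳ (⊗-resp-≈
    (wire-cong B λ p → ≡.sym (either-++⁺ˡ f g p))
    (wire-cong C λ p → ≡.sym (either-++⁺ʳ f g p)))

  ⊗-wiring : ∀ (A B C D : Tensor Type) → vars C ⊆ₗ vars A → vars D ⊆ₗ vars B → vars (C ⊗ D) ⊆ₗ vars (A ⊗ B)
  ⊗-wiring A B C D f g = either {xs = vars C} {vars D} {vars A ++ vars B}
    (λ p → ∈-++⁺ˡ (f p)) (λ p → ∈-++⁺ʳ (vars A) (g p))

  wire-⊗ : ∀ {A B} C D {f : vars C ⊆ₗ vars A} {g : vars D ⊆ₗ vars B} →
           wire {Q} {A} C f ⊗₁ wire {Q} {B} D g
             ≈ wire (C ⊗ D) (⊗-wiring A B C D f g)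
  wire-⊗ {A} {B} C D {f} {g} = begin
    wire C f ⊗₁ wire D g
      ≈⟨ ⊗-as-copy ⟩
    ((wire C f ∘ fst) ⊗₁ (wire D g ∘ snd)) ∘ copy
      ≈⟨ ∘-congʳ (⊗-resp-≈ (wire-++⁺ˡ B C) (wire-++⁺ʳ A D)) ⟨
    (wire C (λ p → ∈-++⁺ˡ (f p)) ⊗₁ wire D (λ p → ∈-++⁺ʳ (vars A) (g p))) ∘ copy
      ≈⟨ wire-either C D ⟩
    wire (C ⊗ D) (⊗-wiring A B C D f g) ∎

  wire-⊗-unique : ∀ {A B} C D (f : vars C ⊆ₗ vars A) (g : vars D ⊆ₗ vars B)
                  (h : vars (C ⊗ D) ⊆ₗ vars (A ⊗ B)) → Unique (vars (A ⊗ B)) →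
                  wire {Q} {A} C f ⊗₁ wire {Q} {B} D g ≈ wire (C ⊗ D) h
  wire-⊗-unique {A} {B} C D f g h u =
    E.trans (wire-⊗ C D {f} {g}) (wire-unique {A ⊗ B} (C ⊗ D) {⊗-wiring A B C D f g} {h} u)

  wire-inverse : ∀ {A B} {f : vars B ⊆ₗ vars A} {g : vars A ⊆ₗ vars B} → Unique (vars A) →
                 wire {Q} {B} A g ∘ wire {Q} {A} B f ≈ id
  wire-inverse {A} u = E.trans (wire-∘ A) (E.trans (wire-unique A u) (wire-id A))

  permute-++⁺ : ∀ {A B C D} (s : vars B ↭ vars A) (t : vars D ↭ vars C) →
                permute {Q} {A ⊗ C} {B ⊗ D} (++⁺ s t) ≈ permute s ⊗₁ permute t
  permute-++⁺ {A} {B} {C} {D} s t = E.sym (E.trans (wire-⊗ B D {∈-resp-↭ s} {∈-resp-↭ t}) (wire-cong (B ⊗ D)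
    (either-unique _ _ (∈-resp-↭ (++⁺ s t))
      (λ p → ≡.sym (≡.trans (cong (∈-resp-↭ (++⁺ˡ (vars A) t)) (∈-resp-++⁺ʳ-ˡ s p))
                            (∈-resp-++⁺ˡ-ˡ (vars A) t _)))
      (λ p → ≡.sym (≡.trans (cong (∈-resp-↭ (++⁺ˡ (vars A) t)) (∈-resp-++⁺ʳ-ʳ s p))
                            (∈-resp-++⁺ˡ-ʳ (vars A) t p))))))

-- `rewire` interprets a wiring over a private signature; the signature does not matter.
module _ (𝒞 : MarkovCategory o ℓ e) where
  private
    module C = MarkovCategory 𝒞

    signature : (T : Set) {K : Set} → (K → Tensor T) → (K → Tensor T) → Signature
    signature T d c = record { Type = T ; Query = _ ; dom = d ; cod = c }

  module _ {T : Set} {K K′ : Set} {d c : K → Tensor T} {d′ c′ : K′ → Tensor T}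
           (ob : T → C.Obj)
           {hom : ∀ q → ⟦_⟧₀ 𝒞 (d q) ob C.⇒ ⟦_⟧₀ 𝒞 (c q) ob}
           {hom′ : ∀ q → ⟦_⟧₀ 𝒞 (d′ q) ob C.⇒ ⟦_⟧₀ 𝒞 (c′ q) ob} where
    private
      module E  = Extension 𝒞 (signature T d c) ob hom
      module E′ = Extension 𝒞 (signature T d′ c′) ob hom′

    project-signature : ∀ A {x} (p : x ∈ₗ vars A) → E.⟦ project A p ⟧₁ ≡ E′.⟦ project A p ⟧₁
    project-signature (var y) (here ≡.refl) = ≡.refl
    project-signature (A ⊗ B) p with ∈-++⁻ (vars A) p
    ... | inj₁ q = cong (λ g → C.ru C.∘ (g C.⊗₁ C.!)) (project-signature A q)
    ... | inj₂ q = cong (λ g → C.lu C.∘ (C.! C.⊗₁ g)) (project-signature B q)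

    wire-signature : ∀ A B (f : vars B ⊆ₗ vars A) →
                     E.⟦ wire {A = A} B f ⟧₁ ≡ E′.⟦ wire {A = A} B f ⟧₁
    wire-signature A unit    f = ≡.refl
    wire-signature A (var x) f = project-signature A (f (here ≡.refl))
    wire-signature A (B ⊗ D) f = ≡.cong₂ (λ g h → (g C.⊗₁ h) C.∘ C.copy)
      (wire-signature A B _) (wire-signature A D _)

  ⟦wire⟧ : ∀ Q (ob : Signature.Type Q → C.Obj) hom A B (f : vars B ⊆ₗ vars A) →
           Extension.⟦_⟧₁ 𝒞 Q ob hom (wire {Q} {A} B f) ≡ rewire 𝒞 ob A B f
  ⟦wire⟧ Q ob hom A B f = wire-signature ob A B f

-- Marginalisation

vars-⨂ : ∀ {T : Set} (xs : List T) → vars (⨂ xs) ≡ xs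
vars-⨂ []       = ≡.refl
vars-⨂ (x ∷ xs) = cong (x ∷_) (vars-⨂ xs)

elems-unique : ∀ {n} (S : Subset n) → Unique (elems S)
elems-unique {n} S = unique-filter⁺ (_∈? S) (allFin⁺ n)

⨂ˢ-unique : ∀ {n} (S : Subset n) → Unique (vars (⨂ˢ S))
⨂ˢ-unique S = subst Unique (≡.sym (vars-⨂ (elems S))) (elems-unique S)

module Marginal {n} (G : OpenDAG n) where
  open OpenDAG G

  ∈-wires⁻ : ∀ O xs {y} → y ∈ₗ vars (wires O xs) → y ∈ ins ⊎ y ∈ₗ xs
  ∈-wires⁻ O []       p = inj₁ (∈-⨂ˢ⁻ p)
  ∈-wires⁻ O (x ∷ xs) p with used? O x
  ∈-wires⁻ O (x ∷ xs) (here q)  | yes _ = inj₂ (here q)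
  ∈-wires⁻ O (x ∷ xs) (there p) | yes _ = map₂ there (∈-wires⁻ O xs p)
  ∈-wires⁻ O (x ∷ xs) p         | no _  = map₂ there (∈-wires⁻ O xs p)

  -- Mechanisms produce only non-inputs, and a topological list does not repeat a vertex, so a new
  -- wire is always fresh.
  wires-unique : ∀ O {xs} → Topological xs → Unique (vars (wires O xs))
  wires-unique O [] = ⨂ˢ-unique ins
  wires-unique O (add x {xs} x∉xs _ t) with used? O x
  ... | no _ = wires-unique O t
  ... | yes (x∉ins , _) = All.tabulate fresh AllPairs.∷ wires-unique O t
    where
    fresh : ∀ {y} → y ∈ₗ vars (wires O xs) → x ≢ y
    fresh p ≡.refl = [ x∉ins , x∉xs ]′ (∈-wires⁻ O xs p)

  module _ {O O′ : Subset n} (O⊆O′ : O ⊆ O′) where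
    open MarkovCategory (Free mechanisms)
    open Markov (Free mechanisms)
    open Wiring {mechanisms}
    open HomReasoning
    private
      module E = Equiv

    PathTo-mono : ∀ {x} → PathTo O x → PathTo O′ x
    PathTo-mono (y , y∈O , path) = y , O⊆O′ y∈O , path

    wires-mono : ∀ xs → vars (wires O xs) ⊆ₗ vars (wires O′ xs)
    wires-mono []       p = p
    wires-mono (x ∷ xs) p with used? O x | used? O′ x
    wires-mono (x ∷ xs) (here q)  | yes _ | yes _ = here q
    wires-mono (x ∷ xs) (there p) | yes _ | yes _ = there (wires-mono xs p)
    wires-mono (x ∷ xs) p | yes (x∉ , path) | no ¬u = contradiction (x∉ , PathTo-mono path) ¬u
    wires-mono (x ∷ xs) p | no _ | yes _ = there (wires-mono xs p)
    wires-mono (x ∷ xs) p | no _ | no _  = wires-mono xs p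

    -- Both networks run through the same topological order, and a mechanism relevant to `O` is
    -- relevant to `O′`, so they can be compared vertex by vertex. The wiring `f` is arbitrary,
    -- which lets the induction ignore how positions were computed.
    build-mono : ∀ {xs} (t : Topological xs) (f : vars (wires O xs) ⊆ₗ vars (wires O′ xs)) →
                 wire (wires O xs) f ∘ build O′ t ≈ build O t
    build-mono [] f = E.trans identityʳ
      (E.trans (wire-unique (⨂ˢ ins) (⨂ˢ-unique ins)) (wire-id (⨂ˢ ins)))
    -- `wires-unique` joins the `with` so that its type reduces together with `wires O′ (x ∷ xs)`.
    build-mono (add x {xs} x∉xs pa⊆xs t) f with used? O x | used? O′ x | wires-unique O′ (add x x∉xs pa⊆xs t)
    ... | yes (x∉ , path) | no ¬u | _ = contradiction (x∉ , PathTo-mono path) ¬u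
    ... | no _ | no _ | _ = build-mono t f
    -- A mechanism needed for O′ but not for O is discarded together with its output.
    ... | no _ | yes _ | u = begin
      wire W f ∘ ((_ ⊗₁ id) ∘ (copy ∘ b′))
        ≈⟨ ∘-congʳ (E.trans (wire-unique W u) (wire-++⁺ʳ (var x) W)) ⟩
      (wire W (wires-mono xs) ∘ snd) ∘ ((_ ⊗₁ id) ∘ (copy ∘ b′))
        ≈⟨ E.trans assoc (∘-congˡ (E.trans (square snd-⊗) identityˡ)) ⟩
      wire W (wires-mono xs) ∘ (snd ∘ (copy ∘ b′))
        ≈⟨ ∘-congˡ (cancelˡ snd-copy) ⟩
      wire W (wires-mono xs) ∘ b′
        ≈⟨ build-mono t (wires-mono xs) ⟩
      build O t ∎
      where
      W = wires O xs
      b′ = build O′ t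
    -- A mechanism needed for both. Its parents have paths to `O`, so the wiring to them factors
    -- through `w`; being deterministic, `w` then moves past the copy.
    ... | yes _ | yes _ | u@(_ AllPairs.∷ u′) = begin
      wire (var x ⊗ W) f ∘ (((m ∘ wire P _) ⊗₁ id) ∘ (copy ∘ b′))
        ≈⟨ ∘-congʳ (E.sym (wire-⊗-unique {var x} (var x) W (λ p → p) (wires-mono xs) f u)) ⟩
      (id ⊗₁ w) ∘ (((m ∘ wire P _) ⊗₁ id) ∘ (copy ∘ b′))
        ≈⟨ pullˡ (E.trans (E.sym ⊗-∘) (⊗-resp-≈ identityˡ (E.trans identityʳ (E.sym identityˡ)))) ⟩
      ((m ∘ wire P _) ⊗₁ (id ∘ w)) ∘ (copy ∘ b′)
        ≈⟨ ∘-congʳ (⊗-congʳ (E.trans (∘-congˡ (E.trans (wire-unique P u′) (E.sym (wire-∘ P)))) (E.sym assoc))) ⟩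
      (((m ∘ wire P _) ∘ w) ⊗₁ (id ∘ w)) ∘ (copy ∘ b′)
        ≈⟨ E.trans (∘-congʳ ⊗-∘) assoc ⟩
      ((m ∘ wire P _) ⊗₁ id) ∘ ((w ⊗₁ w) ∘ (copy ∘ b′))
        ≈⟨ ∘-congˡ (square (E.sym (wire-det W (wires-mono xs)))) ⟩
      ((m ∘ wire P _) ⊗₁ id) ∘ (copy ∘ (w ∘ b′))
        ≈⟨ ∘-congˡ (∘-congˡ (build-mono t (wires-mono xs))) ⟩
      ((m ∘ wire P _) ⊗₁ id) ∘ (copy ∘ build O t) ∎
      where
      W = wires O xs
      b′ = build O′ t
      P = ⨂ˢ (pa x)
      m = gen (mechanism x _)
      w : wires O′ xs ⇒ W
      w = wire W (wires-mono xs)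

    network-mono : (f : vars (⨂ˢ O) ⊆ₗ vars (⨂ˢ O′)) → wire (⨂ˢ O) f ∘ network O′ ≈ network O
    network-mono f = let xs , t , _ = order in begin
      wire (⨂ˢ O) f ∘ (wire (⨂ˢ O′) _ ∘ build O′ t)  ≈⟨ pullˡ (wire-∘ (⨂ˢ O)) ⟩
      wire (⨂ˢ O) _ ∘ build O′ t                       ≈⟨ ∘-congʳ (wire-unique (⨂ˢ O) (wires-unique O′ t)) ⟩
      wire (⨂ˢ O) _ ∘ build O′ t                       ≈⟨ ∘-congʳ (wire-∘ (⨂ˢ O) {wires-mono xs}) ⟨
      (wire (⨂ˢ O) _ ∘ wire (wires O xs) (wires-mono xs)) ∘ build O′ t ≈⟨ E.trans assoc (∘-congˡ (build-mono t _)) ⟩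
      wire (⨂ˢ O) _ ∘ build O t                        ∎

module _ {𝒞 : MarkovCategory o ℓ e} {n} {G : OpenDAG n} where
  open MarkovCategory 𝒞
  open Markov 𝒞
  private
    module E = Equiv

  channel-mono : (M : CausalModel 𝒞 G) {O O′ : Subset n} → O ⊆ O′ →
                 (f : vars (⨂ˢ O) ⊆ₗ vars (⨂ˢ O′)) →
                 rewire 𝒞 (CausalModel.ob M) (⨂ˢ O′) (⨂ˢ O) f ∘ channel M O′ ≈ channel M O
  channel-mono M {O} {O′} O⊆O′ f = E.trans
    (∘-congʳ (E.reflexive (≡.sym (⟦wire⟧ 𝒞 (OpenDAG.mechanisms G) (CausalModel.ob M) _ (⨂ˢ O′) (⨂ˢ O) f))))
    (Extension.⟦⟧-resp-≈ 𝒞 (OpenDAG.mechanisms G) (CausalModel.ob M) _ (Marginal.network-mono G O⊆O′ f))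

module _ {𝒞 : MarkovCategory o ℓ e} {n} {G : OpenDAG n} where
  open MarkovCategory 𝒞
  open Markov 𝒞

  -- Neither the intervened set nor the channels to the `Ss` depend on the output, so only the outer
  -- channel is marginalised.
  interchange-mono : (M : CausalModel 𝒞 G) {O O′ : Subset n} → O ⊆ O′ →
                     (f : vars (⨂ˢ O) ⊆ₗ vars (⨂ˢ O′)) →
                     ∀ {k} (Ss : Vec (Subset n) k) →
                     rewire 𝒞 (CausalModel.ob M) (⨂ˢ O′) (⨂ˢ O) f ∘ interchange M Ss O′ ≈ interchange M Ss O
  interchange-mono M O⊆O′ f Ss = pullˡ (channel-mono (DoM M (⋃ˢ M Ss)) O⊆O′ f)

-- Transformations between functors on free categories

module _ {Q : Signature} {𝒟 : MarkovCategory o ℓ e} (F : Functor (Free Q) 𝒟) where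
  open MarkovCategory 𝒟
  open Markov 𝒟
  open Functor F
  open HomReasoning
  private
    module E = Equiv

  split : ∀ A → F₀ A ⇒ ⟦_⟧₀ 𝒟 A (onVar F)
  split unit    = η⁻¹
  split (var X) = id
  split (A ⊗ B) = (split A ⊗₁ split B) ∘ μ⁻¹

  merge-split : ∀ A → merge F A ∘ split A ≈ id
  merge-split unit    = η-isoʳ
  merge-split (var X) = identityˡ
  merge-split (A ⊗ B) = begin
    (μ ∘ (merge F A ⊗₁ merge F B)) ∘ ((split A ⊗₁ split B) ∘ μ⁻¹)
      ≈⟨ E.trans assoc (∘-congˡ (cancelˡ (⊗-inverse (merge-split A) (merge-split B)))) ⟩
    μ ∘ μ⁻¹
      ≈⟨ μ-isoʳ ⟩
    id ∎

  split-merge : ∀ A → split A ∘ merge F A ≈ id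
  split-merge unit    = η-isoˡ
  split-merge (var X) = identityˡ
  split-merge (A ⊗ B) = begin
    ((split A ⊗₁ split B) ∘ μ⁻¹) ∘ (μ ∘ (merge F A ⊗₁ merge F B))
      ≈⟨ E.trans assoc (∘-congˡ (cancelˡ μ-isoˡ)) ⟩
    (split A ⊗₁ split B) ∘ (merge F A ⊗₁ merge F B)
      ≈⟨ ⊗-inverse (split-merge A) (split-merge B) ⟩
    id ∎

module _ {𝒞 : MarkovCategory o ℓ e} {𝒟 : MarkovCategory o′ ℓ′ e′} (F : Functor 𝒞 𝒟) where
  private
    module C = MarkovCategory 𝒞
  open MarkovCategory 𝒟
  open Functor F

  F-inverse : ∀ {A B} {f : B C.⇒ A} {g : A C.⇒ B} → f C.∘ g C.≈ C.id → F₁ f ∘ F₁ g ≈ id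
  F-inverse p = Equiv.trans (Equiv.sym F-∘) (Equiv.trans (F-resp-≈ p) F-id)

-- Determinism is what naturality at the copy maps amounts to.
record MonoidalFamily {Q : Signature} {𝒟 : MarkovCategory o ℓ e} (F G : Functor (Free Q) 𝒟) : Set (ℓ ⊔ e) where
  open MarkovCategory 𝒟
  open Markov 𝒟
  open HomReasoning
  private
    module E = Equiv
    module F = Functor F
    module G = Functor G
    module Q = MarkovCategory (Free Q)

  field
    at : ∀ A → F.F₀ A ⇒ G.F₀ A
    at-⊗ : ∀ A B → at (A ⊗ B) ∘ F.μ ≈ G.μ ∘ (at A ⊗₁ at B)
    at-unit : at unit ∘ F.η ≈ G.η
    at-var-det : ∀ X → Deterministic (at (var X))

  Natural : ∀ {A B} → Term Q A B → Set e
  Natural {A} {B} f = at B ∘ F.F₁ f ≈ G.F₁ f ∘ at A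

  -- Monoidality expresses the component at a tensor through its factors and the structure
  -- isomorphisms, which are deterministic together with their inverses.
  at-det : ∀ A → Deterministic (at A)
  at-det unit = det-resp-≈ (section⇒epic F.η-isoʳ _ _ (begin
      (G.η ∘ F.η⁻¹) ∘ F.η ≈⟨ E.trans assoc (E.trans (∘-congˡ F.η-isoˡ) identityʳ) ⟩
      G.η                 ≈⟨ at-unit ⟨
      at unit ∘ F.η       ∎))
    (∘-det G.η-det (inverse-det F.η-isoʳ F.η-isoˡ F.η-det))
  at-det (var X) = at-var-det X
  at-det (A ⊗ B) = det-resp-≈ (section⇒epic F.μ-isoʳ _ _ (begin
      (G.μ ∘ ((at A ⊗₁ at B) ∘ F.μ⁻¹)) ∘ F.μ
        ≈⟨ E.trans assoc (∘-congˡ (E.trans assoc (E.trans (∘-congˡ F.μ-isoˡ) identityʳ))) ⟩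
      G.μ ∘ (at A ⊗₁ at B)                   ≈⟨ at-⊗ A B ⟨
      at (A ⊗ B) ∘ F.μ                       ∎))
    (∘-det G.μ-det (∘-det (⊗-det (at-det A) (at-det B)) (inverse-det F.μ-isoʳ F.μ-isoˡ F.μ-det)))

  natural-resp-≈ : ∀ {A B} {f g : Term Q A B} → f Q.≈ g → Natural f → Natural g
  natural-resp-≈ p n = E.trans (∘-congˡ (E.sym (F.F-resp-≈ p))) (E.trans n (∘-congʳ (G.F-resp-≈ p)))

  natural-id : ∀ {A} → Natural (idᵗ {A = A})
  natural-id = E.trans (∘-congˡ F.F-id) (E.trans identityʳ (E.sym (E.trans (∘-congʳ G.F-id) identityˡ)))

  natural-∘ : ∀ {A B C} {f : Term Q B C} {g : Term Q A B} → Natural f → Natural g → Natural (f ∘ᵗ g)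
  natural-∘ {A} {B} {C} {f} {g} p q = begin
    at C ∘ F.F₁ (f ∘ᵗ g)        ≈⟨ ∘-congˡ F.F-∘ ⟩
    at C ∘ (F.F₁ f ∘ F.F₁ g)    ≈⟨ square p ⟩
    G.F₁ f ∘ (at B ∘ F.F₁ g)    ≈⟨ ∘-congˡ q ⟩
    G.F₁ f ∘ (G.F₁ g ∘ at A)    ≈⟨ pullˡ (E.sym G.F-∘) ⟩
    G.F₁ (f ∘ᵗ g) ∘ at A        ∎

  natural-⊗ : ∀ {A B C D} {f : Term Q A B} {g : Term Q C D} →
              Natural f → Natural g → Natural (f ⊗ᵗ g)
  natural-⊗ {A} {B} {C} {D} {f} {g} p q = section⇒epic F.μ-isoʳ _ _ (begin
    (at (B ⊗ D) ∘ F.F₁ (f ⊗ᵗ g)) ∘ F.μ          ≈⟨ E.trans assoc (∘-congˡ (E.sym F.μ-natural)) ⟩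
    at (B ⊗ D) ∘ (F.μ ∘ (F.F₁ f ⊗₁ F.F₁ g))     ≈⟨ square (at-⊗ B D) ⟩
    G.μ ∘ ((at B ⊗₁ at D) ∘ (F.F₁ f ⊗₁ F.F₁ g)) ≈⟨ ∘-congˡ (E.trans (E.sym ⊗-∘) (E.trans (⊗-resp-≈ p q) ⊗-∘)) ⟩
    G.μ ∘ ((G.F₁ f ⊗₁ G.F₁ g) ∘ (at A ⊗₁ at C)) ≈⟨ square G.μ-natural ⟩
    G.F₁ (f ⊗ᵗ g) ∘ (G.μ ∘ (at A ⊗₁ at C))      ≈⟨ ∘-congˡ (at-⊗ A C) ⟨
    G.F₁ (f ⊗ᵗ g) ∘ (at (A ⊗ C) ∘ F.μ)          ≈⟨ assoc ⟨
    (G.F₁ (f ⊗ᵗ g) ∘ at (A ⊗ C)) ∘ F.μ          ∎)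

  natural-inverse : ∀ {A B} {f : Term Q A B} {g : Term Q B A} →
                    f Q.∘ g Q.≈ idᵗ → g Q.∘ f Q.≈ idᵗ → Natural f → Natural g
  natural-inverse {A} {B} {f} {g} p q n = begin
    at A ∘ F.F₁ g                          ≈⟨ cancelˡ (F-inverse G q) ⟨
    G.F₁ g ∘ (G.F₁ f ∘ (at A ∘ F.F₁ g))    ≈⟨ ∘-congˡ (square n) ⟨
    G.F₁ g ∘ (at B ∘ (F.F₁ f ∘ F.F₁ g))    ≈⟨ ∘-congˡ (E.trans (∘-congˡ (F-inverse F p)) identityʳ) ⟩
    G.F₁ g ∘ at B                          ∎

  -- `G.F₀ unit` is isomorphic to `I` by `G.η`, hence terminal.
  natural-! : ∀ {A} → Natural (!ᵗ {A = A})
  natural-! = retraction⇒monic G.η-isoʳ !-unique₂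

  natural-copy : ∀ {A} → Natural (copyᵗ {A = A})
  natural-copy {A} = begin
    at (A ⊗ A) ∘ F.F₁ copyᵗ         ≈⟨ ∘-congˡ F.F-copy ⟩
    at (A ⊗ A) ∘ (F.μ ∘ copy)       ≈⟨ square (at-⊗ A A) ⟩
    G.μ ∘ ((at A ⊗₁ at A) ∘ copy)   ≈⟨ ∘-congˡ (at-det A) ⟨
    G.μ ∘ (copy ∘ at A)             ≈⟨ pullˡ (E.sym G.F-copy) ⟩
    G.F₁ copyᵗ ∘ at A               ∎

  natural-σ : ∀ {A B} → Natural (σᵗ {A = A} {B})
  natural-σ {A} {B} = section⇒epic F.μ-isoʳ _ _ (begin
    (at (B ⊗ A) ∘ F.F₁ σᵗ) ∘ F.μ     ≈⟨ E.trans assoc (∘-congˡ F.μ-symm) ⟩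
    at (B ⊗ A) ∘ (F.μ ∘ σ)           ≈⟨ square (at-⊗ B A) ⟩
    G.μ ∘ ((at B ⊗₁ at A) ∘ σ)       ≈⟨ ∘-congˡ σ-natural ⟨
    G.μ ∘ (σ ∘ (at A ⊗₁ at B))       ≈⟨ square (E.sym G.μ-symm) ⟩
    G.F₁ σᵗ ∘ (G.μ ∘ (at A ⊗₁ at B)) ≈⟨ ∘-congˡ (at-⊗ A B) ⟨
    G.F₁ σᵗ ∘ (at (A ⊗ B) ∘ F.μ)     ≈⟨ assoc ⟨
    (G.F₁ σᵗ ∘ at (A ⊗ B)) ∘ F.μ     ∎)

  natural-lu : ∀ {A} → Natural (luᵗ {A = A})
  natural-lu {A} = section⇒epic
    (E.trans (E.trans assoc (∘-congˡ (cancelˡ (⊗-inverse F.η-isoʳ identityˡ)))) F.μ-isoʳ) _ _ (begin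
    (at A ∘ F.F₁ luᵗ) ∘ (F.μ ∘ (F.η ⊗₁ id))            ≈⟨ E.trans assoc (∘-congˡ F.μ-unitˡ) ⟩
    at A ∘ lu                                          ≈⟨ lu-natural ⟨
    lu ∘ (id ⊗₁ at A)                                  ≈⟨ ∘-congʳ G.μ-unitˡ ⟨
    (G.F₁ luᵗ ∘ (G.μ ∘ (G.η ⊗₁ id))) ∘ (id ⊗₁ at A)    ≈⟨ E.trans assoc (∘-congˡ assoc) ⟩
    G.F₁ luᵗ ∘ (G.μ ∘ ((G.η ⊗₁ id) ∘ (id ⊗₁ at A)))    ≈⟨ ∘-congˡ (∘-congˡ ⊗-splitˡ) ⟨
    G.F₁ luᵗ ∘ (G.μ ∘ (G.η ⊗₁ at A))
      ≈⟨ ∘-congˡ (∘-congˡ (E.trans (E.sym ⊗-∘) (⊗-resp-≈ at-unit identityʳ))) ⟨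
    G.F₁ luᵗ ∘ (G.μ ∘ ((at unit ⊗₁ at A) ∘ (F.η ⊗₁ id))) ≈⟨ ∘-congˡ (square (at-⊗ unit A)) ⟨
    G.F₁ luᵗ ∘ (at (unit ⊗ A) ∘ (F.μ ∘ (F.η ⊗₁ id)))   ≈⟨ assoc ⟨
    (G.F₁ luᵗ ∘ at (unit ⊗ A)) ∘ (F.μ ∘ (F.η ⊗₁ id))   ∎)

  natural-ru : ∀ {A} → Natural (ruᵗ {A = A})
  natural-ru {A} = natural-resp-≈ (Markov.lu-σ (Free Q)) (natural-∘ natural-lu natural-σ)

  natural-α : ∀ {A B C} → Natural (αᵗ {A = A} {B} {C})
  natural-α {A} {B} {C} = section⇒epic
    (E.trans (E.trans assoc (∘-congˡ (cancelˡ (⊗-inverse F.μ-isoʳ identityˡ)))) F.μ-isoʳ) _ _ (begin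
    (at (A ⊗ (B ⊗ C)) ∘ F.F₁ αᵗ) ∘ (F.μ ∘ (F.μ ⊗₁ id))    ≈⟨ E.trans assoc (∘-congˡ F.μ-assoc) ⟩
    at (A ⊗ (B ⊗ C)) ∘ (F.μ ∘ ((id ⊗₁ F.μ) ∘ α))          ≈⟨ square (at-⊗ A (B ⊗ C)) ⟩
    G.μ ∘ ((at A ⊗₁ at (B ⊗ C)) ∘ ((id ⊗₁ F.μ) ∘ α))      ≈⟨ ∘-congˡ (square inner) ⟩
    G.μ ∘ ((id ⊗₁ G.μ) ∘ ((at A ⊗₁ (at B ⊗₁ at C)) ∘ α))  ≈⟨ ∘-congˡ (∘-congˡ α-natural) ⟨
    G.μ ∘ ((id ⊗₁ G.μ) ∘ (α ∘ ((at A ⊗₁ at B) ⊗₁ at C)))  ≈⟨ ∘-congˡ assoc ⟨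
    G.μ ∘ (((id ⊗₁ G.μ) ∘ α) ∘ ((at A ⊗₁ at B) ⊗₁ at C))  ≈⟨ square (E.sym G.μ-assoc) ⟩
    G.F₁ αᵗ ∘ ((G.μ ∘ (G.μ ⊗₁ id)) ∘ ((at A ⊗₁ at B) ⊗₁ at C)) ≈⟨ ∘-congˡ (E.trans assoc (∘-congˡ outer)) ⟩
    G.F₁ αᵗ ∘ (G.μ ∘ ((at (A ⊗ B) ⊗₁ at C) ∘ (F.μ ⊗₁ id))) ≈⟨ ∘-congˡ (square (at-⊗ (A ⊗ B) C)) ⟨
    G.F₁ αᵗ ∘ (at ((A ⊗ B) ⊗ C) ∘ (F.μ ∘ (F.μ ⊗₁ id)))     ≈⟨ assoc ⟨
    (G.F₁ αᵗ ∘ at ((A ⊗ B) ⊗ C)) ∘ (F.μ ∘ (F.μ ⊗₁ id))     ∎)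
    where
    inner : (at A ⊗₁ at (B ⊗ C)) ∘ (id ⊗₁ F.μ) ≈ (id ⊗₁ G.μ) ∘ (at A ⊗₁ (at B ⊗₁ at C))
    inner = E.trans (E.sym ⊗-∘)
      (E.trans (⊗-resp-≈ (E.trans identityʳ (E.sym identityˡ)) (at-⊗ B C)) ⊗-∘)

    outer : (G.μ ⊗₁ id) ∘ ((at A ⊗₁ at B) ⊗₁ at C) ≈ (at (A ⊗ B) ⊗₁ at C) ∘ (F.μ ⊗₁ id)
    outer = E.trans (E.sym ⊗-∘)
      (E.trans (⊗-resp-≈ (E.sym (at-⊗ A B)) (E.trans identityˡ (E.sym identityʳ))) ⊗-∘)

  natural-project : ∀ A {x} (p : x ∈ₗ vars A) → Natural (project A p)
  natural-project (var x) (here ≡.refl) = natural-id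
  natural-project (A ⊗ B) p with ∈-++⁻ (vars A) p
  ... | inj₁ q = natural-∘ natural-ru (natural-⊗ (natural-project A q) natural-!)
  ... | inj₂ q = natural-∘ natural-lu (natural-⊗ natural-! (natural-project B q))

  -- Independent of `natural-gen`: the proof of naturality at the queries of an interchange
  -- abstraction itself uses naturality at the discarding wirings.
  natural-wire : ∀ {A} B (f : vars B ⊆ₗ vars A) → Natural (wire {A = A} B f)
  natural-wire unit    f = natural-!
  natural-wire {A} (var x) f = natural-project A _
  natural-wire (B ⊗ D) f = natural-∘ (natural-⊗ (natural-wire B _) (natural-wire D _)) natural-copy

  module _ (natural-gen : ∀ q → Natural (gen q)) where

    natural : ∀ {A B} (f : Term Q A B) → Natural f
    natural (gen q)  = natural-gen q
    natural idᵗ      = natural-id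
    natural (f ∘ᵗ g) = natural-∘ (natural f) (natural g)
    natural (f ⊗ᵗ g) = natural-⊗ (natural f) (natural g)
    natural αᵗ       = natural-α
    natural α⁻¹ᵗ     = natural-inverse Q.α-isoʳ Q.α-isoˡ natural-α
    natural luᵗ      = natural-lu
    natural lu⁻¹ᵗ    = natural-inverse Q.lu-isoʳ Q.lu-isoˡ natural-lu
    natural ruᵗ      = natural-ru
    natural ru⁻¹ᵗ    = natural-inverse Q.ru-isoʳ Q.ru-isoˡ natural-ru
    natural σᵗ       = natural-σ
    natural !ᵗ       = natural-!
    natural copyᵗ    = natural-copy

    transformation : Transformation F G
    transformation = record
      { at = at ; natural = natural ; at-⊗ = at-⊗ _ _ ; at-unit = at-unit ; at-det = at-det }

-- Lists without repetitions, and substitution of lists for variables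

module _ {T : Set} where

  unique-++⁻ : ∀ (xs : List T) {ys} → Unique (xs ++ ys) →
               Unique xs × Unique ys × (∀ {x} → x ∈ₗ xs → x ∉ₗ ys)
  unique-++⁻ []       u = AllPairs.[] , u , λ ()
  unique-++⁻ (x ∷ xs) (x∉ AllPairs.∷ u) =
    let xs! , ys! , disjoint = unique-++⁻ xs u
        x∉xs , x∉ys = All-++⁻ xs x∉
    in x∉xs AllPairs.∷ xs! , ys! ,
       λ { (here ≡.refl) q → All.lookup x∉ys q ≡.refl ; (there p) q → disjoint p q }

  unique⇒↭ : ∀ {xs ys : List T} → Unique xs → Unique ys → xs ⊆ₗ ys → ys ⊆ₗ xs → xs ↭ ys
  unique⇒↭ xs! ys! xs⊆ys ys⊆xs = ∼bag⇒↭ (unique∧set⇒bag xs! ys! (mk⇔ xs⊆ys ys⊆xs))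

  unique-resp-↭ : ∀ {xs ys : List T} → xs ↭ ys → Unique xs → Unique ys
  unique-resp-↭ s = SetoidPermutation.Unique-resp-↭ (≡.setoid T) (↭⇒↭ₛ s)

module _ {S T : Set} where

  ∈-substitute⁺ : ∀ (g : S → Tensor T) A {x y} → x ∈ₗ vars A → y ∈ₗ vars (g x) → y ∈ₗ vars (substitute g A)
  ∈-substitute⁺ g (var x) (here ≡.refl) q = q
  ∈-substitute⁺ g (A ⊗ B) p q with ∈-++⁻ (vars A) p
  ... | inj₁ r = ∈-++⁺ˡ (∈-substitute⁺ g A r q)
  ... | inj₂ r = ∈-++⁺ʳ (vars (substitute g A)) (∈-substitute⁺ g B r q)

  record Separated (g : S → Tensor T) : Set where
    field
      unique   : ∀ X → Unique (vars (g X))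
      disjoint : ∀ {X Y} → X ≢ Y → ∀ {x} → x ∈ₗ vars (g X) → x ∉ₗ vars (g Y)

  substitute-unique : ∀ {g : S → Tensor T} → Separated g → ∀ A → Unique (vars A) →
                      Unique (vars (substitute g A))
  substitute-unique s unit    u = AllPairs.[]
  substitute-unique s (var X) u = Separated.unique s X
  substitute-unique {g} s (A ⊗ B) u =
    let A! , B! , A#B = unique-++⁻ (vars A) u
    in unique-++⁺ (substitute-unique s A A!) (substitute-unique s B B!) λ (p , q) →
         let X , X∈A , x∈X = ∈-substitute⁻ g A p
             Y , Y∈B , x∈Y = ∈-substitute⁻ g B q
         in Separated.disjoint s (λ X≡Y → A#B X∈A (subst (_∈ₗ vars B) (≡.sym X≡Y) Y∈B)) x∈X x∈Y

  substitute-unique⁻ : ∀ (g : S → Tensor T) A {X} → Unique (vars (substitute g A)) →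
                       X ∈ₗ vars A → Unique (vars (g X))
  substitute-unique⁻ g (var X) u (here ≡.refl) = u
  substitute-unique⁻ g (A ⊗ B) u p with unique-++⁻ (vars (substitute g A)) u | ∈-++⁻ (vars A) p
  ... | A! , _ , _ | inj₁ q = substitute-unique⁻ g A A! q
  ... | _ , B! , _ | inj₂ q = substitute-unique⁻ g B B! q

  substitute-disjoint⁻ : ∀ (g : S → Tensor T) A {X Y} → Unique (vars (substitute g A)) →
                         X ∈ₗ vars A → Y ∈ₗ vars A → X ≢ Y →
                         ∀ {x} → x ∈ₗ vars (g X) → x ∉ₗ vars (g Y)
  substitute-disjoint⁻ g (var X) u (here ≡.refl) (here ≡.refl) X≢Y = contradiction ≡.refl X≢Y
  substitute-disjoint⁻ g (A ⊗ B) u p q X≢Y x∈X x∈Y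
    with unique-++⁻ (vars (substitute g A)) u | ∈-++⁻ (vars A) p | ∈-++⁻ (vars A) q
  ... | A! , _ , _  | inj₁ p′ | inj₁ q′ = substitute-disjoint⁻ g A A! p′ q′ X≢Y x∈X x∈Y
  ... | _ , B! , _  | inj₂ p′ | inj₂ q′ = substitute-disjoint⁻ g B B! p′ q′ X≢Y x∈X x∈Y
  ... | _ , _ , A#B | inj₁ p′ | inj₂ q′ = A#B (∈-substitute⁺ g A p′ x∈X) (∈-substitute⁺ g B q′ x∈Y)
  ... | _ , _ , A#B | inj₂ p′ | inj₁ q′ = A#B (∈-substitute⁺ g A q′ x∈Y) (∈-substitute⁺ g B p′ x∈X)

∈-⋃-map⁻ : ∀ {n} {T : Set} (f : T → Subset n) {x} (ys : List T) →
           x ∈ ⋃ (map f ys) → ∃[ y ] (y ∈ₗ ys × x ∈ f y)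
∈-⋃-map⁻ f []       p = contradiction p ∉⊥
∈-⋃-map⁻ f (y ∷ ys) p with x∈p∪q⁻ (f y) _ p
... | inj₁ q = y , here ≡.refl , q
... | inj₂ q = let z , z∈ys , x∈fz = ∈-⋃-map⁻ f ys q in z , there z∈ys , x∈fz

∈-support⁻ : ∀ {n} (A : Tensor (Fin n)) {x} → x ∈ support A → x ∈ₗ vars A
∈-support⁻ A p with ∈-⋃-map⁻ ⁅_⁆ (vars A) p
... | y , y∈A , x∈y with ≡.refl ← x∈⁅y⁆⇒x≡y y x∈y = y∈A

module _ {m n} (π : Fin n → Subset m) where

  ∈-image⁺ : ∀ {S X x} → X ∈ S → x ∈ π X → x ∈ image π S
  ∈-image⁺ X∈S x∈X = ∈-⋃-map⁺ π (∈-elems⁺ X∈S) x∈X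

  ∈-image⁻ : ∀ {S x} → x ∈ image π S → ∃[ X ] (X ∈ S × x ∈ π X)
  ∈-image⁻ {S} p = let X , X∈S , x∈X = ∈-⋃-map⁻ π (elems S) p in X , ∈-elems⁻ X∈S , x∈X

  image-mono : ∀ {S T} → S ⊆ T → image π S ⊆ image π T
  image-mono S⊆T p = let X , X∈S , x∈X = ∈-image⁻ p in ∈-image⁺ (S⊆T X∈S) x∈X

  image-⊆-substitute : ∀ (g : Fin n → Tensor (Fin m)) → (∀ X {x} → x ∈ π X → x ∈ₗ vars (g X)) →
                       ∀ S → vars (⨂ˢ (image π S)) ⊆ₗ vars (substitute g (⨂ˢ S))
  image-⊆-substitute g h S p =
    let X , X∈S , x∈X = ∈-image⁻ (∈-⨂ˢ⁻ p) in ∈-substitute⁺ g (⨂ˢ S) (∈-⨂ˢ⁺ X∈S) (h X x∈X)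

  ⨂ˢ-separated : (∀ X Y → X ≢ Y → Disjoint (π X) (π Y)) → Separated (λ X → ⨂ˢ (π X))
  ⨂ˢ-separated d = record
    { unique   = λ X → ⨂ˢ-unique (π X)
    ; disjoint = λ X≢Y p q → d _ _ X≢Y (_ , x∈p∩q⁺ (∈-⨂ˢ⁻ p , ∈-⨂ˢ⁻ q))
    }

image-cong : ∀ {m n} {π π′ : Fin n → Subset m} → (∀ X → π X ≡ π′ X) → ∀ S → image π S ≡ image π′ S
image-cong {π = π} {π′} h S = ⊆-antisym
  (λ p → let X , X∈S , x∈X = ∈-image⁻ π p in ∈-image⁺ π′ X∈S (subst (_ ∈_) (h X) x∈X))
  (λ p → let X , X∈S , x∈X = ∈-image⁻ π′ p in ∈-image⁺ π X∈S (subst (_ ∈_) (≡.sym (h X)) x∈X))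

substitute-mono : ∀ {S T : Set} (g h : S → Tensor T) → (∀ X → vars (h X) ⊆ₗ vars (g X)) →
                  ∀ A → vars (substitute h A) ⊆ₗ vars (substitute g A)
substitute-mono g h f A p =
  let X , X∈A , x∈X = ∈-substitute⁻ h A p in ∈-substitute⁺ g A X∈A (f X x∈X)

module Pointwise {S : Set} {Q : Signature} (g h : S → Tensor (Signature.Type Q))
                 (f : ∀ X → vars (h X) ⊆ₗ vars (g X)) where
  open MarkovCategory (Free Q)
  open Markov (Free Q)
  open Wiring {Q}
  private
    module E = Equiv

  -- Rearranging block by block is compatible with `⊗₁` by definition and makes sense even where
  -- variables repeat, as in `power`. Without repetitions `pointwise-wire` identifies it with a
  -- single wiring.
  pointwise : ∀ A → substitute g A ⇒ substitute h A
  pointwise unit    = id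
  pointwise (var X) = wire (h X) (f X)
  pointwise (A ⊗ B) = pointwise A ⊗₁ pointwise B

  pointwise-wire : ∀ A (k : vars (substitute h A) ⊆ₗ vars (substitute g A)) →
                   Unique (vars (substitute g A)) → pointwise A ≈ wire (substitute h A) k
  pointwise-wire unit    k u = !-unique _
  pointwise-wire (var X) k u = wire-unique (h X) u
  pointwise-wire (A ⊗ B) k u =
    let A! , B! , _ = unique-++⁻ (vars (substitute g A)) u in
    E.trans (⊗-resp-≈ (pointwise-wire A (substitute-mono g h f A) A!)
                      (pointwise-wire B (substitute-mono g h f B) B!))
            (wire-⊗-unique (substitute h A) (substitute h B) _ _ k u)

module Substitution {P Q : Signature} (g : Signature.Type P → Tensor (Signature.Type Q))
  (hom : ∀ q → Term Q (substitute g (Signature.dom P q)) (substitute g (Signature.cod P q))) where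
  open MarkovCategory (Free Q)
  open Markov (Free Q)
  open Wiring {Q}
  open Extension (Free Q) P g hom
  private
    module E = Equiv

  ⟦project⟧-wire : ∀ A {x} (p : x ∈ₗ vars A) →
    Σ[ h ∈ (vars (g x) ⊆ₗ vars (substitute g A)) ] ⟦ project A p ⟧₁ ≈ wire (g x) h
  ⟦project⟧-wire (var x) (here ≡.refl) = (λ p → p) , E.sym (wire-id (g x))
  ⟦project⟧-wire (A ⊗ B) {x} p with ∈-++⁻ (vars A) p
  ... | inj₁ q = let h , r = ⟦project⟧-wire A q in
    (λ p → ∈-++⁺ˡ (h p)) ,
    E.trans ru-fst (E.trans (∘-congʳ r) (E.sym (wire-++⁺ˡ (substitute g B) (g x))))
  ... | inj₂ q = let h , r = ⟦project⟧-wire B q in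
    (λ p → ∈-++⁺ʳ (vars (substitute g A)) (h p)) ,
    E.trans lu-snd (E.trans (∘-congʳ r) (E.sym (wire-++⁺ʳ (substitute g A) (g x))))

  -- The positions in the substituted lists are left existential: in the application the source has
  -- no repetitions, and `wire-unique` makes them immaterial.
  ⟦wire⟧-wire : ∀ {A} B (f : vars B ⊆ₗ vars A) →
    Σ[ h ∈ (vars (substitute g B) ⊆ₗ vars (substitute g A)) ] ⟦ wire {A = A} B f ⟧₁ ≈ wire (substitute g B) h
  ⟦wire⟧-wire unit        f = (λ ()) , E.refl
  ⟦wire⟧-wire {A} (var x) f = ⟦project⟧-wire A _
  ⟦wire⟧-wire {A} (B ⊗ D) f =
    let h , r = ⟦wire⟧-wire B (λ p → f (∈-++⁺ˡ p))
        k , s = ⟦wire⟧-wire D (λ p → f (∈-++⁺ʳ (vars B) p))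
    in either {xs = vars (substitute g B)} h k ,
       E.trans (∘-congʳ (⊗-resp-≈ r s)) (wire-either (substitute g B) (substitute g D) {h} {k})

module _ {Q : Signature} {S : Set} (g : S → Tensor (Signature.Type Q)) where
  open MarkovCategory (Free Q)
  open Markov (Free Q)

  -- The list of all copies may repeat variables, so `wire-inverse` does not apply to it as a whole;
  -- each copy is inverted separately.
  powerᵗ-inverse : ∀ k {A B} {f : A ⇒ substitute g B} {h : substitute g B ⇒ A} → f ∘ h ≈ id → h ∘ f ≈ id →
                   Σ[ h′ ∈ substitute g (power k B) ⇒ power k A ]
                     powerᵗ {Q} g k f ∘ h′ ≈ id × h′ ∘ powerᵗ {Q} g k f ≈ id
  powerᵗ-inverse zero            p q = id , identityˡ , identityˡ
  powerᵗ-inverse (suc k) {h = h} p q =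
    let h′ , p′ , q′ = powerᵗ-inverse k p q in h ⊗₁ h′ , ⊗-inverse p p′ , ⊗-inverse q q′

  ↭-power : ∀ k {A B} → vars (substitute g B) ↭ vars A → vars (substitute g (power k B)) ↭ vars (power k A)
  ↭-power zero    s = ↭.refl
  ↭-power (suc k) s = ++⁺ s (↭-power k s)

  -- Reconciles the two descriptions of a query's inputs: `π-query` wants one permutation of the
  -- entire list, `π-int` one rearrangement applied to every copy of V^in.
  permute-power : ∀ k {A B} (s : vars (substitute g B) ↭ vars A) (f : A ⇒ substitute g B) →
                  permute s ≈ f → permute (↭-power k {A} {B} s) ≈ powerᵗ {Q} g k f
  permute-power zero    s f p = Equiv.sym (!-unique _)
  permute-power (suc k) {A} {B} s f p = Equiv.trans
    (Wiring.permute-++⁺ {Q} {A} {substitute g B} {power k A} {substitute g (power k B)} s (↭-power k s))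
    (⊗-resp-≈ p (permute-power k s f p))

-- From downward abstractions to interchange abstractions

module _ {S : Set} {Q : Signature} (g h : S → Tensor (Signature.Type Q))
         (f : ∀ X → vars (h X) ⊆ₗ vars (g X)) (f′ : ∀ X → vars (g X) ⊆ₗ vars (h X)) where
  open MarkovCategory (Free Q)
  open Markov (Free Q)
  open Pointwise {S} {Q}

  pointwise-inverse : (∀ X → Unique (vars (h X))) → ∀ A →
                      pointwise g h f A ∘ pointwise h g f′ A ≈ id
  pointwise-inverse u unit    = identityˡ
  pointwise-inverse u (var X) = Wiring.wire-inverse (u X)
  pointwise-inverse u (A ⊗ B) = ⊗-inverse (pointwise-inverse u A) (pointwise-inverse u B)

module Models (𝒞 : MarkovCategory o ℓ e) {m n} {G_L : OpenDAG m} {G_H : OpenDAG n}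
              (L : CausalModel 𝒞 G_L) (H : CausalModel 𝒞 G_H) where
  open MarkovCategory 𝒞
  open Markov 𝒞
  open HomReasoning
  module E = Equiv
  module L where
    open OpenDAG G_L public
    open CausalModel L public
  module H where
    open OpenDAG G_H public
    open CausalModel H public
  Int-L = Int G_L L.outs
  Int-H = Int G_H H.outs
  module FL = MarkovCategory (Free Int-L)
  module WL = Wiring {Int-L}

  ⟦_⟧ᴸ : ∀ {A B} → Term Int-L A B → ⟦_⟧₀ 𝒞 A L.ob ⇒ ⟦_⟧₀ 𝒞 B L.ob
  ⟦_⟧ᴸ = Functor.F₁ ⟦ L ⟧Int

  ⟦_⟧ᴴ : ∀ {A B} → Term Int-H A B → ⟦_⟧₀ 𝒞 A H.ob ⇒ ⟦_⟧₀ 𝒞 B H.ob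
  ⟦_⟧ᴴ = Functor.F₁ ⟦ H ⟧Int

  ⟦⟧ᴸ-resp-≈ : ∀ {A B} {f g : Term Int-L A B} → f FL.≈ g → ⟦ f ⟧ᴸ ≈ ⟦ g ⟧ᴸ
  ⟦⟧ᴸ-resp-≈ = Functor.F-resp-≈ ⟦ L ⟧Int

  rewire≈⟦wire⟧ᴸ : ∀ A B (f : vars B ⊆ₗ vars A) → rewire 𝒞 L.ob A B f ≈ ⟦ wire {A = A} B f ⟧ᴸ
  rewire≈⟦wire⟧ᴸ A B f = E.reflexive (≡.sym (⟦wire⟧ 𝒞 Int-L L.ob _ A B f))

  rewire≈⟦wire⟧ᴴ : ∀ A B (f : vars B ⊆ₗ vars A) → rewire 𝒞 H.ob A B f ≈ ⟦ wire {A = A} B f ⟧ᴴ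
  rewire≈⟦wire⟧ᴴ A B f = E.reflexive (≡.sym (⟦wire⟧ 𝒞 Int-H H.ob _ A B f))

  module _ (a : OnVariables L H) where
    open OnVariables a

    τˢ-wire : ∀ S {T} (eq : image π S ≡ T) (f : vars (πᵗ (⨂ˢ S)) ⊆ₗ vars (⨂ˢ T)) →
              τˢ S eq ≈ τᵗ (⨂ˢ S) ∘ ⟦ wire {A = ⨂ˢ T} (πᵗ (⨂ˢ S)) f ⟧ᴸ
    τˢ-wire S ≡.refl f = ∘-congˡ (E.trans (rewire≈⟦wire⟧ᴸ (⨂ˢ (image π S)) (πᵗ (⨂ˢ S)) _)
      (⟦⟧ᴸ-resp-≈ (WL.wire-unique (πᵗ (⨂ˢ S)) (⨂ˢ-unique (image π S)))))

  powerʰ-resp-≈ : ∀ k {A B} {f g : ⟦_⟧₀ 𝒞 A L.ob ⇒ ⟦_⟧₀ 𝒞 B H.ob} → f ≈ g →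
                  powerʰ L H k {A} {B} f ≈ powerʰ L H k {A} {B} g
  powerʰ-resp-≈ zero    p = E.refl
  powerʰ-resp-≈ (suc k) p = ⊗-resp-≈ p (powerʰ-resp-≈ k p)

  -- By monoidality `merged` is the tensor of the components of τ at single variables.
  module Merged (π : Functor (Free Int-H) (Free Int-L))
                (τ : Transformation (⟦ L ⟧Int ∘F π) ⟦ H ⟧Int) where
    module π = Functor π
    module τ = Transformation τ

    merged : ∀ A → ⟦_⟧₀ 𝒞 (substitute (onVar π) A) L.ob ⇒ ⟦_⟧₀ 𝒞 A H.ob
    merged A = τ.at A ∘ ⟦ merge π A ⟧ᴸ

    merged-unit : merged unit ≈ id
    merged-unit = E.trans (∘-congˡ (E.sym identityʳ)) τ.at-unit

    merged-⊗ : ∀ A B → merged (A ⊗ B) ≈ merged A ⊗₁ merged B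
    merged-⊗ A B = begin
      τ.at (A ⊗ B) ∘ (⟦ π.μ ⟧ᴸ ∘ (⟦ merge π A ⟧ᴸ ⊗₁ ⟦ merge π B ⟧ᴸ))
        ≈⟨ pullˡ (E.trans (∘-congˡ (E.sym identityʳ)) (E.trans τ.at-⊗ identityˡ)) ⟩
      (τ.at A ⊗₁ τ.at B) ∘ (⟦ merge π A ⟧ᴸ ⊗₁ ⟦ merge π B ⟧ᴸ)
        ≈⟨ ⊗-∘ ⟨
      merged A ⊗₁ merged B ∎

    merged-split : ∀ A → merged A ∘ ⟦ split π A ⟧ᴸ ≈ τ.at A
    merged-split A = E.trans assoc (E.trans (∘-congˡ (⟦⟧ᴸ-resp-≈ (merge-split π A))) identityʳ)

    merged-power : ∀ k {A B} (g : Term Int-L A (substitute (onVar π) B)) →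
      merged (power k B) ∘ ⟦ powerᵗ (onVar π) k g ⟧ᴸ ≈ powerʰ L H k {A} {B} (merged B ∘ ⟦ g ⟧ᴸ)
    merged-power zero    g = E.trans identityʳ merged-unit
    merged-power (suc k) g = E.trans (∘-congʳ (merged-⊗ _ _))
      (E.trans (E.sym ⊗-∘) (⊗-congˡ (merged-power k g)))

    -- Naturality of `τ` at `gen q`, with `SendsTo` replacing the image of `gen q` by the generator
    -- `q′`.
    merged-query : ∀ q q′ i j → SendsTo π q q′ i j →
      merged (Signature.cod Int-H q) ∘ (⟦ j ⟧ᴸ ∘ ⟦ gen q′ ⟧ᴸ)
        ≈ ⟦ gen q ⟧ᴴ ∘ (merged (Signature.dom Int-H q) ∘ ⟦ i ⟧ᴸ)
    merged-query q q′ i j p = begin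
      merged B ∘ (⟦ j ⟧ᴸ ∘ ⟦ gen q′ ⟧ᴸ)
        ≈⟨ E.trans assoc (∘-congˡ (E.sym (⟦⟧ᴸ-resp-≈ p))) ⟩
      τ.at B ∘ (⟦ π.F₁ (gen q) ⟧ᴸ ∘ (⟦ merge π A ⟧ᴸ ∘ ⟦ i ⟧ᴸ))
        ≈⟨ square (τ.natural (gen q)) ⟩
      ⟦ gen q ⟧ᴴ ∘ (τ.at A ∘ (⟦ merge π A ⟧ᴸ ∘ ⟦ i ⟧ᴸ))
        ≈⟨ ∘-congˡ assoc ⟨
      ⟦ gen q ⟧ᴴ ∘ (merged A ∘ ⟦ i ⟧ᴸ) ∎
      where
      A = Signature.dom Int-H q
      B = Signature.cod Int-H q

  module Restriction (D : InterchangeDownwardAbstraction L H) where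
    open InterchangeDownwardAbstraction D public
    open Merged π τ public

    a : OnVariables L H
    a = restrict L H D
    module a = OnVariables a

    g : Fin n → Tensor (Fin m)
    g = onVar π

    ∈-in : ∀ {X x} → X ∈ H.ins → x ∈ₗ vars (g X) → x ∈ L.ins
    ∈-in X∈ x∈ = ∈-elems⁻ (∈-resp-↭ π-in (∈-substitute⁺ g (⨂ˢ H.ins) (∈-⨂ˢ⁺ X∈) x∈))

    ∈-nin : ∀ {X x} → X ∉ H.ins → x ∈ₗ vars (g X) → x ∈ L.nin
    ∈-nin X∉ x∈ = All.lookup π-nin (∈-substitute⁺ g (⨂ˢ H.nin) (∈-⨂ˢ⁺ (x∉p⇒x∈∁p X∉)) x∈)

    -- Two inputs, or two non-inputs, are separated because their concatenated list has no
    -- repetitions; an input and a non-input because their blocks lie in the complementary sets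
    -- `L.ins` and `L.nin`.
    separated : Separated g
    separated = record { unique = unique ; disjoint = disjoint _ _ }
      where
      in-unique : Unique (vars (substitute g (⨂ˢ H.ins)))
      in-unique = unique-resp-↭ (↭-sym π-in) (elems-unique L.ins)

      unique : ∀ X → Unique (vars (g X))
      unique X with X ∈? H.ins
      ... | yes X∈ = substitute-unique⁻ g (⨂ˢ H.ins) in-unique (∈-⨂ˢ⁺ X∈)
      ... | no  X∉ = substitute-unique⁻ g (⨂ˢ H.nin) π-nin-unique (∈-⨂ˢ⁺ (x∉p⇒x∈∁p X∉))

      disjoint : ∀ X Y → X ≢ Y → ∀ {x} → x ∈ₗ vars (g X) → x ∉ₗ vars (g Y)
      disjoint X Y X≢Y x∈X x∈Y with X ∈? H.ins | Y ∈? H.ins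
      ... | yes X∈ | yes Y∈ = substitute-disjoint⁻ g (⨂ˢ H.ins) in-unique (∈-⨂ˢ⁺ X∈) (∈-⨂ˢ⁺ Y∈) X≢Y x∈X x∈Y
      ... | yes X∈ | no  Y∉ = x∈∁p⇒x∉p (∈-nin Y∉ x∈Y) (∈-in X∈ x∈X)
      ... | no  X∉ | yes Y∈ = x∈∁p⇒x∉p (∈-nin X∉ x∈X) (∈-in Y∈ x∈Y)
      ... | no  X∉ | no  Y∉ = substitute-disjoint⁻ g (⨂ˢ H.nin) π-nin-unique
                                (∈-⨂ˢ⁺ (x∉p⇒x∈∁p X∉)) (∈-⨂ˢ⁺ (x∉p⇒x∈∁p Y∉)) X≢Y x∈X x∈Y

    -- An alignment retains only the set of variables of `g X`, which is listed in a standard order.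
    -- Since `g X` has no repetitions, `unsort` is invertible and nothing is lost.
    sorted : Fin n → Tensor (Fin m)
    sorted X = ⨂ˢ (support (g X))

    to-sorted : ∀ X → vars (g X) ⊆ₗ vars (sorted X)
    to-sorted X p = ∈-⨂ˢ⁺ (∈-support⁺ (g X) p)

    from-sorted : ∀ X → vars (sorted X) ⊆ₗ vars (g X)
    from-sorted X p = ∈-support⁻ (g X) (∈-⨂ˢ⁻ p)

    unsort : ∀ A → Term Int-L (substitute sorted A) (substitute g A)
    unsort = Pointwise.pointwise {Q = Int-L} sorted g to-sorted

    unsort-epic : ∀ A → Epic ⟦ unsort A ⟧ᴸ
    unsort-epic A = section⇒epic
      (⟦⟧ᴸ-resp-≈ (pointwise-inverse {Q = Int-L} sorted g to-sorted from-sorted (Separated.unique separated) A))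

    τᵗ-merged : ∀ A → a.τᵗ A ≈ merged A ∘ ⟦ unsort A ⟧ᴸ
    τᵗ-merged unit    = E.sym (E.trans identityʳ merged-unit)
    τᵗ-merged (var X) = ∘-resp-≈ (E.sym identityʳ) (rewire≈⟦wire⟧ᴸ (sorted X) (g X) (to-sorted X))
    τᵗ-merged (A ⊗ B) = begin
      a.τᵗ A ⊗₁ a.τᵗ B                               ≈⟨ ⊗-resp-≈ (τᵗ-merged A) (τᵗ-merged B) ⟩
      (merged A ∘ ⟦ unsort A ⟧ᴸ) ⊗₁ (merged B ∘ ⟦ unsort B ⟧ᴸ) ≈⟨ ⊗-∘ ⟩
      (merged A ⊗₁ merged B) ∘ ⟦ unsort (A ⊗ B) ⟧ᴸ   ≈⟨ ∘-congʳ (merged-⊗ A B) ⟨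
      merged (A ⊗ B) ∘ ⟦ unsort (A ⊗ B) ⟧ᴸ           ∎

    -- The epicness of tensor products required of an alignment comes from the components of `τ` at
    -- composite objects; `merge` and `unsort` are split epic.
    τᵗ-epic : ∀ A → Epic (a.τᵗ A)
    τᵗ-epic A = epic-resp-≈ (E.sym (τᵗ-merged A)) (epic-∘
      (epic-∘ (τ-epic A) (section⇒epic (⟦⟧ᴸ-resp-≈ (merge-split π A)))) (unsort-epic A))

    π-disjoint : ∀ X Y → X ≢ Y → Disjoint (a.π X) (a.π Y)
    π-disjoint X Y X≢Y (x , p) =
      let p₁ , p₂ = x∈p∩q⁻ (a.π X) (a.π Y) p
      in Separated.disjoint separated X≢Y (∈-support⁻ (g X) p₁) (∈-support⁻ (g Y) p₂)

    a-separated : Separated sorted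
    a-separated = ⨂ˢ-separated a.π π-disjoint

    image-ins : image a.π H.ins ≡ L.ins
    image-ins = ⊆-antisym
      (λ p → let X , X∈ , x∈ = ∈-image⁻ a.π p in ∈-in X∈ (∈-support⁻ (g X) x∈))
      (λ p → let X , X∈ , x∈ = ∈-substitute⁻ g (⨂ˢ H.ins) (∈-resp-↭ (↭-sym π-in) (∈-elems⁺ p))
             in ∈-image⁺ a.π (∈-⨂ˢ⁻ X∈) (∈-support⁺ (g X) x∈))

    alignment : IsVariableAlignment L H a
    alignment = record
      { π-disjoint = π-disjoint
      ; π-in = image-ins
      -- The query without interventions and with output V^out must have a valid image, whose output
      -- is π(V^out).
      ; π-out = IsInterchange.output (proj₁ (π-int [] H.outs
          (record { nonInput = λ () ; disjoint = λ () ; output = λ p → p })))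
      ; τ-epic = λ X → τᵗ-epic (var X)
      ; τ-det = λ X → ∘-det (τ.at-det (var X))
          (det-resp-≈ (E.sym (rewire≈⟦wire⟧ᴸ (sorted X) (g X) (to-sorted X)))
            (⟦⟧ᴸ-resp-≈ (WL.wire-det (g X) (to-sorted X))))
      ; τᵗ-epic = τᵗ-epic
      }

    τˢ-merged : ∀ S {T} (eq : image a.π S ≡ T) (f : vars (substitute g (⨂ˢ S)) ⊆ₗ vars (⨂ˢ T)) →
                a.τˢ S eq ≈ merged (⨂ˢ S) ∘ ⟦ wire {A = ⨂ˢ T} (substitute g (⨂ˢ S)) f ⟧ᴸ
    τˢ-merged S {T} eq f = begin
      a.τˢ S eq
        ≈⟨ τˢ-wire a S eq k ⟩
      a.τᵗ (⨂ˢ S) ∘ ⟦ wire (substitute sorted (⨂ˢ S)) k ⟧ᴸ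
        ≈⟨ E.trans (∘-congʳ (τᵗ-merged (⨂ˢ S))) assoc ⟩
      merged (⨂ˢ S) ∘ (⟦ unsort (⨂ˢ S) ⟧ᴸ ∘ ⟦ wire (substitute sorted (⨂ˢ S)) k ⟧ᴸ)
        ≈⟨ ∘-congˡ (⟦⟧ᴸ-resp-≈ unsort-wire) ⟩
      merged (⨂ˢ S) ∘ ⟦ wire (substitute g (⨂ˢ S)) f ⟧ᴸ ∎
      where
      k : vars (substitute sorted (⨂ˢ S)) ⊆ₗ vars (⨂ˢ T)
      k p = f (substitute-mono g sorted from-sorted (⨂ˢ S) p)

      unsort-wire : unsort (⨂ˢ S) FL.∘ wire {A = ⨂ˢ T} (substitute sorted (⨂ˢ S)) k
                      FL.≈ wire (substitute g (⨂ˢ S)) f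
      unsort-wire = FL.Equiv.trans
        (FL.∘-congʳ (Pointwise.pointwise-wire {Q = Int-L} sorted g to-sorted (⨂ˢ S)
          (substitute-mono sorted g to-sorted (⨂ˢ S)) (substitute-unique a-separated (⨂ˢ S) (⨂ˢ-unique S))))
        (FL.Equiv.trans (WL.wire-∘ (substitute g (⨂ˢ S))) (WL.wire-unique (substitute g (⨂ˢ S)) (⨂ˢ-unique T)))

    isInterchangeAbstraction : IsInterchangeAbstraction L H a
    isInterchangeAbstraction = record { alignment = alignment ; commutes = commutes }
      where
      commutes : ∀ {k} (Ss : Vec (Subset n) k) → (∀ i → lookup Ss i ⊆ H.nin) → PairwiseDisjoint Ss →
        a.τˢ H.outs ≡.refl ∘ interchange L (mapᵥ (image a.π) Ss) (image a.π H.outs)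
          ≈ interchange H Ss H.outs ∘ powerʰ L H (suc k) {⨂ˢ L.ins} {⨂ˢ H.ins} (a.τˢ H.ins image-ins)
      commutes {k} Ss nonInput disjoint =
        let v , sends = π-int Ss H.outs
              (record { nonInput = nonInput ; disjoint = disjoint ; output = λ p → p })
        in begin
        a.τˢ H.outs ≡.refl ∘ interchange L (mapᵥ (image a.π) Ss) (image a.π H.outs)
          ≈⟨ E.trans (∘-congʳ (τˢ-merged H.outs ≡.refl _)) assoc ⟩
        merged (⨂ˢ H.outs) ∘ (⟦ outputs H.outs ⟧ᴸ ∘ interchange L (mapᵥ (image a.π) Ss) (image a.π H.outs))
          ≈⟨ merged-query _ _ _ _ sends ⟩
        interchange H Ss H.outs ∘ (merged (power (suc k) (⨂ˢ H.ins)) ∘ ⟦ powerᵗ g (suc k) inputs ⟧ᴸ)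
          ≈⟨ ∘-congˡ (merged-power (suc k) {⨂ˢ L.ins} {⨂ˢ H.ins} inputs) ⟩
        interchange H Ss H.outs ∘ powerʰ L H (suc k) {⨂ˢ L.ins} {⨂ˢ H.ins} (merged (⨂ˢ H.ins) ∘ ⟦ inputs ⟧ᴸ)
          ≈⟨ ∘-congˡ (powerʰ-resp-≈ (suc k) {⨂ˢ L.ins} {⨂ˢ H.ins} (E.sym (τˢ-merged H.ins image-ins _))) ⟩
        interchange H Ss H.outs ∘ powerʰ L H (suc k) {⨂ˢ L.ins} {⨂ˢ H.ins} (a.τˢ H.ins image-ins) ∎

-- Injectivity

-- InterchangeQuery holds the validity of a query only irrelevantly, so it has to be recomputed.
isInterchange? : ∀ {n} (G : OpenDAG n) outs {k} (Ss : Vec (Subset n) k) O → Dec (IsInterchange G outs Ss O)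
isInterchange? G outs Ss O = map′ bundle
  (λ v → let open IsInterchange v in nonInput , disjoint , output)
  (Fin.all? (λ i → lookup Ss i ⊆? OpenDAG.nin G)
    ×-dec Fin.all? (λ i → Fin.all? λ j → ¬? (i Fin.≟ j) →-dec ¬? (nonempty? (lookup Ss i ∩ lookup Ss j)))
    ×-dec (O ⊆? outs))
  where
  bundle : (∀ i → lookup Ss i ⊆ OpenDAG.nin G) × PairwiseDisjoint Ss × (O ⊆ outs) → IsInterchange G outs Ss O
  bundle (p , q , r) = record { nonInput = p ; disjoint = q ; output = r }

module Transport {P Q : Signature} (π π′ : Functor (Free P) (Free Q))
  (f : ∀ X → vars (onVar π′ X) ⊆ₗ vars (onVar π X)) where
  open MarkovCategory (Free Q)
  open Markov (Free Q)
  open HomReasoning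
  private
    module E  = Equiv
    module π  = Functor π
    module π′ = Functor π′
    g  = onVar π
    g′ = onVar π′

  rearrange : ∀ A → substitute g A ⇒ substitute g′ A
  rearrange = Pointwise.pointwise {Q = Q} g g′ f

  -- The only possible choice: a monoidal transformation is determined at variables, and `merge` and
  -- `split` transport it to all objects.
  θ-at : ∀ A → π.F₀ A ⇒ π′.F₀ A
  θ-at A = merge π′ A ∘ (rearrange A ∘ split π A)

  θ-merge : ∀ A → θ-at A ∘ merge π A ≈ merge π′ A ∘ rearrange A
  θ-merge A = E.trans assoc (∘-congˡ (E.trans assoc
    (E.trans (∘-congˡ (split-merge π A)) identityʳ)))

  θ-⊗ : ∀ A B → θ-at (A ⊗ B) ∘ π.μ ≈ π′.μ ∘ (θ-at A ⊗₁ θ-at B)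
  θ-⊗ A B = section⇒epic (⊗-inverse (merge-split π A) (merge-split π B)) _ _ (begin
    (θ-at (A ⊗ B) ∘ π.μ) ∘ (merge π A ⊗₁ merge π B)             ≈⟨ assoc ⟩
    θ-at (A ⊗ B) ∘ merge π (A ⊗ B)                              ≈⟨ θ-merge (A ⊗ B) ⟩
    (π′.μ ∘ (merge π′ A ⊗₁ merge π′ B)) ∘ (rearrange A ⊗₁ rearrange B) ≈⟨ E.trans assoc (∘-congˡ (E.sym ⊗-∘)) ⟩
    π′.μ ∘ ((merge π′ A ∘ rearrange A) ⊗₁ (merge π′ B ∘ rearrange B)) ≈⟨ ∘-congˡ (⊗-resp-≈ (θ-merge A) (θ-merge B)) ⟨
    π′.μ ∘ ((θ-at A ∘ merge π A) ⊗₁ (θ-at B ∘ merge π B))       ≈⟨ E.trans (∘-congˡ ⊗-∘) (E.sym assoc) ⟩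
    (π′.μ ∘ (θ-at A ⊗₁ θ-at B)) ∘ (merge π A ⊗₁ merge π B)      ∎)

  θ-unit : θ-at unit ∘ π.η ≈ π′.η
  θ-unit = E.trans (θ-merge unit) identityʳ

  θ-wire : ∀ X → θ-at (var X) ≈ wire (g′ X) (f X)
  θ-wire X = E.trans identityˡ identityʳ

  rearrange-power : ∀ k {A B} {i : A ⇒ substitute g B} {i′ : A ⇒ substitute g′ B} →
    rearrange B ∘ i ≈ i′ → rearrange (power k B) ∘ powerᵗ g k i ≈ powerᵗ g′ k i′
  rearrange-power zero    q = identityˡ
  rearrange-power (suc k) q = E.trans (E.sym ⊗-∘) (⊗-resp-≈ q (rearrange-power k q))

  θ-family : MonoidalFamily π π′
  θ-family = record
    { at = θ-at
    ; at-⊗ = θ-⊗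
    ; at-unit = θ-unit
    ; at-var-det = λ X → det-resp-≈ (E.sym (θ-wire X)) (Wiring.wire-det (g′ X) (f X))
    }

  open MonoidalFamily θ-family public using (Natural; transformation)

  -- `SendsTo` describes the image of `gen q` only after composition with `merge` and `i`. Both are
  -- split epic, so naturality may be tested there.
  natural-query : ∀ {q C D D′} {x : C ⇒ D} {x′ : C ⇒ D′} {i i′ j j′ h} →
    π.F₁ (gen q) ∘ (merge π (Signature.dom P q) ∘ i) ≈ merge π (Signature.cod P q) ∘ (j ∘ x) →
    π′.F₁ (gen q) ∘ (merge π′ (Signature.dom P q) ∘ i′) ≈ merge π′ (Signature.cod P q) ∘ (j′ ∘ x′) →
    i ∘ h ≈ id → rearrange (Signature.dom P q) ∘ i ≈ i′ →
    rearrange (Signature.cod P q) ∘ (j ∘ x) ≈ j′ ∘ x′ → Natural (gen q)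
  natural-query {q} {x = x} {x′} {i} {i′} {j} {j′} sends sends′ i-section i≈ j≈ =
    epic-∘ (section⇒epic (merge-split π A)) (section⇒epic i-section) _ _ (begin
      (θ-at B ∘ π.F₁ (gen q)) ∘ (merge π A ∘ i)        ≈⟨ E.trans assoc (∘-congˡ sends) ⟩
      θ-at B ∘ (merge π B ∘ (j ∘ x))              ≈⟨ square (θ-merge B) ⟩
      merge π′ B ∘ (rearrange B ∘ (j ∘ x))        ≈⟨ ∘-congˡ j≈ ⟩
      merge π′ B ∘ (j′ ∘ x′)                       ≈⟨ sends′ ⟨
      π′.F₁ (gen q) ∘ (merge π′ A ∘ i′)                ≈⟨ ∘-congˡ (∘-congˡ i≈) ⟨
      π′.F₁ (gen q) ∘ (merge π′ A ∘ (rearrange A ∘ i)) ≈⟨ ∘-congˡ (square (θ-merge A)) ⟨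
      π′.F₁ (gen q) ∘ (θ-at A ∘ (merge π A ∘ i))       ≈⟨ assoc ⟨
      (π′.F₁ (gen q) ∘ θ-at A) ∘ (merge π A ∘ i)       ∎)
    where
    A = Signature.dom P q
    B = Signature.cod P q

module Comparison (𝒞 : MarkovCategory o ℓ e) {m n} {G_L : OpenDAG m} {G_H : OpenDAG n}
                  (L : CausalModel 𝒞 G_L) (H : CausalModel 𝒞 G_H) where
  open MarkovCategory 𝒞
  open Markov 𝒞
  open HomReasoning
  open Models 𝒞 L H

  -- The two generators have codomains that are equal only propositionally; wiring both to a common
  -- `B` avoids a transport of terms.
  gen-cong : ∀ {k} {Ss Ss′ : Vec (Subset m) k} {O O′} .{v v′} → Ss ≡ Ss′ → O ≡ O′ →
             ∀ B (f : vars B ⊆ₗ vars (⨂ˢ O)) (f′ : vars B ⊆ₗ vars (⨂ˢ O′)) →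
             wire {Int-L} {⨂ˢ O} B f FL.∘ gen (int Ss O v)
               FL.≈ wire {Int-L} {⨂ˢ O′} B f′ FL.∘ gen (int Ss′ O′ v′)
  gen-cong {O = O} ≡.refl ≡.refl B f f′ = FL.∘-congʳ (WL.wire-unique B (⨂ˢ-unique O))

  module _ {C : Obj} (A A′ : Tensor (Fin m)) (w : vars A′ ⊆ₗ vars A)
           {u : ⟦_⟧₀ 𝒞 A L.ob ⇒ C} {u′ : ⟦_⟧₀ 𝒞 A′ L.ob ⇒ C} where
    private
      -- The equation `τ-≈` with the supports generalised to arbitrary sets, so that `eq` can be
      -- matched with `refl`.
      Agree : ∀ {S S′} → S ≡ S′ → vars A ⊆ₗ vars (⨂ˢ S) → vars A′ ⊆ₗ vars (⨂ˢ S′) → Set e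
      Agree {S} {S′} eq f f′ = subst (λ S → ⟦_⟧₀ 𝒞 (⨂ˢ S) L.ob ⇒ C) eq (u ∘ rewire 𝒞 L.ob (⨂ˢ S) A f)
                                 ≈ u′ ∘ rewire 𝒞 L.ob (⨂ˢ S′) A′ f′

    rearranged⇒sorted : ∀ {S S′} (eq : S ≡ S′) (f : vars A ⊆ₗ vars (⨂ˢ S)) (f′ : vars A′ ⊆ₗ vars (⨂ˢ S′)) →
                        u ≈ u′ ∘ ⟦ wire {Int-L} {A} A′ w ⟧ᴸ → Agree eq f f′
    rearranged⇒sorted {S} ≡.refl f f′ p = begin
      u ∘ rewire 𝒞 L.ob (⨂ˢ S) A f                     ≈⟨ ∘-resp-≈ p (rewire≈⟦wire⟧ᴸ (⨂ˢ S) A f) ⟩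
      (u′ ∘ ⟦ wire {A = A} A′ w ⟧ᴸ) ∘ ⟦ wire {A = ⨂ˢ S} A f ⟧ᴸ ≈⟨ assoc ⟩
      u′ ∘ ⟦ wire {A = A} A′ w FL.∘ wire {A = ⨂ˢ S} A f ⟧ᴸ     ≈⟨ ∘-congˡ (⟦⟧ᴸ-resp-≈ (WL.wire-∘ A′)) ⟩
      u′ ∘ ⟦ wire {A = ⨂ˢ S} A′ _ ⟧ᴸ                   ≈⟨ ∘-congˡ (⟦⟧ᴸ-resp-≈ (WL.wire-unique A′ (⨂ˢ-unique S))) ⟩
      u′ ∘ ⟦ wire {A = ⨂ˢ S} A′ f′ ⟧ᴸ                  ≈⟨ ∘-congˡ (rewire≈⟦wire⟧ᴸ (⨂ˢ S) A′ f′) ⟨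
      u′ ∘ rewire 𝒞 L.ob (⨂ˢ S) A′ f′                  ∎

    sorted⇒rearranged : ∀ {S S′} (eq : S ≡ S′) (f : vars A ⊆ₗ vars (⨂ˢ S)) (f′ : vars A′ ⊆ₗ vars (⨂ˢ S′)) →
                        Unique (vars A) → vars (⨂ˢ S) ⊆ₗ vars A → Agree eq f f′ →
                        u ≈ u′ ∘ ⟦ wire {Int-L} {A} A′ w ⟧ᴸ
    sorted⇒rearranged {S} ≡.refl f f′ A! k p =
      section⇒epic (⟦⟧ᴸ-resp-≈ (WL.wire-inverse {A} {⨂ˢ S} {k} {f} A!)) _ _ (begin
        u ∘ ⟦ wire {A = ⨂ˢ S} A f ⟧ᴸ                             ≈⟨ ∘-congˡ (rewire≈⟦wire⟧ᴸ (⨂ˢ S) A f) ⟨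
        u ∘ rewire 𝒞 L.ob (⨂ˢ S) A f                             ≈⟨ p ⟩
        u′ ∘ rewire 𝒞 L.ob (⨂ˢ S) A′ f′                          ≈⟨ ∘-congˡ (rewire≈⟦wire⟧ᴸ (⨂ˢ S) A′ f′) ⟩
        u′ ∘ ⟦ wire {A = ⨂ˢ S} A′ f′ ⟧ᴸ
          ≈⟨ ∘-congˡ (⟦⟧ᴸ-resp-≈ (WL.wire-unique A′ (⨂ˢ-unique S))) ⟩
        u′ ∘ ⟦ wire {A = ⨂ˢ S} A′ _ ⟧ᴸ                           ≈⟨ ∘-congˡ (⟦⟧ᴸ-resp-≈ (WL.wire-∘ A′ {f} {w})) ⟨
        u′ ∘ ⟦ wire {A = A} A′ w FL.∘ wire {A = ⨂ˢ S} A f ⟧ᴸ     ≈⟨ assoc ⟨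
        (u′ ∘ ⟦ wire {A = A} A′ w ⟧ᴸ) ∘ ⟦ wire {A = ⨂ˢ S} A f ⟧ᴸ ∎)

  restriction : InterchangeDownwardAbstraction L H → InterchangeAbstraction L H
  restriction D = restrict L H D , Restriction.isInterchangeAbstraction D

  module _ (D D′ : InterchangeDownwardAbstraction L H) where
    private
      module D  = Restriction D
      module D′ = Restriction D′
      open D using (g)
      open D′ using () renaming (g to g′)

    restriction-cong : D.downward ≈ᴰ D′.downward →
                       _≈ᴵ_ L H (restriction D) (restriction D′)
    restriction-cong p = record
      { π-≡ = λ X → support-≡ X (proj₁ (θ-var X))
      ; τ-≈ = λ X → rearranged⇒sorted (g X) (g′ X) (∈-resp-↭ (proj₁ (θ-var X))) _
          (D.to-sorted X) (D′.to-sorted X)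
          (E.trans (E.sym (θ-τ (var X))) (∘-congˡ (⟦⟧ᴸ-resp-≈ (proj₂ (θ-var X)))))
      }
      where
      open _≈ᴰ_ p
      support-≡ : ∀ X → vars (g′ X) ↭ vars (g X) → support (g X) ≡ support (g′ X)
      support-≡ X s = ⊆-antisym
        (λ q → ∈-support⁺ (g′ X) (∈-resp-↭ (↭-sym s) (∈-support⁻ (g X) q)))
        (λ q → ∈-support⁺ (g X) (∈-resp-↭ s (∈-support⁻ (g′ X) q)))

    module _ (p : _≈ᴵ_ L H (restriction D) (restriction D′)) where
      open _≈ᴵ_ p
      private
        module MFL = Markov (Free Int-L)

      rearrangement : ∀ X → vars (g′ X) ↭ vars (g X)
      rearrangement X = unique⇒↭ (Separated.unique D′.separated X) (Separated.unique D.separated X)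
        (λ q → ∈-support⁻ (g X) (subst (_ ∈_) (≡.sym (π-≡ X)) (∈-support⁺ (g′ X) q)))
        (λ q → ∈-support⁻ (g′ X) (subst (_ ∈_) (π-≡ X) (∈-support⁺ (g X) q)))

      open Transport D.π D′.π (λ X → ∈-resp-↭ (rearrangement X))

      -- At single variables this is `τ-≈`, freed from the sorting; both sides are monoidal.
      rearrange-merged : ∀ A → D′.merged A ∘ ⟦ rearrange A ⟧ᴸ ≈ D.merged A
      rearrange-merged unit = E.trans identityʳ (E.trans D′.merged-unit (E.sym D.merged-unit))
      rearrange-merged (var X) = E.trans (∘-congʳ identityʳ) (E.trans
        (E.sym (sorted⇒rearranged (g X) (g′ X) (∈-resp-↭ (rearrangement X)) (π-≡ X)
          (D.to-sorted X) (D′.to-sorted X)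
          (Separated.unique D.separated X) (D.from-sorted X) (τ-≈ X)))
        (E.sym identityʳ))
      rearrange-merged (A ⊗ B) = begin
        D′.merged (A ⊗ B) ∘ ⟦ rearrange (A ⊗ B) ⟧ᴸ
          ≈⟨ ∘-congʳ (D′.merged-⊗ A B) ⟩
        (D′.merged A ⊗₁ D′.merged B) ∘ (⟦ rearrange A ⟧ᴸ ⊗₁ ⟦ rearrange B ⟧ᴸ)
          ≈⟨ ⊗-∘ ⟨
        (D′.merged A ∘ ⟦ rearrange A ⟧ᴸ) ⊗₁ (D′.merged B ∘ ⟦ rearrange B ⟧ᴸ)
          ≈⟨ ⊗-resp-≈ (rearrange-merged A) (rearrange-merged B) ⟩
        D.merged A ⊗₁ D.merged B
          ≈⟨ D.merged-⊗ A B ⟨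
        D.merged (A ⊗ B) ∎

      rearrange-wire : ∀ {A} B (f : vars (substitute g B) ⊆ₗ vars A) (f′ : vars (substitute g′ B) ⊆ₗ vars A) →
        Unique (vars A) → Unique (vars B) →
        rearrange B FL.∘ wire {A = A} (substitute g B) f FL.≈ wire {A = A} (substitute g′ B) f′
      rearrange-wire B f f′ A! B! = FL.Equiv.trans
        (FL.∘-congʳ (Pointwise.pointwise-wire {Q = Int-L} g g′ _ B
          (substitute-mono g g′ (λ X → ∈-resp-↭ (rearrangement X)) B) (substitute-unique D.separated B B!)))
        (FL.Equiv.trans (WL.wire-∘ (substitute g′ B)) (WL.wire-unique (substitute g′ B) A!))

      -- `π-int` prescribes the image of a query through the sets π(S) and π(O). These agree for `D`
      -- and `D′`, so up to rearrangement both functors pick the same generator.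
      θ-query : ∀ {k} (Ss : Vec (Subset n) k) O (v : IsInterchange G_H H.outs Ss O) → Natural (gen (int Ss O v))
      θ-query {k} Ss O v = natural-query (proj₂ (D.π-int Ss O v)) (proj₂ (D′.π-int Ss O v))
        (proj₁ (proj₂ (powerᵗ-inverse g (suc k) {f = D.inputs} {uninputs}
          (WL.wire-inverse (substitute-unique D.separated (⨂ˢ H.ins) (⨂ˢ-unique H.ins)))
          (WL.wire-inverse (⨂ˢ-unique L.ins)))))
        (rearrange-power (suc k) {⨂ˢ L.ins} {⨂ˢ H.ins}
          (rearrange-wire (⨂ˢ H.ins) _ _ (⨂ˢ-unique L.ins) (⨂ˢ-unique H.ins)))
        (FL.Equiv.trans
          (MFL.pullˡ (rearrange-wire (⨂ˢ O) _ (λ p → substitute-⊆-image g (λ X → ∈-support⁺ (g X)) O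
            (substitute-mono g g′ (λ X → ∈-resp-↭ (rearrangement X)) (⨂ˢ O) p)) (⨂ˢ-unique _) (⨂ˢ-unique O)))
          (gen-cong (map-cong (image-cong π-≡) Ss) (image-cong π-≡ O) (substitute g′ (⨂ˢ O)) _ _))
        where
        uninputs : Term Int-L (substitute g (⨂ˢ H.ins)) (⨂ˢ L.ins)
        uninputs = wire (⨂ˢ L.ins) λ p → ∈-resp-↭ (↭-sym D.π-in) (∈-⨂⁻ _ p)

      restriction-injective : D.downward ≈ᴰ D′.downward
      restriction-injective = record
        { θ = transformation λ { (int Ss O v) → θ-query Ss O (recompute (isInterchange? G_H H.outs Ss O) v) }
        ; θ-var = λ X → rearrangement X , θ-wire X
        ; θ-τ = λ A → begin
            D′.τ.at A ∘ (⟦ merge D′.π A ⟧ᴸ ∘ (⟦ rearrange A ⟧ᴸ ∘ ⟦ split D.π A ⟧ᴸ))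
              ≈⟨ E.trans (E.sym assoc) (E.sym assoc) ⟩
            (D′.merged A ∘ ⟦ rearrange A ⟧ᴸ) ∘ ⟦ split D.π A ⟧ᴸ ≈⟨ ∘-congʳ (rearrange-merged A) ⟩
            D.merged A ∘ ⟦ split D.π A ⟧ᴸ                       ≈⟨ D.merged-split A ⟩
            D.τ.at A                                            ∎
        }

-- Surjectivity

module _ (𝒞 : MarkovCategory o ℓ e) (Q : Signature) (ob : Signature.Type Q → MarkovCategory.Obj 𝒞)
         (hom : ∀ q → MarkovCategory._⇒_ 𝒞 (⟦_⟧₀ 𝒞 (Signature.dom Q q) ob) (⟦_⟧₀ 𝒞 (Signature.cod Q q) ob)) where
  open MarkovCategory 𝒞

  merge-extend : ∀ A → merge (Extension.extend 𝒞 Q ob hom) A ≈ id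
  merge-extend unit    = Equiv.refl
  merge-extend (var X) = Equiv.refl
  merge-extend (A ⊗ B) = Equiv.trans identityˡ
    (Equiv.trans (⊗-resp-≈ (merge-extend A) (merge-extend B)) ⊗-id)

module Construction (𝒞 : MarkovCategory o ℓ e) {m n} {G_L : OpenDAG m} {G_H : OpenDAG n}
                    (L : CausalModel 𝒞 G_L) (H : CausalModel 𝒞 G_H)
                    (a : OnVariables L H) (isIA : IsInterchangeAbstraction L H a) where
  open MarkovCategory 𝒞
  open Markov 𝒞
  open HomReasoning
  open Models 𝒞 L H
  open Comparison 𝒞 L H
  open OnVariables a
  open IsInterchangeAbstraction isIA
  open IsVariableAlignment alignment
  module MFL = Markov (Free Int-L)

  g : Fin n → Tensor (Fin m)
  g X = ⨂ˢ (π X)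

  separated : Separated g
  separated = ⨂ˢ-separated π π-disjoint

  substituted-unique : ∀ S → Unique (vars (substitute g (⨂ˢ S)))
  substituted-unique S = substitute-unique separated (⨂ˢ S) (⨂ˢ-unique S)

  from-image : ∀ S → vars (⨂ˢ (image π S)) ⊆ₗ vars (substitute g (⨂ˢ S))
  from-image = image-⊆-substitute π g λ X → ∈-⨂ˢ⁺

  to-image : ∀ S → vars (substitute g (⨂ˢ S)) ⊆ₗ vars (⨂ˢ (image π S))
  to-image = substitute-⊆-image g λ X → ∈-⨂ˢ⁻

  image-↭ : ∀ S {T} → image π S ≡ T → vars (substitute g (⨂ˢ S)) ↭ vars (⨂ˢ T)
  image-↭ S ≡.refl = unique⇒↭ (substituted-unique S) (⨂ˢ-unique (image π S)) (to-image S) (from-image S)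

  -- An alignment does not state this. It follows because π(V^in) already exhausts the inputs of `L`
  -- and the blocks are disjoint.
  image-nin : ∀ {S} → S ⊆ H.nin → image π S ⊆ L.nin
  image-nin S⊆nin p = x∉p⇒x∈∁p λ x∈ins →
    let X , X∈S , x∈X = ∈-image⁻ π p
        Y , Y∈ins , x∈Y = ∈-image⁻ π (subst (_ ∈_) (≡.sym π-in) x∈ins)
    in π-disjoint X Y (λ X≡Y → x∈∁p⇒x∉p (S⊆nin X∈S) (subst (_∈ H.ins) (≡.sym X≡Y) Y∈ins))
         (_ , x∈p∩q⁺ (x∈X , x∈Y))

  image-disjoint : ∀ {S T} → Disjoint S T → Disjoint (image π S) (image π T)
  image-disjoint {S} {T} d (x , p) =
    let p₁ , p₂ = x∈p∩q⁻ (image π S) (image π T) p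
        X , X∈S , x∈X = ∈-image⁻ π p₁
        Y , Y∈T , x∈Y = ∈-image⁻ π p₂
    in π-disjoint X Y (λ X≡Y → d (X , x∈p∩q⁺ (X∈S , subst (_∈ T) (≡.sym X≡Y) Y∈T))) (x , x∈p∩q⁺ (x∈X , x∈Y))

  image-valid : ∀ {k} {Ss : Vec (Subset n) k} {O} → IsInterchange G_H H.outs Ss O →
                IsInterchange G_L L.outs (mapᵥ (image π) Ss) (image π O)
  image-valid {Ss = Ss} v = record
    { nonInput = λ i → subst (_⊆ L.nin) (≡.sym (lookup-map i (image π) Ss)) (image-nin (nonInput i))
    ; disjoint = λ i j i≢j → ≡.subst₂ Disjoint
        (≡.sym (lookup-map i (image π) Ss)) (≡.sym (lookup-map j (image π) Ss))
        (image-disjoint (disjoint i j i≢j))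
    ; output = λ p → π-out (image-mono π output p)
    }
    where open IsInterchange v

  ins-↭ : vars (substitute g (⨂ˢ H.ins)) ↭ vars (⨂ˢ L.ins)
  ins-↭ = image-↭ H.ins π-in

  ins-↭-elems : vars (substitute g (⨂ˢ H.ins)) ↭ elems L.ins
  ins-↭-elems = subst (vars (substitute g (⨂ˢ H.ins)) ↭_) (vars-⨂ (elems L.ins)) ins-↭

  ins-wire : Term Int-L (⨂ˢ L.ins) (substitute g (⨂ˢ H.ins))
  ins-wire = wire (substitute g (⨂ˢ H.ins)) λ p → ∈-⨂⁺ (∈-resp-↭ ins-↭-elems p)

  ins-unwire : Term Int-L (substitute g (⨂ˢ H.ins)) (⨂ˢ L.ins)
  ins-unwire = wire (⨂ˢ L.ins) λ p → ∈-resp-↭ (↭-sym ins-↭) p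

  module _ (k : ℕ) where
    inputs : Term Int-L (power k (⨂ˢ L.ins)) (substitute g (power k (⨂ˢ H.ins)))
    inputs = powerᵗ g k ins-wire

    private
      inverse = powerᵗ-inverse {Int-L} g k {⨂ˢ L.ins} {⨂ˢ H.ins} {ins-wire} {ins-unwire}
        (WL.wire-inverse (substituted-unique H.ins)) (WL.wire-inverse (⨂ˢ-unique L.ins))

    uninputs : Term Int-L (substitute g (power k (⨂ˢ H.ins))) (power k (⨂ˢ L.ins))
    uninputs = proj₁ inverse

    inputs-uninputs : inputs FL.∘ uninputs FL.≈ FL.id
    inputs-uninputs = proj₁ (proj₂ inverse)

    uninputs-inputs : uninputs FL.∘ inputs FL.≈ FL.id
    uninputs-inputs = proj₂ (proj₂ inverse)

  outputs : ∀ O → Term Int-L (⨂ˢ (image π O)) (substitute g (⨂ˢ O))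
  outputs O = wire (substitute g (⨂ˢ O)) (to-image O)

  -- A functor on the free category needs a term between the substituted lists, so the generator is
  -- conjugated by rearrangements. `uninputs` is chosen to cancel the `inputs` that `SendsTo` puts
  -- in front.
  query : ∀ q → Term Int-L (substitute g (Signature.dom Int-H q)) (substitute g (Signature.cod Int-H q))
  query (int {k} Ss O v) =
    outputs O FL.∘ (gen (int (mapᵥ (image π) Ss) (image π O) (image-valid v)) FL.∘ uninputs (suc k))

  open Extension (Free Int-L) Int-H g query using () renaming (extend to πF)

  query-inputs : ∀ {k} (Ss : Vec (Subset n) k) O .v .v′ →
    query (int Ss O v) FL.∘ inputs (suc k) FL.≈ outputs O FL.∘ gen (int (mapᵥ (image π) Ss) (image π O) v′)
  query-inputs {k} Ss O v v′ = FL.Equiv.trans FL.assoc (FL.∘-congˡ (FL.Equiv.trans FL.assoc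
    (FL.Equiv.trans (FL.∘-congˡ (uninputs-inputs (suc k))) FL.identityʳ)))

  -- The form of `i`, `j` and `x` is left open because the fact is used twice: with permutations for
  -- `π-query`, and with the sets computed from supports for `π-int`.
  sends : ∀ {k} (Ss : Vec (Subset n) k) O .v {q′}
    (i : Term Int-L (power (suc k) (⨂ˢ L.ins)) (substitute g (power (suc k) (⨂ˢ H.ins)))) →
    i FL.≈ inputs (suc k) → ∀ {j : Term Int-L _ (substitute g (⨂ˢ O))} {x : Term Int-L _ q′} →
    outputs O FL.∘ gen (int (mapᵥ (image π) Ss) (image π O) (image-valid v)) FL.≈ j FL.∘ x →
    query (int Ss O v) FL.∘ (merge πF (power (suc k) (⨂ˢ H.ins)) FL.∘ i) FL.≈ merge πF (⨂ˢ O) FL.∘ (j FL.∘ x)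
  sends {k} Ss O v i p q = FL.Equiv.trans
    (FL.∘-congˡ (FL.Equiv.trans (FL.∘-resp-≈ (merge-πF (power (suc k) (⨂ˢ H.ins))) p) FL.identityˡ))
    (FL.Equiv.trans (query-inputs Ss O v (image-valid v))
      (FL.Equiv.trans q (FL.Equiv.sym (FL.Equiv.trans (FL.∘-congʳ (merge-πF (⨂ˢ O))) FL.identityˡ))))
    where
    merge-πF : ∀ A → merge πF A FL.≈ FL.id
    merge-πF = merge-extend (Free Int-L) Int-H g query

  τᵗ-family : MonoidalFamily (⟦ L ⟧Int ∘F πF) ⟦ H ⟧Int
  τᵗ-family = record
    { at = τᵗ
    ; at-⊗ = λ A B → E.trans (∘-congˡ identityˡ) (E.trans identityʳ (E.sym identityˡ))
    ; at-unit = E.trans identityˡ identityˡ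
    ; at-var-det = τ-det
    }

  open MonoidalFamily τᵗ-family using (Natural; natural-wire; transformation)

  τᵗ-power : ∀ k → τᵗ (power k (⨂ˢ H.ins)) ∘ ⟦ inputs k ⟧ᴸ ≈ powerʰ L H k {⨂ˢ L.ins} {⨂ˢ H.ins} (τˢ H.ins π-in)
  τᵗ-power zero    = identityˡ
  τᵗ-power (suc k) = E.trans (E.sym ⊗-∘) (⊗-resp-≈ (E.sym (τˢ-wire a H.ins π-in _)) (τᵗ-power k))

  -- The query with output `O` is the one with output V^out followed by discarding, in `L` and in
  -- `H`. Naturality at the discarding wiring moves τ to V^out, where `commutes` applies.
  natural-query : ∀ {k} (Ss : Vec (Subset n) k) O .v → IsInterchange G_H H.outs Ss O → Natural (gen (int Ss O v))
  natural-query {k} Ss O v valid = begin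
    τᵗ B ∘ (⟦ outputs O ⟧ᴸ ∘ (interchange L Ss′ (image π O) ∘ ⟦ uninputs (suc k) ⟧ᴸ))
      ≈⟨ ∘-congˡ (∘-congˡ (∘-congʳ (interchange-mono L (image-mono π O⊆) drop-L Ss′))) ⟨
    τᵗ B ∘ (⟦ outputs O ⟧ᴸ ∘ ((marginal-L ∘ intL) ∘ ⟦ uninputs (suc k) ⟧ᴸ))
      ≈⟨ ∘-congˡ (E.trans (∘-congˡ assoc) (square outputs-drop)) ⟩
    τᵗ B ∘ (⟦ wire B drop-H ⟧π ∘ (⟦ outputs H.outs ⟧ᴸ ∘ (intL ∘ ⟦ uninputs (suc k) ⟧ᴸ)))
      ≈⟨ square (natural-wire B drop-H) ⟩
    ⟦ wire B drop-H ⟧ᴴ ∘ (τᵗ (⨂ˢ H.outs) ∘ (⟦ outputs H.outs ⟧ᴸ ∘ (intL ∘ ⟦ uninputs (suc k) ⟧ᴸ)))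
      ≈⟨ ∘-congˡ (pullˡ (E.sym (τˢ-wire a H.outs ≡.refl (to-image H.outs)))) ⟩
    ⟦ wire B drop-H ⟧ᴴ ∘ (τˢ H.outs ≡.refl ∘ (intL ∘ ⟦ uninputs (suc k) ⟧ᴸ))
      ≈⟨ ∘-congˡ (square (commutes Ss nonInput disjoint)) ⟩
    ⟦ wire B drop-H ⟧ᴴ ∘ (intH ∘ (τ-inputs ∘ ⟦ uninputs (suc k) ⟧ᴸ))
      -- Exposes `inputs` inside the tensor power of τ, where it cancels the `uninputs` coming from
      -- `query`.
      ≈⟨ ∘-congˡ (∘-congˡ (∘-congʳ (τᵗ-power (suc k)))) ⟨
    ⟦ wire B drop-H ⟧ᴴ ∘ (intH ∘ ((τᵗ A ∘ ⟦ inputs (suc k) ⟧ᴸ) ∘ ⟦ uninputs (suc k) ⟧ᴸ))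
      ≈⟨ ∘-congˡ (∘-congˡ (E.trans assoc (E.trans (∘-congˡ (⟦⟧ᴸ-resp-≈ (inputs-uninputs (suc k)))) identityʳ))) ⟩
    ⟦ wire B drop-H ⟧ᴴ ∘ (intH ∘ τᵗ A)
      ≈⟨ pullˡ (E.trans (∘-congʳ (E.sym (rewire≈⟦wire⟧ᴴ (⨂ˢ H.outs) B drop-H)))
                        (interchange-mono H O⊆ drop-H Ss)) ⟩
    interchange H Ss O ∘ τᵗ A ∎
    where
    open IsInterchange valid renaming (output to O⊆)
    A = power (suc k) (⨂ˢ H.ins)
    B = ⨂ˢ O
    Ss′ = mapᵥ (image π) Ss
    intL = interchange L Ss′ (image π H.outs)
    intH = interchange H Ss H.outs
    τ-inputs = powerʰ L H (suc k) {⨂ˢ L.ins} {⨂ˢ H.ins} (τˢ H.ins π-in)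

    ⟦_⟧π : ∀ {A B} → Term Int-H A B → ⟦_⟧₀ 𝒞 (substitute g A) L.ob ⇒ ⟦_⟧₀ 𝒞 (substitute g B) L.ob
    ⟦ f ⟧π = ⟦ Functor.F₁ πF f ⟧ᴸ

    drop-L : vars (⨂ˢ (image π O)) ⊆ₗ vars (⨂ˢ (image π H.outs))
    drop-L p = ∈-⨂ˢ⁺ (image-mono π O⊆ (∈-⨂ˢ⁻ p))

    marginal-L : ⟦_⟧₀ 𝒞 (⨂ˢ (image π H.outs)) L.ob ⇒ ⟦_⟧₀ 𝒞 (⨂ˢ (image π O)) L.ob
    marginal-L = rewire 𝒞 L.ob (⨂ˢ (image π H.outs)) (⨂ˢ (image π O)) drop-L

    drop-H : vars (⨂ˢ O) ⊆ₗ vars (⨂ˢ H.outs)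
    drop-H p = ∈-⨂ˢ⁺ (O⊆ (∈-⨂ˢ⁻ p))

    -- The functor πF turns the discarding wiring into some wiring, so both sides are wirings out of
    -- the repetition-free list of π(V^out).
    outputs-drop : ⟦ outputs O ⟧ᴸ ∘ marginal-L ≈ ⟦ wire B drop-H ⟧π ∘ ⟦ outputs H.outs ⟧ᴸ
    outputs-drop = E.trans (∘-congˡ (rewire≈⟦wire⟧ᴸ (⨂ˢ (image π H.outs)) (⨂ˢ (image π O)) drop-L))
      (⟦⟧ᴸ-resp-≈ (FL.Equiv.trans (WL.wire-∘ (substitute g B))
        (FL.Equiv.trans (WL.wire-unique (substitute g B) (⨂ˢ-unique (image π H.outs)))
          (FL.Equiv.sym (FL.Equiv.trans (FL.∘-congʳ (proj₂ image-wire)) (WL.wire-∘ (substitute g B)))))))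
      where
      image-wire = Substitution.⟦wire⟧-wire {Int-H} {Int-L} g query {⨂ˢ H.outs} B drop-H

  downward : DownwardAbstraction ⟦ L ⟧Int ⟦ H ⟧Int
  downward = record
    { π = πF
    ; π-query = λ { q@(int {k} Ss O v) →
        int (mapᵥ (image π) Ss) (image π O) (image-valid v) ,
        ↭-power {Int-L} g (suc k) {⨂ˢ L.ins} {⨂ˢ H.ins} ins-↭ ,
        image-↭ O ≡.refl ,
        sends Ss O v _ (permute-power {Int-L} g (suc k) {⨂ˢ L.ins} {⨂ˢ H.ins} ins-↭ ins-wire
            (WL.wire-unique (substitute g (⨂ˢ H.ins)) (⨂ˢ-unique L.ins)))
          (FL.∘-congʳ (WL.wire-unique (substitute g (⨂ˢ O)) (⨂ˢ-unique (image π O)))) }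
    ; τ = transformation λ { (int Ss O v) → natural-query Ss O v (recompute (isInterchange? G_H H.outs Ss O) v) }
    ; τ-epic = τᵗ-epic
    }

  support-⨂ˢ : ∀ X → support (g X) ≡ π X
  support-⨂ˢ X = ⊆-antisym (λ p → ∈-⨂ˢ⁻ (∈-support⁻ (g X) p)) (λ p → ∈-support⁺ (g X) (∈-⨂ˢ⁺ p))

  abstraction : InterchangeDownwardAbstraction L H
  abstraction = record
    { downward = downward
    ; π-in = ins-↭-elems
    ; π-nin = All.tabulate λ p →
        let X , X∈ , x∈ = ∈-substitute⁻ g (⨂ˢ H.nin) p
        in image-nin {H.nin} (λ q → q) (∈-image⁺ π (∈-⨂ˢ⁻ X∈) (∈-⨂ˢ⁻ x∈))
    ; π-nin-unique = substituted-unique H.nin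
    -- Here the image sets are computed from supports of lists; they equal the sets of the alignment
    -- only propositionally, hence the transport.
    ; π-int = λ {k} Ss O v →
        ≡.subst₂ (IsInterchange G_L L.outs)
          (≡.sym (map-cong image-support Ss)) (≡.sym (image-support O)) (image-valid v) ,
        sends Ss O v _ FL.Equiv.refl
          (gen-cong (≡.sym (map-cong image-support Ss)) (≡.sym (image-support O)) (substitute g (⨂ˢ O)) _ _)
    }
    where
    image-support : ∀ S → image (λ X → support (g X)) S ≡ image π S
    image-support = image-cong support-⨂ˢ

  restriction-abstraction : _≈ᴵ_ L H (restriction abstraction) (a , isIA)
  restriction-abstraction = record
    { π-≡ = support-⨂ˢ
    ; τ-≈ = λ X → unsorted X (support-⨂ˢ X) _
    }
    where
    -- With `S` arbitrary, `eq` can be matched with `refl`; the rewiring from a repetition-free list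
    -- to itself is then the identity.
    unsorted : ∀ X {S} (eq : S ≡ π X) (f : vars (g X) ⊆ₗ vars (⨂ˢ S)) →
               subst (λ S → ⟦_⟧₀ 𝒞 (⨂ˢ S) L.ob ⇒ H.ob X) eq (τ X ∘ rewire 𝒞 L.ob (⨂ˢ S) (g X) f) ≈ τ X
    unsorted X ≡.refl f = E.trans
      (∘-congˡ (E.trans (rewire≈⟦wire⟧ᴸ (g X) (g X) f)
        (⟦⟧ᴸ-resp-≈ (FL.Equiv.trans (WL.wire-unique (g X) (⨂ˢ-unique (π X))) (WL.wire-id (g X))))))
      identityʳ

module _ (𝒞 : MarkovCategory o ℓ e) {m n} {G_L : OpenDAG m} {G_H : OpenDAG n}
         (L : CausalModel 𝒞 G_L) (H : CausalModel 𝒞 G_H) where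
  open MarkovCategory 𝒞

  -- Surjectivity inside `Bijective` concerns every `D` equivalent to the chosen preimage, so
  -- congruence has to be chained with the equation for the preimage.
  ≈ᴵ-trans : ∀ {a b c} → _≈ᴵ_ L H a b → _≈ᴵ_ L H b c → _≈ᴵ_ L H a c
  ≈ᴵ-trans p q = record
    { π-≡ = λ X → ≡.trans (p.π-≡ X) (q.π-≡ X)
    ; τ-≈ = λ X → subst-trans (p.π-≡ X) (q.π-≡ X) (p.τ-≈ X) (q.τ-≈ X)
    }
    where
    module p = _≈ᴵ_ p
    module q = _≈ᴵ_ q
    subst-trans : ∀ {A : Set} {x y z : A} {B : A → Obj} {C} (p : x ≡ y) (q : y ≡ z)
                  {f : B x ⇒ C} {g : B y ⇒ C} {h : B z ⇒ C} →
                  subst (λ x → B x ⇒ C) p f ≈ g → subst (λ x → B x ⇒ C) q g ≈ h →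
                  subst (λ x → B x ⇒ C) (≡.trans p q) f ≈ h
    subst-trans ≡.refl ≡.refl r s = Equiv.trans r s

proposition29 : ∀ {o ℓ e : Level} (𝒞 : MarkovCategory o ℓ e) {m n : ℕ} {G_L : OpenDAG m} {G_H : OpenDAG n}
    (L : CausalModel 𝒞 G_L) (H : CausalModel 𝒞 G_H) →
    Σ[ r ∈ (∀ D → IsInterchangeAbstraction L H (restrict L H D)) ]
      (let f : InterchangeDownwardAbstraction L H → InterchangeAbstraction L H
           f D = restrict L H D , r D
           _≈_ = λ D D′ → InterchangeDownwardAbstraction.downward D ≈ᴰ InterchangeDownwardAbstraction.downward D′
       in Congruent _≈_ (_≈ᴵ_ L H) f × Bijective _≈_ (_≈ᴵ_ L H) f)
proposition29 𝒞 L H =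
  (λ D → Models.Restriction.isInterchangeAbstraction 𝒞 L H D) ,
  (λ {D} {D′} → restriction-cong D D′) ,
  (λ {D} {D′} → restriction-injective D D′) ,
  λ (a , isIA) → Construction.abstraction 𝒞 L H a isIA , λ {D} p →
    ≈ᴵ-trans 𝒞 L H (restriction-cong D (Construction.abstraction 𝒞 L H a isIA) p)
      (Construction.restriction-abstraction 𝒞 L H a isIA)
  where open Comparison 𝒞 L H
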